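{- Let $$a=\frac{1-q-\alpha+\gamma+\sqrt{(1-q-\alpha+\gamma)^2+4\alpha\gamma}}{2\alpha},\qquad b=\frac{1-q-\beta+\delta+\sqrt{(1-q-\beta+\delta)^2+4\beta\delta}}{2\beta},$$ $$c=\frac{1-q-\alpha+\gamma-\sqrt{(1-q-\alpha+\gamma)^2+4\alpha\gamma}}{2\alpha},\qquad d=\frac{1-q-\beta+\delta-\sqrt{(1-q-\beta+\delta)^2+4\beta\delta}}{2\beta}.$$ Then for every $n\ge 0$, $$Z_n(y;\alpha,\beta,\gamma,\delta;q)=(abcd;q)_n\Big(\frac{\alpha\beta}{1-q}\Big)^n\sum_{k=0}^n\frac{(ab,ac/y,ad;q)_k}{(abcd;q)_k}q^k\sum_{j=0}^k q^{ -j^2}(a^2/y)^{ -j}\frac{(1+y+q^{j}a+q^{ -j}y/a)^n}{(q,q^{ -2j+1}y/a^2;q)_{j}\,(q,a^2q^{1+2j}/y;q)_{k-j}}.$$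
   Context: $(x;q)_n=\prod_{k=0}^{n-1}(1-xq^k)$ and $(a_1,\dots,a_s;q)_n=\prod_{r=1}^s(a_r;q)_n$. A staircase tableau of size $n$ is a filling of the Young diagram of staircase shape $(n,n-1,\dots,1)$ (English convention: row $r$ consists of columns $1,\dots,n+1-r$; the diagonal boxes are the last boxes of the rows) in which each box is empty or labeled by one of $\alpha,\beta,\gamma,\delta$, such that: no diagonal box is empty; every box in the same row and to the left of a $\beta$ or a $\delta$ is empty; every box in the same column and above an $\alpha$ or a $\gamma$ is empty. The type of $T$ is the word in $\{\bullet,\circ\}^n$ obtained by reading the diagonal boxes from northeast to southwest, writing $\bullet$ for $\alpha$ or $\delta$ and $\circ$ for $\beta$ or $\gamma$. Each empty box is assigned $q$ or $1$ according to the nearest labeled box to its right in its row and the nearest labeled box below it in its column: it gets $1$ if it sees a $\beta$ to its right; $q$ if it sees a $\delta$ to its right; $1$ if it sees an $\alpha$ or $\gamma$ to its right and an $\alpha$ or $\delta$ below it; $q$ if it sees an $\alpha$ or $\gamma$ to its right and a $\beta$ or $\gamma$ below it. The weight $\mathrm{wt}(T)$ is the product of all labels $\alpha,\beta,\gamma,\delta$ in $T$ and all assigned $q$'s. Let $t(T)$ be the number of $\bullet$'s in the type of $T$, and $Z_n(y;\alpha,\beta,\gamma,\delta;q)=\sum_T \mathrm{wt}(T)\,y^{t(T)}$, summed over all staircase tableaux of size $n$ (the fugacity partition function). -}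

module Defs where

open import Level using (Level)
open import Algebra.Bundles using (CommutativeRing)
open import Data.Bool using (Bool; true; false; _∧_; _∨_; not; if_then_else_)
open import Data.Nat as ℕ using (ℕ; zero; suc; _≡ᵇ_; _∸_)
open import Data.List using (List; []; _∷_; map; concatMap; upTo; foldr; length; filterᵇ)
open import Data.Product using (_×_; _,_)

-- Staircase tableaux (purely combinatorial part)
--
-- Coordinates are 0-indexed: row r (0 ≤ r < n) has the boxes (r , c)
-- with 0 ≤ c < n - r; the diagonal box of row r is (r , n - 1 - r).
-- Row 0 is the top row (English convention), so "to the right" means
-- larger c and "below" means larger r.

data Label : Set where
  emp lα lβ lγ lδ : Label

labels : List Label
labels = emp ∷ lα ∷ lβ ∷ lγ ∷ lδ ∷ []

-- A filling of the staircase shape: list of rows, row r a list of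
-- length n - r.
allB : {A : Set} → (A → Bool) → List A → Bool
allB p []       = true
allB p (x ∷ xs) = p x ∧ allB p xs

Filling : Set
Filling = List (List Label)

allRows : ℕ → List (List Label)
allRows zero    = [] ∷ []
allRows (suc m) = concatMap (λ l → map (l ∷_) (allRows m)) labels

fillingsWith : List ℕ → List Filling
fillingsWith []       = [] ∷ []
fillingsWith (m ∷ ms) = concatMap (λ row → map (row ∷_) (fillingsWith ms)) (allRows m)

allFillings : ℕ → List Filling
allFillings n = fillingsWith (map (n ∸_) (upTo n))

nth : List Label → ℕ → Label
nth []       _       = emp
nth (x ∷ xs) zero    = x
nth (x ∷ xs) (suc i) = nth xs i

rowOf : Filling → ℕ → List Label
rowOf []       _       = []
rowOf (x ∷ xs) zero    = x
rowOf (x ∷ xs) (suc i) = rowOf xs i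

get : Filling → ℕ → ℕ → Label
get T r c = nth (rowOf T r) c

isEmp isBD isAG isBullet : Label → Bool
isEmp emp = true
isEmp _   = false
isBD lβ = true
isBD lδ = true
isBD _  = false
isAG lα = true
isAG lγ = true
isAG _  = false
isBullet lα = true
isBullet lδ = true
isBullet _  = false

boxes : ℕ → List (ℕ × ℕ)
boxes n = concatMap (λ r → map (r ,_) (upTo (n ∸ r))) (upTo n)

boxOK : ℕ → Filling → ℕ × ℕ → Bool
boxOK n T (r , c) =
  (if suc (r ℕ.+ c) ≡ᵇ n then not (isEmp (get T r c)) else true)
  ∧ (if isBD (get T r c) then allB (λ c' → isEmp (get T r c')) (upTo c) else true)
  ∧ (if isAG (get T r c) then allB (λ r' → isEmp (get T r' c)) (upTo r) else true)

-- T (assumed of staircase shape of size n) is a staircase tableau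
isStaircase : ℕ → Filling → Bool
isStaircase n T = allB (boxOK n T) (boxes n)

staircaseTableaux : ℕ → List Filling
staircaseTableaux n = filterᵇ (isStaircase n) (allFillings n)

firstLabeled : List Label → Label
firstLabeled []         = emp
firstLabeled (emp ∷ xs) = firstLabeled xs
firstLabeled (x ∷ xs)   = x

rightOf : ℕ → Filling → ℕ → ℕ → Label
rightOf n T r c = firstLabeled (map (λ i → get T r (suc c ℕ.+ i)) (upTo (n ∸ r ∸ suc c)))

belowOf : ℕ → Filling → ℕ → ℕ → Label
belowOf n T r c = firstLabeled (map (λ i → get T (suc r ℕ.+ i) c) (upTo (n ∸ c ∸ suc r)))

bullets : ℕ → Filling → ℕ
bullets n T = length (filterᵇ (λ r → isBullet (get T r (n ∸ suc r))) (upTo n))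

module _ {c ℓ : Level} (R : CommutativeRing c ℓ) where
  open CommutativeRing R

  infixr 8 _^′_
  _^′_ : Carrier → ℕ → Carrier
  x ^′ zero  = 1#
  x ^′ suc n = x * (x ^′ n)

  sumR : List Carrier → Carrier
  sumR = foldr _+_ 0#

  prodR : List Carrier → Carrier
  prodR = foldr _*_ 1#

  qPoch : Carrier → Carrier → ℕ → Carrier
  qPoch x q m = prodR (map (λ i → 1# - x * (q ^′ i)) (upTo m))

  module _ (α β γ δ q : Carrier) where

    labelWt : Label → Carrier
    labelWt emp = 1#
    labelWt lα  = α
    labelWt lβ  = β
    labelWt lγ  = γ
    labelWt lδ  = δ

    emptyWt : Label → Label → Carrier
    emptyWt lβ _  = 1#
    emptyWt lδ _  = q
    emptyWt lα lα = 1#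
    emptyWt lα lδ = 1#
    emptyWt lα lβ = q
    emptyWt lα lγ = q
    emptyWt lγ lα = 1#
    emptyWt lγ lδ = 1#
    emptyWt lγ lβ = q
    emptyWt lγ lγ = q
    emptyWt _  _  = 1#   -- never occurs in a staircase tableau

    boxWt : ℕ → Filling → ℕ × ℕ → Carrier
    boxWt n T (r , c) with get T r c
    ... | emp = emptyWt (rightOf n T r c) (belowOf n T r c)
    ... | l   = labelWt l

    wt : ℕ → Filling → Carrier
    wt n T = prodR (map (boxWt n T) (boxes n))

    Z : ℕ → Carrier → Carrier
    Z n y = sumR (map (λ T → wt n T * (y ^′ bullets n T)) (staircaseTableaux n))

  -- Right-hand side of Theorem 1.13.  'inv' is the field inverse
  -- (x⁻¹ = inv x); negative powers q^{-m} are written (inv q)^m.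

  module _ (inv : Carrier → Carrier) (q y α β a b c d : Carrier) where

    denomKJ : ℕ → ℕ → Carrier
    denomKJ k j =
      qPoch q q j * qPoch ((inv q ^′ (2 ℕ.* j)) * q * y * inv (a * a)) q j
      * (qPoch q q (k ∸ j) * qPoch (a * a * (q ^′ (1 ℕ.+ 2 ℕ.* j)) * inv y) q (k ∸ j))

    innerTerm : ℕ → ℕ → ℕ → Carrier
    innerTerm n k j =
      (inv q ^′ (j ℕ.* j)) * (inv (a * a * inv y) ^′ j)
      * ((1# + y + (q ^′ j) * a + (inv q ^′ j) * y * inv a) ^′ n)
      * inv (denomKJ k j)

    outerTerm : ℕ → ℕ → Carrier
    outerTerm n k =
      qPoch (a * b) q k * qPoch (a * c * inv y) q k * qPoch (a * d) q k
      * inv (qPoch (a * b * c * d) q k) * (q ^′ k)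
      * sumR (map (innerTerm n k) (upTo (suc k)))

    RHS : ℕ → Carrier
    RHS n = qPoch (a * b * c * d) q n * ((α * β * inv (1# - q)) ^′ n)
            * sumR (map (outerTerm n) (upTo (suc n)))

{-# OPTIONS --safe #-}

-- Give a tableau the monomial Xⁱ Yʲ, where i rows have leftmost label α or γ, and j rows have
-- leftmost label δ.  Adding a new leftmost column acts on polynomials in X and Y by D if its bottom
-- label is α or δ, and by E if it is β or γ, where
--   D 1 = α X + δ Y,  D Y = q Y D,  D X = X D + δ Y (D + E),
--   E 1 = β + γ X,    E Y = q Y E,  E X = q X E + β (D + E),
-- so that Z_n is (y D + E)ⁿ 1 at X = Y = 1.  The operator W with
--   W 1 = - γ δ,  W Y = q Y W - (1 - q) α β,  W X = X W + (1 - q) δ E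
-- satisfies W D = q D W and W E = q E W, hence it acts by the scalar - γ δ q^m on every image of 1
-- under m letters D and E; expressing X Y W and E D - q D E through W then gives the matrix ansatz,
-- with the factor L_m = α β - γ δ q^m for words of length m + 1.
--
-- After division by these factors, let x_k = 1 + y + a q^k + y / (a q^k) and let the functional ω_{k+1}
-- be ω_k preceded by (1 - q) (y D + E) - x_k.  The left boundary relation of ω_k is that of ω_0 with
-- a q^k for a, so the values ω_k(1) are an explicit product.  The theorem is Newton's expansion
-- of the n-th power in the nodes x_0, x_1, …; the inner sums are its divided differences.
module Submission where

open import Defs
open import Level using (Level)
open import Algebra.Bundles using (CommutativeRing)
open import Algebra.Solver.Ring.AlmostCommutativeRing
  using (fromCommutativeRing; _-Raw-AlmostCommutative⟶_; Induced-equivalence)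
import Algebra.Properties.Semiring.Mult.TCOptimised as Mult
import Algebra.Solver.Ring
open import Data.Bool using (Bool; true; false; _∧_; _∨_; not; if_then_else_)
import Data.Bool.Properties as 𝔹
import Data.Integer as ℤ
import Data.Integer.Properties as ℤₚ
open import Data.List using (List; []; _∷_; _++_; length; map; concatMap; applyUpTo; upTo; drop; filterᵇ)
import Data.List.Properties as Listₚ
open import Data.List.Relation.Unary.All using (All; []; _∷_)
open import Data.Maybe using (just; nothing)
open import Data.Nat as ℕ using (ℕ; zero; suc; _≤_; _<_; z≤n; s≤s; _∸_; _≡ᵇ_)
import Data.Nat.Properties as ℕₚ
open import Data.Nat.Solver using (module +-*-Solver)
open import Data.Product using (_×_; _,_; proj₁; proj₂; ∃-syntax)
open import Function using (_∘_; id)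
open import Relation.Binary.Definitions using (WeaklyDecidable)
import Relation.Binary.PropositionalEquality as P
open import Relation.Nullary using (¬_; yes; no)

-- `W` originates at the right boundary: it is the quotient of `β D - δ Y E - α β X` by `X Y`, and
-- its recursion amounts to a proof that this division is possible. It isolates the dependence on
-- the length of a word, which keeps `D` and `E` from satisfying the matrix ansatz as operators. The
-- factors L_m are known to be invertible only for m < n. The relations of the normalised
-- functionals are therefore stated up to a length, and each passage from ω_k to ω_{k+1} uses up one
-- letter; for k < n this leaves enough to compute ω_{k+1}(1). No summation theorem for basic
-- hypergeometric series enters: the divided differences are used through their recursion alone, and
-- the one q-identity to prove is that they vanish on the constant 1. On the side of tableaux the
-- obstacle is a mismatch of directions: the rules for `D` and `E` take off the lowest row with
-- leftmost label α or γ, whereas columns, as lists, are taken apart from the top. Functionals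
-- refined by the topmost label of the new column reconcile the two.

module IntegerSolver {c ℓ : Level} (R : CommutativeRing c ℓ) where
  open import Data.Integer using (+_; -[1+_])
  open CommutativeRing R hiding (zero)
  open import Algebra.Properties.Ring ring
  open import Relation.Binary.Reasoning.Setoid setoid
  open Mult semiring using (×-homo-+; ×1-homo-*) renaming (_×_ to _×′_)

  -- With the optimised multiples, `ι 0` and `ι 1` are definitionally `0#` and `1#`, so the morphism
  -- below preserves both constants by `refl`.
  ι : ℕ → Carrier
  ι n = n ×′ 1#

  ⟦_⟧ℤ : ℤ.ℤ → Carrier
  ⟦ + n ⟧ℤ      = ι n
  ⟦ -[1+ n ] ⟧ℤ = - ι (suc n)

  cancel₁ : ∀ x y z → (x + y) - (x + z) ≈ y - z
  cancel₁ x y z = begin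
    (x + y) - (x + z)       ≈⟨ +-cong (+-comm x y) (sym (-‿+-comm x z)) ⟩
    (y + x) + (- x + - z)   ≈⟨ +-assoc y x _ ⟩
    y + (x + (- x + - z))   ≈⟨ +-congˡ (sym (+-assoc x _ _)) ⟩
    y + ((x - x) + - z)     ≈⟨ +-congˡ (+-congʳ (-‿inverseʳ x)) ⟩
    y + (0# + - z)          ≈⟨ +-congˡ (+-identityˡ _) ⟩
    y - z                   ∎

  ⊖-homo : ∀ m n → ⟦ m ℤ.⊖ n ⟧ℤ ≈ ι m - ι n
  ⊖-homo m zero = sym (trans (+-congˡ -0#≈0#) (+-identityʳ _))
  ⊖-homo zero (suc n) = sym (+-identityˡ _)
  ⊖-homo (suc m) (suc n) = begin
    ⟦ suc m ℤ.⊖ suc n ⟧ℤ     ≡⟨ P.cong ⟦_⟧ℤ (ℤₚ.[1+m]⊖[1+n]≡m⊖n m n) ⟩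
    ⟦ m ℤ.⊖ n ⟧ℤ             ≈⟨ ⊖-homo m n ⟩
    ι m - ι n                ≈⟨ sym (cancel₁ 1# _ _) ⟩
    (1# + ι m) - (1# + ι n)  ≈⟨ sym (+-cong (×-homo-+ 1# 1 m) (-‿cong (×-homo-+ 1# 1 n))) ⟩
    ι (suc m) - ι (suc n)    ∎

  +-homo : ∀ i j → ⟦ i ℤ.+ j ⟧ℤ ≈ ⟦ i ⟧ℤ + ⟦ j ⟧ℤ
  +-homo (+ m) (+ n) = ×-homo-+ 1# m n
  +-homo (+ m) -[1+ n ] = ⊖-homo m (suc n)
  +-homo -[1+ m ] (+ n) = trans (⊖-homo n (suc m)) (+-comm _ _)
  +-homo -[1+ m ] -[1+ n ] = begin
    - ι (suc (suc (m ℕ.+ n)))    ≡⟨ P.cong (λ k → - ι k) (P.cong suc (P.sym (ℕₚ.+-suc m n))) ⟩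
    - ι (suc m ℕ.+ suc n)        ≈⟨ -‿cong (×-homo-+ 1# (suc m) (suc n)) ⟩
    - (ι (suc m) + ι (suc n))    ≈⟨ sym (-‿+-comm _ _) ⟩
    - ι (suc m) + - ι (suc n)    ∎

  -‿homo : ∀ i → ⟦ ℤ.- i ⟧ℤ ≈ - ⟦ i ⟧ℤ
  -‿homo (+ zero)  = sym -0#≈0#
  -‿homo (+ suc n) = refl
  -‿homo -[1+ n ]  = sym (-‿involutive _)

  *-homo⁺ : ∀ m j → ⟦ + m ℤ.* j ⟧ℤ ≈ ι m * ⟦ j ⟧ℤ
  *-homo⁺ m (+ n) = begin
    ⟦ + m ℤ.* + n ⟧ℤ    ≡⟨ P.cong ⟦_⟧ℤ (P.sym (ℤₚ.pos-* m n)) ⟩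
    ι (m ℕ.* n)         ≈⟨ ×1-homo-* m n ⟩
    ι m * ι n           ∎
  *-homo⁺ m -[1+ n ] = begin
    ⟦ + m ℤ.* ℤ.- (+ suc n) ⟧ℤ    ≡⟨ P.cong ⟦_⟧ℤ (P.sym (ℤₚ.neg-distribʳ-* (+ m) (+ suc n))) ⟩
    ⟦ ℤ.- (+ m ℤ.* + suc n) ⟧ℤ    ≈⟨ -‿homo (+ m ℤ.* + suc n) ⟩
    - ⟦ + m ℤ.* + suc n ⟧ℤ        ≈⟨ -‿cong (*-homo⁺ m (+ suc n)) ⟩
    - (ι m * ι (suc n))           ≈⟨ -‿distribʳ-* _ _ ⟩
    ι m * - ι (suc n)             ∎

  *-homo : ∀ i j → ⟦ i ℤ.* j ⟧ℤ ≈ ⟦ i ⟧ℤ * ⟦ j ⟧ℤ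
  *-homo (+ m) j = *-homo⁺ m j
  *-homo -[1+ m ] j = begin
    ⟦ ℤ.- (+ suc m) ℤ.* j ⟧ℤ    ≡⟨ P.cong ⟦_⟧ℤ (P.sym (ℤₚ.neg-distribˡ-* (+ suc m) j)) ⟩
    ⟦ ℤ.- (+ suc m ℤ.* j) ⟧ℤ    ≈⟨ -‿homo (+ suc m ℤ.* j) ⟩
    - ⟦ + suc m ℤ.* j ⟧ℤ        ≈⟨ -‿cong (*-homo⁺ (suc m) j) ⟩
    - (ι (suc m) * ⟦ j ⟧ℤ)      ≈⟨ -‿distribˡ-* _ _ ⟩
    - ι (suc m) * ⟦ j ⟧ℤ        ∎

  ℤ-morphism : CommutativeRing.rawRing ℤₚ.+-*-commutativeRing -Raw-AlmostCommutative⟶ fromCommutativeRing R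
  ℤ-morphism = record
    { ⟦_⟧ = ⟦_⟧ℤ ; +-homo = +-homo ; *-homo = *-homo ; -‿homo = -‿homo
    ; 0-homo = refl ; 1-homo = refl }

  -- An abstract carrier has no decidable equality; with coefficients in ℤ the solver can recognise
  -- that monomials cancel.
  ℤ-weaklyDecidable : WeaklyDecidable (Induced-equivalence ℤ-morphism)
  ℤ-weaklyDecidable i j with i ℤ.≟ j
  ... | yes i≡j = just (reflexive (P.cong ⟦_⟧ℤ i≡j))
  ... | no  _   = nothing

  open Algebra.Solver.Ring _ (fromCommutativeRing R) ℤ-morphism ℤ-weaklyDecidable public
    using (solve; _:=_; _:+_; _:*_; _:-_; :-_; con; Polynomial)

  :1 : ∀ {n} → Polynomial n
  :1 = con (+ 1)

-- Equations as linear combinations of hypotheses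

module LinComb {c ℓ : Level} (R : CommutativeRing c ℓ) where
  open CommutativeRing R hiding (zero)

  vanish : ∀ {x y} c → x ≈ y → c * (x - y) ≈ 0#
  vanish c x≈y = trans (*-congˡ (trans (+-congʳ x≈y) (-‿inverseʳ _))) (zeroʳ c)

  -- Reasoning modulo hypotheses becomes a certificate: once the cofactor `c` is given, `h` is a
  -- plain ring identity that the solver checks.
  lincomb₁ : ∀ {L R′ x y} c → x ≈ y → L ≈ R′ + c * (x - y) → L ≈ R′
  lincomb₁ c e h = trans h (trans (+-congˡ (vanish c e)) (+-identityʳ _))

  lincomb₂ : ∀ {L R′ x y x′ y′} c c′ → x ≈ y → x′ ≈ y′ →
             L ≈ R′ + c * (x - y) + c′ * (x′ - y′) → L ≈ R′
  lincomb₂ c c′ e e′ h = lincomb₁ c e (lincomb₁ c′ e′ h)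

  lincomb₃ : ∀ {L R′ x y x′ y′ x″ y″} c c′ c″ → x ≈ y → x′ ≈ y′ → x″ ≈ y″ →
             L ≈ R′ + c * (x - y) + c′ * (x′ - y′) + c″ * (x″ - y″) → L ≈ R′
  lincomb₃ c c′ c″ e e′ e″ h = lincomb₂ c c′ e e′ (lincomb₁ c″ e″ h)

-- Powers, finite sums and products

module Sums {ℓc ℓ : Level} (F : CommutativeRing ℓc ℓ) where
  open CommutativeRing F hiding (zero)
  open IntegerSolver F
  open import Relation.Binary.Reasoning.Setoid setoid

  infixr 8 _^_
  _^_ : Carrier → ℕ → Carrier
  _^_ = _^′_ F

  ^-+ : ∀ x m n → x ^ (m ℕ.+ n) ≈ x ^ m * x ^ n
  ^-+ x zero    n = sym (*-identityˡ _)
  ^-+ x (suc m) n = trans (*-congˡ (^-+ x m n)) (sym (*-assoc _ _ _))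

  ^-cong : ∀ {x y} n → x ≈ y → x ^ n ≈ y ^ n
  ^-cong zero    x≈y = refl
  ^-cong (suc n) x≈y = *-cong x≈y (^-cong n x≈y)

  ^-* : ∀ x y n → (x * y) ^ n ≈ x ^ n * y ^ n
  ^-* x y zero    = sym (*-identityˡ _)
  ^-* x y (suc n) = trans (*-congˡ (^-* x y n))
    (solve 4 (λ x y a b → x :* y :* (a :* b) := x :* a :* (y :* b)) refl x y _ _)

  ^-inverse : ∀ {x x⁻¹} n → x * x⁻¹ ≈ 1# → x ^ n * x⁻¹ ^ n ≈ 1#
  ^-inverse zero    h = *-identityˡ _
  ^-inverse {x} {x⁻¹} (suc n) h = trans
    (solve 4 (λ x y a b → x :* a :* (y :* b) := x :* y :* (a :* b)) refl x x⁻¹ _ _)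
    (trans (*-cong h (^-inverse n h)) (*-identityˡ _))

  -- The first term is taken off, as in `applyUpTo`, so the list sums and products of the statement
  -- translate up to propositional equality.
  Sum Prod : ℕ → (ℕ → Carrier) → Carrier
  Sum zero    f = 0#
  Sum (suc n) f = f 0 + Sum n (f ∘ suc)
  Prod zero    f = 1#
  Prod (suc n) f = f 0 * Prod n (f ∘ suc)

  sumR-map-applyUpTo : ∀ (f : ℕ → Carrier) g n → sumR F (map f (applyUpTo g n)) P.≡ Sum n (f ∘ g)
  sumR-map-applyUpTo f g zero    = P.refl
  sumR-map-applyUpTo f g (suc n) = P.cong (f (g 0) +_) (sumR-map-applyUpTo f (g ∘ suc) n)

  prodR-map-applyUpTo : ∀ (f : ℕ → Carrier) g n → prodR F (map f (applyUpTo g n)) P.≡ Prod n (f ∘ g)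
  prodR-map-applyUpTo f g zero    = P.refl
  prodR-map-applyUpTo f g (suc n) = P.cong (f (g 0) *_) (prodR-map-applyUpTo f (g ∘ suc) n)

  Sum-cong : ∀ n {f g} → (∀ i → i < n → f i ≈ g i) → Sum n f ≈ Sum n g
  Sum-cong zero    h = refl
  Sum-cong (suc n) h = +-cong (h 0 (s≤s z≤n)) (Sum-cong n (λ i i<n → h (suc i) (s≤s i<n)))

  Sum-snoc : ∀ n f → Sum (suc n) f ≈ Sum n f + f n
  Sum-snoc zero    f = +-comm _ _
  Sum-snoc (suc n) f = trans (+-congˡ (Sum-snoc n (f ∘ suc))) (sym (+-assoc _ _ _))

  Sum-lin : ∀ n s t f g → Sum n (λ i → s * f i + t * g i) ≈ s * Sum n f + t * Sum n g
  Sum-lin zero    s t f g = solve 2 (λ s t → con (ℤ.+ 0) := s :* con (ℤ.+ 0) :+ t :* con (ℤ.+ 0)) refl s t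
  Sum-lin (suc n) s t f g = trans (+-congˡ (Sum-lin n s t (f ∘ suc) (g ∘ suc)))
    (solve 6 (λ s t a b c d → (s :* a :+ t :* b) :+ (s :* c :+ t :* d) := s :* (a :+ c) :+ t :* (b :+ d))
      refl s t _ _ _ _)

  Sum-*ˡ : ∀ n s f → Sum n (λ i → s * f i) ≈ s * Sum n f
  Sum-*ˡ zero    s f = sym (zeroʳ s)
  Sum-*ˡ (suc n) s f = trans (+-congˡ (Sum-*ˡ n s (f ∘ suc))) (sym (distribˡ s _ _))

  Sum-+ : ∀ n f g → Sum n (λ i → f i + g i) ≈ Sum n f + Sum n g
  Sum-+ zero    f g = sym (+-identityˡ _)
  Sum-+ (suc n) f g = trans (+-congˡ (Sum-+ n (f ∘ suc) (g ∘ suc)))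
    (solve 4 (λ a b c d → (a :+ b) :+ (c :+ d) := (a :+ c) :+ (b :+ d)) refl _ _ _ _)

  Prod-cong : ∀ n {f g} → (∀ i → i < n → f i ≈ g i) → Prod n f ≈ Prod n g
  Prod-cong zero    h = refl
  Prod-cong (suc n) h = *-cong (h 0 (s≤s z≤n)) (Prod-cong n (λ i i<n → h (suc i) (s≤s i<n)))

  Prod-snoc : ∀ n f → Prod (suc n) f ≈ Prod n f * f n
  Prod-snoc zero    f = *-comm _ _
  Prod-snoc (suc n) f = trans (*-congˡ (Prod-snoc n (f ∘ suc))) (sym (*-assoc _ _ _))

  Prod-* : ∀ n f g → Prod n (λ i → f i * g i) ≈ Prod n f * Prod n g
  Prod-* zero    f g = sym (*-identityˡ _)
  Prod-* (suc n) f g = trans (*-congˡ (Prod-* n (f ∘ suc) (g ∘ suc)))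
    (solve 4 (λ a b c d → (a :* b) :* (c :* d) := (a :* c) :* (b :* d)) refl _ _ _ _)

  Prod-1 : ∀ n {f} → (∀ i → i < n → f i ≈ 1#) → Prod n f ≈ 1#
  Prod-1 zero    h = refl
  Prod-1 (suc n) h = trans (*-cong (h 0 (s≤s z≤n)) (Prod-1 n (λ i i<n → h (suc i) (s≤s i<n)))) (*-identityˡ _)

-- Transfer operators for a new leftmost column

data Letter : Set where
  𝐃 𝐄 : Letter

Word : Set
Word = List Letter

module Transfer {ℓc ℓ : Level} (F : CommutativeRing ℓc ℓ)
                (α β γ δ q : CommutativeRing.Carrier F) where
  open CommutativeRing F hiding (zero)
  open IntegerSolver F
  open LinComb F
  open import Relation.Binary.Reasoning.Setoid setoid

  -- Polynomials in X and Y are handled through the functionals φ on them, with φ i j = φ (Xⁱ Yʲ).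
  -- Operators on polynomials act on functionals by transposition, which reverses compositions.
  G : Set ℓc
  G = ℕ → ℕ → Carrier

  infix 4 _≐_
  _≐_ : G → G → Set ℓ
  φ ≐ ψ = ∀ i j → φ i j ≈ ψ i j

  X Y : G → G
  X φ i j = φ (suc i) j
  Y φ i j = φ i (suc j)

  -- A functional for each possible topmost label of the new column.
  record H : Set ℓc where
    constructor ⟨_,_,_,_⟩
    field atα atβ atγ atδ : G
  open H public

  mapH : (G → G) → H → H
  mapH f ⟨ a , b , c , d ⟩ = ⟨ f a , f b , f c , f d ⟩

  const : G → H
  const φ = ⟨ φ , φ , φ , φ ⟩

  -- The clauses at `suc i` single out the lowest row with leftmost label α or γ. If its new box is
  -- empty, the box has weight 1 above α or δ and weight q above β or γ. If it is labelled, the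
  -- bottom label must be β or δ, and the rest of the column looks like one whose bottom box is this
  -- box, of either type: hence the sum `d̂ + ê`. A row with leftmost label δ has an empty new box
  -- of weight q.
  d̂ ê : H → G
  d̂ ψ zero    zero    = α * atα ψ 1 0 + δ * atδ ψ 0 1
  d̂ ψ zero    (suc j) = q * d̂ (mapH Y ψ) zero j
  d̂ ψ (suc i) j       = d̂ (mapH X ψ) i j + δ * (d̂ (mapH Y ψ) i j + ê (mapH Y ψ) i j)
  ê ψ zero    zero    = β * atβ ψ 0 0 + γ * atγ ψ 1 0
  ê ψ zero    (suc j) = q * ê (mapH Y ψ) zero j
  ê ψ (suc i) j       = q * ê (mapH X ψ) i j + β * (d̂ ψ i j + ê ψ i j)

  d e : G → G
  d φ = d̂ (const φ)
  e φ = ê (const φ)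

  -- The transpose of W.
  w : G → G
  w φ zero    zero    = - (γ * δ * φ 0 0)
  w φ zero    (suc j) = q * w (Y φ) zero j - (1# - q) * (α * β) * φ zero j
  w φ (suc i) j       = w (X φ) i j + (1# - q) * δ * e φ i j

  record _≐ᴴ_ (ψ χ : H) : Set ℓ where
    constructor ≐⟨_,_,_,_⟩
    field
      ≐α : atα ψ ≐ atα χ
      ≐β : atβ ψ ≐ atβ χ
      ≐γ : atγ ψ ≐ atγ χ
      ≐δ : atδ ψ ≐ atδ χ

  X≐ : ∀ {ψ χ} → ψ ≐ᴴ χ → mapH X ψ ≐ᴴ mapH X χ
  X≐ ≐⟨ a , b , c , d ⟩ = ≐⟨ (λ i → a (suc i)) , (λ i → b (suc i)) , (λ i → c (suc i)) , (λ i → d (suc i)) ⟩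

  Y≐ : ∀ {ψ χ} → ψ ≐ᴴ χ → mapH Y ψ ≐ᴴ mapH Y χ
  Y≐ ≐⟨ a , b , c , d ⟩ =
    ≐⟨ (λ i j → a i (suc j)) , (λ i j → b i (suc j)) , (λ i j → c i (suc j)) , (λ i j → d i (suc j)) ⟩

  d̂-cong : ∀ {ψ χ} → ψ ≐ᴴ χ → d̂ ψ ≐ d̂ χ
  ê-cong : ∀ {ψ χ} → ψ ≐ᴴ χ → ê ψ ≐ ê χ
  d̂-cong p zero zero = +-cong (*-congˡ (_≐ᴴ_.≐α p 1 0)) (*-congˡ (_≐ᴴ_.≐δ p 0 1))
  d̂-cong p zero (suc j) = *-congˡ (d̂-cong (Y≐ p) zero j)
  d̂-cong p (suc i) j =
    +-cong (d̂-cong (X≐ p) i j) (*-congˡ (+-cong (d̂-cong (Y≐ p) i j) (ê-cong (Y≐ p) i j)))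
  ê-cong p zero zero = +-cong (*-congˡ (_≐ᴴ_.≐β p 0 0)) (*-congˡ (_≐ᴴ_.≐γ p 1 0))
  ê-cong p zero (suc j) = *-congˡ (ê-cong (Y≐ p) zero j)
  ê-cong p (suc i) j =
    +-cong (*-congˡ (ê-cong (X≐ p) i j)) (*-congˡ (+-cong (d̂-cong p i j) (ê-cong p i j)))

  lin : Carrier → Carrier → G → G → G
  lin s t φ χ i j = s * φ i j + t * χ i j

  linᴴ : Carrier → Carrier → H → H → H
  linᴴ s t ⟨ a , b , c , d ⟩ ⟨ a′ , b′ , c′ , d′ ⟩ =
    ⟨ lin s t a a′ , lin s t b b′ , lin s t c c′ , lin s t d d′ ⟩

  d̂-lin : ∀ s t ψ χ → d̂ (linᴴ s t ψ χ) ≐ lin s t (d̂ ψ) (d̂ χ)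
  ê-lin : ∀ s t ψ χ → ê (linᴴ s t ψ χ) ≐ lin s t (ê ψ) (ê χ)
  d̂-lin s t ψ χ zero zero =
    solve 8 (λ α δ s t a a′ b b′ →
      α :* (s :* a :+ t :* a′) :+ δ :* (s :* b :+ t :* b′)
      := s :* (α :* a :+ δ :* b) :+ t :* (α :* a′ :+ δ :* b′)) refl α δ s t _ _ _ _
  d̂-lin s t ψ χ zero (suc j) = trans (*-congˡ (d̂-lin s t (mapH Y ψ) (mapH Y χ) zero j))
    (solve 5 (λ q s t a b → q :* (s :* a :+ t :* b) := s :* (q :* a) :+ t :* (q :* b)) refl q s t _ _)
  d̂-lin s t ψ χ (suc i) j =
    trans (+-cong (d̂-lin s t (mapH X ψ) (mapH X χ) i j)
                  (*-congˡ (+-cong (d̂-lin s t (mapH Y ψ) (mapH Y χ) i j) (ê-lin s t (mapH Y ψ) (mapH Y χ) i j))))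
    (solve 9 (λ δ s t a a′ b b′ c c′ →
      (s :* a :+ t :* a′) :+ δ :* ((s :* b :+ t :* b′) :+ (s :* c :+ t :* c′))
      := s :* (a :+ δ :* (b :+ c)) :+ t :* (a′ :+ δ :* (b′ :+ c′))) refl δ s t _ _ _ _ _ _)
  ê-lin s t ψ χ zero zero =
    solve 8 (λ α δ s t a a′ b b′ →
      α :* (s :* a :+ t :* a′) :+ δ :* (s :* b :+ t :* b′)
      := s :* (α :* a :+ δ :* b) :+ t :* (α :* a′ :+ δ :* b′)) refl β γ s t _ _ _ _
  ê-lin s t ψ χ zero (suc j) = trans (*-congˡ (ê-lin s t (mapH Y ψ) (mapH Y χ) zero j))
    (solve 5 (λ q s t a b → q :* (s :* a :+ t :* b) := s :* (q :* a) :+ t :* (q :* b)) refl q s t _ _)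
  ê-lin s t ψ χ (suc i) j =
    trans (+-cong (*-congˡ (ê-lin s t (mapH X ψ) (mapH X χ) i j))
                  (*-congˡ (+-cong (d̂-lin s t ψ χ i j) (ê-lin s t ψ χ i j))))
    (solve 10 (λ q β s t a a′ b b′ c c′ →
      q :* (s :* a :+ t :* a′) :+ β :* ((s :* b :+ t :* b′) :+ (s :* c :+ t :* c′))
      := s :* (q :* a :+ β :* (b :+ c)) :+ t :* (q :* a′ :+ β :* (b′ :+ c′))) refl q β s t _ _ _ _ _ _)

  -- The definition imposes this rule only on pure powers of Y. The recursion in `i` leaves the
  -- exponent of Y alone and is linear, so the rule spreads to all monomials.
  d̂-Y : ∀ ψ i j → d̂ ψ i (suc j) ≈ q * d̂ (mapH Y ψ) i j
  ê-Y : ∀ ψ i j → ê ψ i (suc j) ≈ q * ê (mapH Y ψ) i j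
  d̂-Y ψ zero j = refl
  d̂-Y ψ (suc i) j =
    trans (+-cong (d̂-Y (mapH X ψ) i j) (*-congˡ (+-cong (d̂-Y (mapH Y ψ) i j) (ê-Y (mapH Y ψ) i j))))
    (solve 5 (λ q δ a b c → q :* a :+ δ :* (q :* b :+ q :* c) := q :* (a :+ δ :* (b :+ c))) refl q δ _ _ _)
  ê-Y ψ zero j = refl
  ê-Y ψ (suc i) j =
    trans (+-cong (*-congˡ (ê-Y (mapH X ψ) i j)) (*-congˡ (+-cong (d̂-Y ψ i j) (ê-Y ψ i j))))
    (solve 5 (λ q β a b c → q :* (q :* a) :+ β :* (q :* b :+ q :* c) := q :* (q :* a :+ β :* (b :+ c))) refl q β _ _ _)

  const-cong : ∀ {φ χ} → φ ≐ χ → const φ ≐ᴴ const χ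
  const-cong p = ≐⟨ p , p , p , p ⟩

  d-cong : ∀ {φ χ} → φ ≐ χ → d φ ≐ d χ
  d-cong p = d̂-cong (const-cong p)
  e-cong : ∀ {φ χ} → φ ≐ χ → e φ ≐ e χ
  e-cong p = ê-cong (const-cong p)

  d-lin : ∀ s t φ χ → d (lin s t φ χ) ≐ lin s t (d φ) (d χ)
  d-lin s t φ χ = d̂-lin s t (const φ) (const χ)
  e-lin : ∀ s t φ χ → e (lin s t φ χ) ≐ lin s t (e φ) (e χ)
  e-lin s t φ χ = ê-lin s t (const φ) (const χ)

  d-Y : ∀ φ i j → d φ i (suc j) ≈ q * d (Y φ) i j
  d-Y φ = d̂-Y (const φ)
  e-Y : ∀ φ i j → e φ i (suc j) ≈ q * e (Y φ) i j
  e-Y φ = ê-Y (const φ)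

  w-cong : ∀ {φ χ} → φ ≐ χ → w φ ≐ w χ
  w-cong p zero zero = -‿cong (*-congˡ (p 0 0))
  w-cong p zero (suc j) = +-cong (*-congˡ (w-cong (λ i j → p i (suc j)) zero j)) (-‿cong (*-congˡ (p zero j)))
  w-cong p (suc i) j = +-cong (w-cong (λ i → p (suc i)) i j) (*-congˡ (e-cong p i j))

  w-lin : ∀ s t φ χ → w (lin s t φ χ) ≐ lin s t (w φ) (w χ)
  w-lin s t φ χ zero zero =
    solve 5 (λ g s t a b → :- (g :* (s :* a :+ t :* b)) := s :* (:- (g :* a)) :+ t :* (:- (g :* b))) refl (γ * δ) s t _ _
  w-lin s t φ χ zero (suc j) = trans (+-congʳ (*-congˡ (w-lin s t (Y φ) (Y χ) zero j)))
    (solve 8 (λ q k s t a b x y → q :* (s :* a :+ t :* b) :- k :* (s :* x :+ t :* y)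
       := s :* (q :* a :- k :* x) :+ t :* (q :* b :- k :* y)) refl q ((1# - q) * (α * β)) s t _ _ _ _)
  w-lin s t φ χ (suc i) j = trans (+-cong (w-lin s t (X φ) (X χ) i j) (*-congˡ (e-lin s t φ χ i j)))
    (solve 7 (λ k s t a b x y → (s :* a :+ t :* b) :+ k :* (s :* x :+ t :* y)
       := s :* (a :+ k :* x) :+ t :* (b :+ k :* y)) refl ((1# - q) * δ) s t _ _ _ _)

  w-Y : ∀ φ i j → w φ i (suc j) ≈ q * w (Y φ) i j - (1# - q) * (α * β) * φ i j
  w-Y φ zero j = refl
  w-Y φ (suc i) j = trans (+-cong (w-Y (X φ) i j) (*-congˡ (e-Y φ i j)))
    (solve 6 (λ q k m a b c → (q :* a :- k :* b) :+ m :* (q :* c) := q :* (a :+ m :* c) :- k :* b)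
      refl q ((1# - q) * (α * β)) ((1# - q) * δ) _ _ _)

  -- X Y W = β D - δ Y E - α β X.
  w-XY : ∀ φ i j → w (X (Y φ)) i j ≈ β * d φ i j - δ * e (Y φ) i j - α * β * φ (suc i) j
  w-XY φ zero zero =
    solve 7 (λ α β γ δ x y z → :- (γ :* δ :* x)
      := β :* (α :* y :+ δ :* z) :- δ :* (β :* z :+ γ :* x) :- α :* β :* y) refl
      α β γ δ (φ 1 1) (φ 1 0) (φ 0 1)
  w-XY φ zero (suc j) = trans (+-congʳ (*-congˡ (w-XY (Y φ) zero j)))
    (solve 7 (λ α β δ q x y z →
      q :* (β :* x :- δ :* y :- α :* β :* z) :- (:1 :- q) :* (α :* β) :* z
      := β :* (q :* x) :- δ :* (q :* y) :- α :* β :* z) refl α β δ q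
      (d (Y φ) 0 j) (e (Y (Y φ)) 0 j) (φ 1 (suc j)))
  w-XY φ (suc i) j = trans (+-congʳ (w-XY (X φ) i j))
    (solve 9 (λ α β δ q x y z u v →
      (β :* x :- δ :* y :- α :* β :* z) :+ (:1 :- q) :* δ :* y
      := β :* (x :+ δ :* (u :+ v)) :- δ :* (q :* y :+ β :* (u :+ v)) :- α :* β :* z) refl α β δ q
      (d (X φ) i j) (e (X (Y φ)) i j) (φ (suc (suc i)) j) (d (Y φ) i j) (e (Y φ) i j))

  scale : Carrier → G → G
  scale s φ i j = s * φ i j

  d-scale : ∀ s φ → d (scale s φ) ≐ scale s (d φ)
  d-scale s φ i j = begin
    d (scale s φ) i j           ≈⟨ d-cong (λ _ _ → sym (trans (+-congˡ (zeroˡ _)) (+-identityʳ _))) i j ⟩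
    d (lin s 0# φ φ) i j        ≈⟨ d-lin s 0# φ φ i j ⟩
    s * d φ i j + 0# * d φ i j  ≈⟨ trans (+-congˡ (zeroˡ _)) (+-identityʳ _) ⟩
    s * d φ i j                 ∎

  e-scale : ∀ s φ → e (scale s φ) ≐ scale s (e φ)
  e-scale s φ i j = begin
    e (scale s φ) i j           ≈⟨ e-cong (λ _ _ → sym (trans (+-congˡ (zeroˡ _)) (+-identityʳ _))) i j ⟩
    e (lin s 0# φ φ) i j        ≈⟨ e-lin s 0# φ φ i j ⟩
    s * e φ i j + 0# * e φ i j  ≈⟨ trans (+-congˡ (zeroˡ _)) (+-identityʳ _) ⟩
    s * e φ i j                 ∎

  d-sum : ∀ φ χ → d (λ i j → φ i j + χ i j) ≐ (λ i j → d φ i j + d χ i j)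
  d-sum φ χ i j = trans (d-cong (λ _ _ → sym (+-cong (*-identityˡ _) (*-identityˡ _))) i j)
    (trans (d-lin 1# 1# φ χ i j) (+-cong (*-identityˡ _) (*-identityˡ _)))

  e-sum : ∀ φ χ → e (λ i j → φ i j + χ i j) ≐ (λ i j → e φ i j + e χ i j)
  e-sum φ χ i j = trans (e-cong (λ _ _ → sym (+-cong (*-identityˡ _) (*-identityˡ _))) i j)
    (trans (e-lin 1# 1# φ χ i j) (+-cong (*-identityˡ _) (*-identityˡ _)))

  w-scale : ∀ s φ → w (scale s φ) ≐ scale s (w φ)
  w-scale s φ i j = begin
    w (scale s φ) i j           ≈⟨ w-cong (λ _ _ → sym (trans (+-congˡ (zeroˡ _)) (+-identityʳ _))) i j ⟩
    w (lin s 0# φ φ) i j        ≈⟨ w-lin s 0# φ φ i j ⟩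
    s * w φ i j + 0# * w φ i j  ≈⟨ trans (+-congˡ (zeroˡ _)) (+-identityʳ _) ⟩
    s * w φ i j                 ∎

  w-sum : ∀ φ χ → w (λ i j → φ i j + χ i j) ≐ (λ i j → w φ i j + w χ i j)
  w-sum φ χ i j = trans (w-cong (λ _ _ → sym (+-cong (*-identityˡ _) (*-identityˡ _))) i j)
    (trans (w-lin 1# 1# φ χ i j) (+-cong (*-identityˡ _) (*-identityˡ _)))

  de : G → G
  de φ i j = d φ i j + e φ i j

  k₁ k₂ : Carrier
  k₁ = (1# - q) * δ
  k₂ = - ((1# - q) * (α * β))

  Yd : ∀ φ → Y (d φ) ≐ scale q (d (Y φ))
  Yd = d-Y
  Ye : ∀ φ → Y (e φ) ≐ scale q (e (Y φ))
  Ye = e-Y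
  Yw : ∀ φ → Y (w φ) ≐ lin q k₂ (w (Y φ)) φ
  Yw φ i j = trans (w-Y φ i j) (+-congˡ (-‿distribˡ-* _ _))
    where open import Algebra.Properties.Ring ring
  Xw : ∀ φ → X (w φ) ≐ lin 1# k₁ (w (X φ)) (e φ)
  Xw φ i j = +-congʳ (sym (*-identityˡ _))

  w-Xd : ∀ φ i j → w (X (d φ)) i j ≈ w (d (X φ)) i j + δ * (w (d (Y φ)) i j + w (e (Y φ)) i j)
  w-Xd φ i j = trans (w-sum (d (X φ)) (scale δ (de (Y φ))) i j)
    (+-congˡ (trans (w-scale δ (de (Y φ)) i j) (*-congˡ (w-sum (d (Y φ)) (e (Y φ)) i j))))

  e-Xd : ∀ φ i j → e (X (d φ)) i j ≈ e (d (X φ)) i j + δ * (e (d (Y φ)) i j + e (e (Y φ)) i j)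
  e-Xd φ i j = trans (e-sum (d (X φ)) (scale δ (de (Y φ))) i j)
    (+-congˡ (trans (e-scale δ (de (Y φ)) i j) (*-congˡ (e-sum (d (Y φ)) (e (Y φ)) i j))))

  w-Xe : ∀ φ i j → w (X (e φ)) i j ≈ q * w (e (X φ)) i j + β * (w (d φ) i j + w (e φ) i j)
  w-Xe φ i j = trans (w-lin q β (e (X φ)) (de φ) i j) (+-congˡ (*-congˡ (w-sum (d φ) (e φ) i j)))

  d-Xe : ∀ φ i j → d (X (e φ)) i j ≈ q * d (e (X φ)) i j + β * (d (d φ) i j + d (e φ) i j)
  d-Xe φ i j = trans (d-lin q β (e (X φ)) (de φ) i j) (+-congˡ (*-congˡ (d-sum (d φ) (e φ) i j)))

  d-Yw : ∀ φ i j → d (Y (w φ)) i j ≈ q * d (w (Y φ)) i j + k₂ * d φ i j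
  d-Yw φ i j = trans (d-cong (Yw φ) i j) (d-lin q k₂ (w (Y φ)) φ i j)

  e-Yw : ∀ φ i j → e (Y (w φ)) i j ≈ q * e (w (Y φ)) i j + k₂ * e φ i j
  e-Yw φ i j = trans (e-cong (Yw φ) i j) (e-lin q k₂ (w (Y φ)) φ i j)

  d-Xw : ∀ φ i j → d (X (w φ)) i j ≈ d (w (X φ)) i j + k₁ * d (e φ) i j
  d-Xw φ i j = trans (d-cong (Xw φ) i j) (trans (d-lin 1# k₁ (w (X φ)) (e φ) i j) (+-congʳ (*-identityˡ _)))

  e-Xw : ∀ φ i j → e (X (w φ)) i j ≈ e (w (X φ)) i j + k₁ * e (e φ) i j
  e-Xw φ i j = trans (e-cong (Xw φ) i j) (trans (e-lin 1# k₁ (w (X φ)) (e φ) i j) (+-congʳ (*-identityˡ _)))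

  w-Yd : ∀ φ i j → w (Y (d φ)) i j ≈ q * w (d (Y φ)) i j
  w-Yd φ i j = trans (w-cong (Yd φ) i j) (w-scale q (d (Y φ)) i j)
  w-Ye : ∀ φ i j → w (Y (e φ)) i j ≈ q * w (e (Y φ)) i j
  w-Ye φ i j = trans (w-cong (Ye φ) i j) (w-scale q (e (Y φ)) i j)
  d-Ye : ∀ φ i j → d (Y (e φ)) i j ≈ q * d (e (Y φ)) i j
  d-Ye φ i j = trans (d-cong (Ye φ) i j) (d-scale q (e (Y φ)) i j)
  e-Yd : ∀ φ i j → e (Y (d φ)) i j ≈ q * e (d (Y φ)) i j
  e-Yd φ i j = trans (e-cong (Yd φ) i j) (e-scale q (d (Y φ)) i j)
  e-Ye : ∀ φ i j → e (Y (e φ)) i j ≈ q * e (e (Y φ)) i j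
  e-Ye φ i j = trans (e-cong (Ye φ) i j) (e-scale q (e (Y φ)) i j)

  d-wXY : ∀ φ i j → d (w (X (Y φ))) i j ≈ β * d (d φ) i j - δ * d (e (Y φ)) i j - α * β * d (X φ) i j
  d-wXY φ i j = begin
    d (w (X (Y φ))) i j
      ≈⟨ d-cong (λ i j → trans (w-XY φ i j)
           (solve 6 (λ α β δ x y z → β :* x :- δ :* y :- α :* β :* z
             := :1 :* (β :* x :+ (:- δ) :* y) :+ (:- (α :* β)) :* z) refl α β δ _ _ _)) i j ⟩
    d (lin 1# (- (α * β)) (lin β (- δ) (d φ) (e (Y φ))) (X φ)) i j
      ≈⟨ d-lin _ _ _ _ i j ⟩
    1# * d (lin β (- δ) (d φ) (e (Y φ))) i j + - (α * β) * d (X φ) i j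
      ≈⟨ +-congʳ (*-congˡ (d-lin _ _ _ _ i j)) ⟩
    1# * (β * d (d φ) i j + - δ * d (e (Y φ)) i j) + - (α * β) * d (X φ) i j
      ≈⟨ solve 6 (λ α β δ x y z → :1 :* (β :* x :+ (:- δ) :* y) :+ (:- (α :* β)) :* z
             := β :* x :- δ :* y :- α :* β :* z) refl α β δ _ _ _ ⟩
    β * d (d φ) i j - δ * d (e (Y φ)) i j - α * β * d (X φ) i j ∎

  -- W D = q D W,  W E = q E W  and  E D - q D E = α β (D + E) + q Y (D + E) W.
  dw : ∀ φ i j → d (w φ) i j ≈ q * w (d φ) i j
  ew : ∀ φ i j → e (w φ) i j ≈ q * w (e φ) i j
  bulk : ∀ φ i j → d (e φ) i j ≈ q * e (d φ) i j + α * β * (d φ i j + e φ i j)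
                                  + q * (w (d (Y φ)) i j + w (e (Y φ)) i j)
  dw φ zero zero =
    solve 8 (λ α β γ δ q x y z →
      α :* (:- (γ :* δ :* x) :+ (:1 :- q) :* δ :* (β :* z :+ γ :* x))
        :+ δ :* (q :* (:- (γ :* δ :* y)) :- (:1 :- q) :* (α :* β) :* z)
      := q :* (:- (γ :* δ :* (α :* x :+ δ :* y)))) refl α β γ δ q (φ 1 0) (φ 0 1) (φ 0 0)
  dw φ i (suc j) = begin
    d (w φ) i (suc j)
      ≈⟨ trans (d-Y (w φ) i j) (*-congˡ (d-Yw φ i j)) ⟩
    q * (q * d (w (Y φ)) i j + k₂ * d φ i j)
      ≈⟨ *-congˡ (+-congʳ (*-congˡ (dw (Y φ) i j))) ⟩
    q * (q * (q * w (d (Y φ)) i j) + k₂ * d φ i j)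
      ≈⟨ solve 4 (λ q k x y → q :* (q :* (q :* x) :+ (:- k) :* y) := q :* (q :* (q :* x) :- k :* y)) refl q _ _ _ ⟩
    q * (q * (q * w (d (Y φ)) i j) - (1# - q) * (α * β) * d φ i j)
      ≈⟨ *-congˡ (+-congʳ (*-congˡ (w-Yd φ i j))) ⟨
    q * (q * w (Y (d φ)) i j - (1# - q) * (α * β) * d φ i j)
      ≈⟨ *-congˡ (w-Y (d φ) i j) ⟨
    q * w (d φ) i (suc j) ∎
  dw φ (suc i) zero = begin
    d (X (w φ)) i 0 + δ * (d (Y (w φ)) i 0 + e (Y (w φ)) i 0)
      ≈⟨ +-cong (d-Xw φ i 0) (*-congˡ (+-cong (d-Yw φ i 0) (e-Yw φ i 0))) ⟩
    (dwX + k₁ * deφ) + δ * ((q * dwY + k₂ * dφ) + (q * ewY + k₂ * eφ))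
      -- Commuting W with X produces `(1 - q) δ E`, hence the term `d (e φ)`; rewriting it needs
      -- `bulk`, which is why the three relations are proved by one simultaneous induction.
      ≈⟨ lincomb₁ 1# (dw (X φ) i 0) (lincomb₃ (δ * q) (δ * q) k₁ (dw (Y φ) i 0) (ew (Y φ) i 0) (bulk φ i 0)
        (solve 14 (λ α β δ q dwX deφ edφ dwY ewY dφ eφ wdX wdY weY →
          (dwX :+ (:1 :- q) :* δ :* deφ) :+ δ :* ((q :* dwY :+ (:- ((:1 :- q) :* (α :* β))) :* dφ)
             :+ (q :* ewY :+ (:- ((:1 :- q) :* (α :* β))) :* eφ))
          := q :* ((wdX :+ δ :* (wdY :+ weY)) :+ (:1 :- q) :* δ :* edφ)
             :+ :1 :* (dwX :- q :* wdX)
             :+ δ :* q :* (dwY :- q :* wdY) :+ δ :* q :* (ewY :- q :* weY)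
             :+ (:1 :- q) :* δ :* (deφ :- (q :* edφ :+ α :* β :* (dφ :+ eφ) :+ q :* (wdY :+ weY))))
         refl α β δ q dwX deφ edφ dwY ewY dφ eφ wdX wdY weY)) ⟩
    q * ((wdX + δ * (wdY + weY)) + k₁ * edφ)
      ≈⟨ *-congˡ (+-congʳ (w-Xd φ i 0)) ⟨
    q * (w (X (d φ)) i 0 + k₁ * edφ) ∎
    where
    dwX = d (w (X φ)) i 0
    deφ = d (e φ) i 0
    edφ = e (d φ) i 0
    dwY = d (w (Y φ)) i 0
    ewY = e (w (Y φ)) i 0
    dφ = d φ i 0
    eφ = e φ i 0
    wdX = w (d (X φ)) i 0
    wdY = w (d (Y φ)) i 0
    weY = w (e (Y φ)) i 0
  ew φ zero zero =
    solve 6 (λ β γ δ q x y →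
      β :* (:- (γ :* δ :* x)) :+ γ :* (:- (γ :* δ :* y) :+ (:1 :- q) :* δ :* (β :* x :+ γ :* y))
      := q :* (:- (γ :* δ :* (β :* x :+ γ :* y)))) refl β γ δ q (φ 0 0) (φ 1 0)
  ew φ i (suc j) = begin
    e (w φ) i (suc j)
      ≈⟨ trans (e-Y (w φ) i j) (*-congˡ (e-Yw φ i j)) ⟩
    q * (q * e (w (Y φ)) i j + k₂ * e φ i j)
      ≈⟨ *-congˡ (+-congʳ (*-congˡ (ew (Y φ) i j))) ⟩
    q * (q * (q * w (e (Y φ)) i j) + k₂ * e φ i j)
      ≈⟨ solve 4 (λ q k x y → q :* (q :* (q :* x) :+ (:- k) :* y) := q :* (q :* (q :* x) :- k :* y)) refl q _ _ _ ⟩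
    q * (q * (q * w (e (Y φ)) i j) - (1# - q) * (α * β) * e φ i j)
      ≈⟨ *-congˡ (+-congʳ (*-congˡ (w-Ye φ i j))) ⟨
    q * (q * w (Y (e φ)) i j - (1# - q) * (α * β) * e φ i j)
      ≈⟨ *-congˡ (w-Y (e φ) i j) ⟨
    q * w (e φ) i (suc j) ∎
  ew φ (suc i) zero = begin
    q * e (X (w φ)) i 0 + β * (d (w φ) i 0 + e (w φ) i 0)
      ≈⟨ +-cong (*-congˡ (trans (e-Xw φ i 0) (+-congʳ (ew (X φ) i 0))))
                (*-congˡ (+-cong (dw φ i 0) (ew φ i 0))) ⟩
    q * (q * weX + k₁ * eeφ) + β * (q * wd + q * we)
      ≈⟨ solve 7 (λ q β k a b c d → q :* (q :* a :+ k :* b) :+ β :* (q :* c :+ q :* d)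
           := q :* ((q :* a :+ β :* (c :+ d)) :+ k :* b)) refl q β k₁ weX eeφ wd we ⟩
    q * ((q * weX + β * (wd + we)) + k₁ * eeφ)
      ≈⟨ *-congˡ (+-congʳ (w-Xe φ i 0)) ⟨
    q * (w (X (e φ)) i 0 + k₁ * eeφ) ∎
    where
    weX = w (e (X φ)) i 0
    eeφ = e (e φ) i 0
    wd = w (d φ) i 0
    we = w (e φ) i 0
  bulk φ zero zero =
    solve 11 (λ α β γ δ q x₀₀ x₁₀ x₀₁ x₂₀ x₁₁ x₀₂ →
      let e₁₀ = q :* (β :* x₁₀ :+ γ :* x₂₀) :+ β :* ((α :* x₁₀ :+ δ :* x₀₁) :+ (β :* x₀₀ :+ γ :* x₁₀))
          e₀₁ = q :* (β :* x₀₁ :+ γ :* x₁₁)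
          d₁₀ = (α :* x₂₀ :+ δ :* x₁₁) :+ δ :* ((α :* x₁₁ :+ δ :* x₀₂) :+ (β :* x₀₁ :+ γ :* x₁₁))
      in α :* e₁₀ :+ δ :* e₀₁
      := q :* (β :* (α :* x₁₀ :+ δ :* x₀₁) :+ γ :* d₁₀)
         :+ α :* β :* ((α :* x₁₀ :+ δ :* x₀₁) :+ (β :* x₀₀ :+ γ :* x₁₀))
         :+ q :* (:- (γ :* δ :* (α :* x₁₁ :+ δ :* x₀₂)) :+ :- (γ :* δ :* (β :* x₀₁ :+ γ :* x₁₁))))
      refl α β γ δ q (φ 0 0) (φ 1 0) (φ 0 1) (φ 2 0) (φ 1 1) (φ 0 2)
  bulk φ i (suc j) = begin
    d (e φ) i (suc j)
      ≈⟨ trans (d-Y (e φ) i j) (*-congˡ (d-Ye φ i j)) ⟩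
    q * (q * deY)
      ≈⟨ *-congˡ (*-congˡ (bulk (Y φ) i j)) ⟩
    q * (q * (q * edY + α * β * (dY + eY) + q * (wdYY + weYY)))
      ≈⟨ solve 8 (λ α β q edY dY eY wdYY weYY →
          q :* (q :* (q :* edY :+ α :* β :* (dY :+ eY) :+ q :* (wdYY :+ weYY)))
          := q :* (q :* (q :* edY)) :+ α :* β :* (q :* dY :+ q :* eY)
             :+ q :* ((q :* (q :* wdYY) :- (:1 :- q) :* (α :* β) :* dY) :+ (q :* (q :* weYY) :- (:1 :- q) :* (α :* β) :* eY)))
          refl α β q edY dY eY wdYY weYY ⟩
    q * (q * (q * edY)) + α * β * (q * dY + q * eY)
      + q * ((q * (q * wdYY) - (1# - q) * (α * β) * dY) + (q * (q * weYY) - (1# - q) * (α * β) * eY))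
      ≈⟨ +-cong (+-cong (*-congˡ (trans (e-Y (d φ) i j) (*-congˡ (e-Yd φ i j))))
                        (*-congˡ (+-cong (d-Y φ i j) (e-Y φ i j))))
                (*-congˡ (+-cong (trans (w-Y (d (Y φ)) i j) (+-congʳ (*-congˡ (w-Yd (Y φ) i j))))
                                 (trans (w-Y (e (Y φ)) i j) (+-congʳ (*-congˡ (w-Ye (Y φ) i j)))))) ⟨
    q * e (d φ) i (suc j) + α * β * (d φ i (suc j) + e φ i (suc j))
      + q * (w (d (Y φ)) i (suc j) + w (e (Y φ)) i (suc j)) ∎
    where
    deY = d (e (Y φ)) i j
    edY = e (d (Y φ)) i j
    dY = d (Y φ) i j
    eY = e (Y φ) i j
    wdYY = w (d (Y (Y φ))) i j
    weYY = w (e (Y (Y φ))) i j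
  bulk φ (suc i) zero = begin
    d (X (e φ)) i 0 + δ * (d (Y (e φ)) i 0 + e (Y (e φ)) i 0)
      ≈⟨ +-cong (d-Xe φ i 0) (*-congˡ (+-cong (d-Ye φ i 0) (e-Ye φ i 0))) ⟩
    (q * deX + β * (ddφ + deφ)) + δ * (q * deY + q * eeY)
      -- The induction hypotheses at `X φ`, `φ` and `Y φ` do not account for `d (d φ)`. What they
      -- leave over is `q - 1` times the difference in `wdXY-eq`, that is, `w-XY` composed with D,
      -- combined with `W D = q D W`.
      ≈⟨ lincomb₁ (q - 1#) wdXY-eq (lincomb₃ q β δ (bulk (X φ) i 0) (bulk φ i 0) (bulk (Y φ) i 0)
        (solve 23 (λ α β δ q deX ddφ deφ deY eeY edX edY edφ dX eX dY eY dφ eφ wdXY weXY wdY weY wYY →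
          (q :* deX :+ β :* (ddφ :+ deφ)) :+ δ :* (q :* deY :+ q :* eeY)
          := q :* (q :* (edX :+ δ :* (edY :+ eeY)) :+ β :* (ddφ :+ edφ))
             :+ α :* β :* ((dX :+ δ :* (dY :+ eY)) :+ (q :* eX :+ β :* (dφ :+ eφ)))
             :+ q :* (((wdXY :+ δ :* wYY) :+ (:1 :- q) :* δ :* edY)
                    :+ ((q :* weXY :+ β :* (wdY :+ weY)) :+ (:1 :- q) :* δ :* eeY))
             :+ (q :- :1) :* (q :* wdXY :- (β :* ddφ :- δ :* deY :- α :* β :* dX))
             :+ q :* (deX :- (q :* edX :+ α :* β :* (dX :+ eX) :+ q :* (wdXY :+ weXY)))
             :+ β :* (deφ :- (q :* edφ :+ α :* β :* (dφ :+ eφ) :+ q :* (wdY :+ weY)))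
             :+ δ :* (deY :- (q :* edY :+ α :* β :* (dY :+ eY) :+ q :* wYY)))
         refl α β δ q deX ddφ deφ deY eeY edX edY edφ dX eX dY eY dφ eφ wdXY weXY wdY weY (wdYY + weYY))) ⟩
    q * (q * (edX + δ * (edY + eeY)) + β * (ddφ + edφ))
      + α * β * ((dX + δ * (dY + eY)) + (q * eX + β * (dφ + eφ)))
      + q * (((wdXY + δ * (wdYY + weYY)) + k₁ * edY) + ((q * weXY + β * (wdY + weY)) + k₁ * eeY))
      ≈⟨ +-cong (+-congʳ (*-congˡ (+-congʳ (*-congˡ (e-Xd φ i 0)))))
                (*-congˡ (+-cong (+-congʳ (w-Xd (Y φ) i 0)) (+-congʳ (w-Xe (Y φ) i 0)))) ⟨
    q * e (d φ) (suc i) 0 + α * β * (d φ (suc i) 0 + e φ (suc i) 0)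
      + q * (w (d (Y φ)) (suc i) 0 + w (e (Y φ)) (suc i) 0) ∎
    where
    deX = d (e (X φ)) i 0
    ddφ = d (d φ) i 0
    deφ = d (e φ) i 0
    deY = d (e (Y φ)) i 0
    eeY = e (e (Y φ)) i 0
    edX = e (d (X φ)) i 0
    edY = e (d (Y φ)) i 0
    edφ = e (d φ) i 0
    dX = d (X φ) i 0
    eX = e (X φ) i 0
    dY = d (Y φ) i 0
    eY = e (Y φ) i 0
    dφ = d φ i 0
    eφ = e φ i 0
    wdXY = w (d (X (Y φ))) i 0
    weXY = w (e (X (Y φ))) i 0
    wdY = w (d (Y φ)) i 0
    weY = w (e (Y φ)) i 0
    wdYY = w (d (Y (Y φ))) i 0
    weYY = w (e (Y (Y φ))) i 0
    wdXY-eq : q * wdXY ≈ β * ddφ - δ * deY - α * β * dX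
    wdXY-eq = trans (sym (dw (X (Y φ)) i 0)) (d-wXY φ i 0)

-- Values of words and the matrix ansatz with length-dependent factors

module Words {ℓc ℓ : Level} (F : CommutativeRing ℓc ℓ)
                (α β γ δ q : CommutativeRing.Carrier F) where
  open CommutativeRing F hiding (zero)
  open IntegerSolver F
  open LinComb F
  open Transfer F α β γ δ q
  open import Relation.Binary.Reasoning.Setoid setoid

  open Sums F

  op : Letter → G → G
  op 𝐃 = d
  op 𝐄 = e

  op-cong : ∀ l {φ χ} → φ ≐ χ → op l φ ≐ op l χ
  op-cong 𝐃 = d-cong
  op-cong 𝐄 = e-cong

  op-lin : ∀ l s t φ χ → op l (lin s t φ χ) ≐ lin s t (op l φ) (op l χ)
  op-lin 𝐃 = d-lin
  op-lin 𝐄 = e-lin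

  op-scale : ∀ l s φ → op l (scale s φ) ≐ scale s (op l φ)
  op-scale 𝐃 = d-scale
  op-scale 𝐄 = e-scale

  op-w : ∀ l φ i j → op l (w φ) i j ≈ q * w (op l φ) i j
  op-w 𝐃 = dw
  op-w 𝐄 = ew

  Y-op : ∀ l φ → Y (op l φ) ≐ scale q (op l (Y φ))
  Y-op 𝐃 = Yd
  Y-op 𝐄 = Ye

  -- Since transposition reverses products, the first letter of a word acts first on polynomials. It
  -- belongs to the column that is added first and ends up rightmost, so words are read from
  -- northeast to southwest.
  act : Word → G → G
  act []      φ = φ
  act (l ∷ u) φ = op l (act u φ)

  act-++ : ∀ u v φ → act (u ++ v) φ P.≡ act u (act v φ)
  act-++ []      v φ = P.refl
  act-++ (l ∷ u) v φ = P.cong (op l) (act-++ u v φ)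

  act-cong : ∀ u {φ χ} → φ ≐ χ → act u φ ≐ act u χ
  act-cong []      p = p
  act-cong (l ∷ u) p = op-cong l (act-cong u p)

  act-lin : ∀ u s t φ χ → act u (lin s t φ χ) ≐ lin s t (act u φ) (act u χ)
  act-lin []      s t φ χ i j = refl
  act-lin (l ∷ u) s t φ χ i j = trans (op-cong l (act-lin u s t φ χ) i j) (op-lin l s t _ _ i j)

  act-w : ∀ u φ → act u (w φ) ≐ scale (q ^ length u) (w (act u φ))
  act-w []      φ i j = sym (*-identityˡ _)
  act-w (l ∷ u) φ i j = begin
    op l (act u (w φ)) i j                          ≈⟨ op-cong l (act-w u φ) i j ⟩
    op l (scale (q ^ length u) (w (act u φ))) i j   ≈⟨ op-scale l _ _ i j ⟩
    q ^ length u * op l (w (act u φ)) i j           ≈⟨ *-congˡ (op-w l _ i j) ⟩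
    q ^ length u * (q * w (act (l ∷ u) φ) i j)      ≈⟨ solve 3 (λ p q x → p :* (q :* x) := (q :* p) :* x) refl _ q _ ⟩
    (q * q ^ length u) * w (act (l ∷ u) φ) i j      ∎

  one : G
  one _ _ = 1#

  -- `one` is evaluation at X = Y = 1 and does not see a factor Y; only the passage of Y through the
  -- letters leaves a trace, one q for each.
  Y-act : ∀ u → Y (act u one) ≐ scale (q ^ length u) (act u one)
  Y-act []      i j = sym (*-identityˡ _)
  Y-act (l ∷ u) i j = begin
    Y (op l (act u one)) i j                        ≈⟨ Y-op l _ i j ⟩
    q * op l (Y (act u one)) i j                    ≈⟨ *-congˡ (op-cong l (Y-act u) i j) ⟩
    q * op l (scale (q ^ length u) (act u one)) i j ≈⟨ *-congˡ (op-scale l _ _ i j) ⟩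
    q * (q ^ length u * act (l ∷ u) one i j)        ≈⟨ sym (*-assoc _ _ _) ⟩
    (q * q ^ length u) * act (l ∷ u) one i j        ∎

  f : Word → Carrier
  f u = act u one 0 0

  f-++ : ∀ u v → f (u ++ v) ≈ act u (act v one) 0 0
  f-++ u v = reflexive (P.cong (λ φ → φ 0 0) (act-++ u v one))

  L : ℕ → Carrier
  L m = α * β - γ * δ * q ^ m

  -- In the term `q Y (D + E) W` of `bulk`, Y passes the letters of `v` and W those of `u`. The
  -- powers of q combine to q to the |u| + 1 + |v|, so the coefficient depends on the total length
  -- alone.
  f-bulk : ∀ u v → f (u ++ 𝐃 ∷ 𝐄 ∷ v) ≈
           q * f (u ++ 𝐄 ∷ 𝐃 ∷ v) + L (length u ℕ.+ suc (length v)) * (f (u ++ 𝐃 ∷ v) + f (u ++ 𝐄 ∷ v))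
  f-bulk u v = begin
    f (u ++ 𝐃 ∷ 𝐄 ∷ v)
      ≈⟨ f-++ u _ ⟩
    act u (d (e ψ)) 0 0
      ≈⟨ act-cong u step 0 0 ⟩
    act u (lin q 1# (e (d ψ)) (lin (α * β) (q * q ^ length v) (lin 1# 1# (d ψ) (e ψ)) (w (lin 1# 1# (d ψ) (e ψ))))) 0 0
      ≈⟨ trans (act-lin u _ _ _ _ 0 0) (+-congˡ (*-congˡ (act-lin u _ _ _ _ 0 0))) ⟩
    q * act u (e (d ψ)) 0 0 + 1# * (α * β * act u S 0 0 + (q * q ^ length v) * act u (w S) 0 0)
      ≈⟨ +-congˡ (*-congˡ (+-congˡ (*-congˡ (act-w u S 0 0)))) ⟩
    q * act u (e (d ψ)) 0 0
      + 1# * (α * β * act u S 0 0 + (q * q ^ length v) * (q ^ length u * - (γ * δ * act u S 0 0)))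
      ≈⟨ solve 8 (λ q α β γ δ p r x → x :+ :1 :* (α :* β :* p :+ r :* (q :* :- (γ :* δ :* p)))
           := x :+ (α :* β :- γ :* δ :* (q :* r)) :* p) refl (q ^ length u) α β γ δ (act u S 0 0) (q * q ^ length v) _ ⟩
    q * act u (e (d ψ)) 0 0 + (α * β - γ * δ * (q ^ length u * q ^ suc (length v))) * act u S 0 0
      ≈⟨ +-cong (*-congˡ (f-++ u _)) (*-cong (+-congˡ (-‿cong (*-congˡ (^-+ q (length u) (suc (length v))))))
           (trans (+-cong (f-++ u _) (f-++ u _)) (sym (trans (act-lin u _ _ _ _ 0 0)
             (+-cong (*-identityˡ _) (*-identityˡ _)))))) ⟨
    q * f (u ++ 𝐄 ∷ 𝐃 ∷ v) + L (length u ℕ.+ suc (length v)) * (f (u ++ 𝐃 ∷ v) + f (u ++ 𝐄 ∷ v)) ∎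
    where
    ψ = act v one
    S = lin 1# 1# (d ψ) (e ψ)
    w-opY : ∀ l i j → w (op l (Y ψ)) i j ≈ q ^ length v * w (op l ψ) i j
    w-opY l i j = trans (w-cong (λ i j → trans (op-cong l (Y-act v) i j) (op-scale l _ ψ i j)) i j)
                        (w-scale _ _ i j)
    step : ∀ i j → d (e ψ) i j ≈ q * e (d ψ) i j + 1# * (α * β * S i j + (q * q ^ length v) * w S i j)
    step i j = begin
      d (e ψ) i j
        ≈⟨ bulk ψ i j ⟩
      q * e (d ψ) i j + α * β * (d ψ i j + e ψ i j) + q * (w (d (Y ψ)) i j + w (e (Y ψ)) i j)
        ≈⟨ +-congˡ (*-congˡ (+-cong (w-opY 𝐃 i j) (w-opY 𝐄 i j))) ⟩
      q * e (d ψ) i j + α * β * (d ψ i j + e ψ i j) + q * (q ^ length v * w (d ψ) i j + q ^ length v * w (e ψ) i j)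
        ≈⟨ solve 8 (λ q x k y z p a b → x :+ k :* (y :+ z) :+ q :* (p :* a :+ p :* b)
             := x :+ :1 :* (k :* (:1 :* y :+ :1 :* z) :+ (q :* p) :* (:1 :* a :+ :1 :* b))) refl q _ (α * β) _ _ _ _ _ ⟩
      q * e (d ψ) i j + 1# * (α * β * S i j + (q * q ^ length v) * (1# * w (d ψ) i j + 1# * w (e ψ) i j))
        ≈⟨ +-congˡ (*-congˡ (+-congˡ (*-congˡ (w-lin 1# 1# (d ψ) (e ψ) i j)))) ⟨
      q * e (d ψ) i j + 1# * (α * β * S i j + (q * q ^ length v) * w S i j) ∎

  -- At X = Y = 1, `w-XY` reads `β D - δ E = α β + W`, and W becomes a scalar by `act-w`.
  f-right : ∀ u → β * f (u ++ 𝐃 ∷ []) - δ * f (u ++ 𝐄 ∷ []) ≈ L (length u) * f u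
  f-right u = begin
    β * f (u ++ 𝐃 ∷ []) - δ * f (u ++ 𝐄 ∷ [])
      ≈⟨ +-cong (*-congˡ (f-++ u _)) (-‿cong (*-congˡ (f-++ u _))) ⟩
    β * act u (d one) 0 0 - δ * act u (e one) 0 0
      ≈⟨ +-congˡ (-‿distribˡ-* δ _) ⟩
    lin β (- δ) (act u (d one)) (act u (e one)) 0 0
      ≈⟨ act-lin u _ _ _ _ 0 0 ⟨
    act u (lin β (- δ) (d one) (e one)) 0 0
      ≈⟨ act-cong u (λ i j → lincomb₁ (- 1#) (w-XY one i j)
          (solve 6 (λ α β δ x y z → β :* x :+ (:- δ) :* y
            := (α :* β :* :1 :+ :1 :* z) :+ (:- :1) :* (z :- (β :* x :- δ :* y :- α :* β :* :1)))
            refl α β δ _ _ _)) 0 0 ⟩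
    act u (lin (α * β) 1# one (w one)) 0 0
      ≈⟨ trans (act-lin u _ _ _ _ 0 0) (+-congˡ (*-congˡ (act-w u one 0 0))) ⟩
    α * β * f u + 1# * (q ^ length u * - (γ * δ * f u))
      ≈⟨ solve 6 (λ α β γ δ p x → α :* β :* x :+ :1 :* (p :* :- (γ :* δ :* x)) := (α :* β :- γ :* δ :* p) :* x)
           refl α β γ δ _ _ ⟩
    L (length u) * f u ∎
    where open import Algebra.Properties.Ring ring

  -- The first letter acts on the polynomial 1. In `α E 1 - γ D 1` the terms in X cancel, and
  -- `α β - γ δ Y` remains.
  f-left : ∀ u → α * f (𝐄 ∷ u) - γ * f (𝐃 ∷ u) ≈ L (length u) * f u
  f-left u = trans
    (solve 7 (λ α β γ δ x y z → α :* (β :* x :+ γ :* y) :- γ :* (α :* y :+ δ :* z) := α :* β :* x :- γ :* δ :* z)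
      refl α β γ δ (f u) (act u one 1 0) (act u one 0 1))
    (trans (+-congˡ (-‿cong (*-congˡ (Y-act u 0 0))))
      (solve 6 (λ α β γ δ p x → α :* β :* x :- γ :* δ :* (p :* x) := (α :* β :- γ :* δ :* p) :* x)
        refl α β γ δ _ _))

-- Functionals of the matrix ansatz and their moments

module Moments {ℓc ℓ : Level} (F : CommutativeRing ℓc ℓ)
  (q y b c d : CommutativeRing.Carrier F) where
  open CommutativeRing F hiding (zero)
  open IntegerSolver F
  open LinComb F
  open import Relation.Binary.Reasoning.Setoid setoid

  Functional : Set ℓc
  Functional = Word → Carrier

  -- `N` bounds the length of the longest word in a relation. `Right` is `β D - δ E = 1` in terms of
  -- the roots: `b d = - δ / β` and `(1 + b) (1 + d) = (1 - q) / β`. `Left` has the same form, with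
  -- a parameter `A` that varies along the construction.
  Bulk Right : ℕ → Functional → Set ℓ
  Bulk N ω = ∀ u v → length u ℕ.+ suc (suc (length v)) ≤ N →
    ω (u ++ 𝐃 ∷ 𝐄 ∷ v) ≈ q * ω (u ++ 𝐄 ∷ 𝐃 ∷ v) + (ω (u ++ 𝐃 ∷ v) + ω (u ++ 𝐄 ∷ v))
  Right N ω = ∀ u → length u < N →
    (1# - q) * (ω (u ++ 𝐃 ∷ []) + b * d * ω (u ++ 𝐄 ∷ [])) ≈ (1# + b) * (1# + d) * ω u

  Left : ℕ → Carrier → Functional → Set ℓ
  Left N A ω = ∀ u → length u < N →
    (1# - q) * (ω (𝐄 ∷ u) + A * c * ω (𝐃 ∷ u)) ≈ (1# + A) * (1# + c) * ω u

  node : Carrier → Carrier → Carrier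
  node A Ai = 1# + y + A + y * Ai

  next : Carrier → Carrier → Functional → Functional
  next A Ai ω u = (1# - q) * (y * ω (𝐃 ∷ u) + ω (𝐄 ∷ u)) - node A Ai * ω u

  -- This is the reason for the choice of the node. After `E` is eliminated by the left relation,
  -- the constant `(1 + A) (1 + c) - node A Ai` equals `- (y - A c) (1 + 1/A)`, so it shares the
  -- factor `y - A c` with the coefficient of `D`.
  next-left : ∀ {N A Ai ω} → A * Ai ≈ 1# → Left N A ω → ∀ u → length u < N →
              next A Ai ω u ≈ (y - A * c) * ((1# - q) * ω (𝐃 ∷ u) - (1# + Ai) * ω u)
  next-left {N} {A} {Ai} {ω} AAi left u u<N = lincomb₂ 1# (- (c * ω u)) (left u u<N) AAi
    (solve 8 (λ q y c A Ai ωD ωE ω →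
       (:1 :- q) :* (y :* ωD :+ ωE) :- (:1 :+ y :+ A :+ y :* Ai) :* ω
       := (y :- A :* c) :* ((:1 :- q) :* ωD :- (:1 :+ Ai) :* ω)
          :+ :1 :* ((:1 :- q) :* (ωE :+ A :* c :* ωD) :- (:1 :+ A) :* (:1 :+ c) :* ω)
          :+ (:- (c :* ω)) :* (A :* Ai :- :1)) refl q y c A Ai (ω (𝐃 ∷ u)) (ω (𝐄 ∷ u)) (ω u))

  Bulk-next : ∀ {N} A Ai {ω} → Bulk (suc N) ω → Bulk N (next A Ai ω)
  Bulk-next A Ai {ω} bulk u v le = lincomb₃ ((1# - q) * y) (1# - q) (- node A Ai)
    (bulk (𝐃 ∷ u) v (s≤s le)) (bulk (𝐄 ∷ u) v (s≤s le)) (bulk u v (ℕₚ.m≤n⇒m≤1+n le))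
    (solve 15 (λ q y x d₁ e₁ o₁ d₂ e₂ o₂ d₃ e₃ o₃ d₄ e₄ o₄ →
      (:1 :- q) :* (y :* d₁ :+ e₁) :- x :* o₁
      := q :* ((:1 :- q) :* (y :* d₂ :+ e₂) :- x :* o₂)
         :+ (((:1 :- q) :* (y :* d₃ :+ e₃) :- x :* o₃) :+ ((:1 :- q) :* (y :* d₄ :+ e₄) :- x :* o₄))
         :+ (:1 :- q) :* y :* (d₁ :- (q :* d₂ :+ (d₃ :+ d₄)))
         :+ (:1 :- q) :* (e₁ :- (q :* e₂ :+ (e₃ :+ e₄)))
         :+ (:- x) :* (o₁ :- (q :* o₂ :+ (o₃ :+ o₄)))) refl q y (node A Ai) _ _ _ _ _ _ _ _ _ _ _ _)

  Right-next : ∀ {N} A Ai {ω} → Right (suc N) ω → Right N (next A Ai ω)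
  Right-next A Ai {ω} right u lt = lincomb₃ ((1# - q) * y) (1# - q) (- node A Ai)
    (right (𝐃 ∷ u) (s≤s lt)) (right (𝐄 ∷ u) (s≤s lt)) (right u (ℕₚ.m≤n⇒m≤1+n lt))
    (solve 14 (λ q y b d x d₁ e₁ o₁ d₂ e₂ o₂ d₃ e₃ o₃ →
      (:1 :- q) :* (((:1 :- q) :* (y :* d₁ :+ e₁) :- x :* o₁) :+ b :* d :* ((:1 :- q) :* (y :* d₂ :+ e₂) :- x :* o₂))
      := (:1 :+ b) :* (:1 :+ d) :* ((:1 :- q) :* (y :* d₃ :+ e₃) :- x :* o₃)
         :+ (:1 :- q) :* y :* ((:1 :- q) :* (d₁ :+ b :* d :* d₂) :- (:1 :+ b) :* (:1 :+ d) :* d₃)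
         :+ (:1 :- q) :* ((:1 :- q) :* (e₁ :+ b :* d :* e₂) :- (:1 :+ b) :* (:1 :+ d) :* e₃)
         :+ (:- x) :* ((:1 :- q) :* (o₁ :+ b :* d :* o₂) :- (:1 :+ b) :* (:1 :+ d) :* o₃))
      refl q y b d (node A Ai) _ _ _ _ _ _ _ _ _)

  Left-cong : ∀ {N A A′ ω} → A ≈ A′ → Left N A ω → Left N A′ ω
  Left-cong A≈A′ left u lt = trans (*-congˡ (+-congˡ (*-congʳ (*-congʳ (sym A≈A′)))))
    (trans (left u lt) (*-congʳ (*-congʳ (+-congˡ A≈A′))))

  -- By `next-left` it is enough to treat `(1 - q) D - (1 + 1/A)` in place of `next`. Exchanging the
  -- first two letters by the bulk relation brings in the q that turns `A` into `q A`.
  Left-next : ∀ {N A Ai ω} → A * Ai ≈ 1# → Bulk (suc N) ω → Left (suc N) A ω → Left N (q * A) (next A Ai ω)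
  Left-next {N} {A} {Ai} {ω} AAi bulk left u u<N = begin
    (1# - q) * (next A Ai ω (𝐄 ∷ u) + q * A * c * next A Ai ω (𝐃 ∷ u))
      ≈⟨ *-congˡ (+-cong (next-left AAi left (𝐄 ∷ u) (s≤s u<N)) (*-congˡ (next-left AAi left (𝐃 ∷ u) (s≤s u<N)))) ⟩
    (1# - q) * ((y - A * c) * χE + q * A * c * ((y - A * c) * χD))
      ≈⟨ solve 5 (λ q z k χE χD → (:1 :- q) :* (z :* χE :+ k :* (z :* χD)) := z :* ((:1 :- q) :* (χE :+ k :* χD)))
           refl q (y - A * c) (q * A * c) χE χD ⟩
    (y - A * c) * ((1# - q) * (χE + q * A * c * χD))
      ≈⟨ *-congˡ core ⟩
    (y - A * c) * ((1# + q * A) * (1# + c) * χ)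
      ≈⟨ solve 3 (λ x y z → x :* (y :* z) := y :* (x :* z)) refl _ _ _ ⟩
    (1# + q * A) * (1# + c) * ((y - A * c) * χ)
      ≈⟨ *-congˡ (next-left AAi left u (ℕₚ.m≤n⇒m≤1+n u<N)) ⟨
    (1# + q * A) * (1# + c) * next A Ai ω u ∎
    where
    χE = (1# - q) * ω (𝐃 ∷ 𝐄 ∷ u) - (1# + Ai) * ω (𝐄 ∷ u)
    χD = (1# - q) * ω (𝐃 ∷ 𝐃 ∷ u) - (1# + Ai) * ω (𝐃 ∷ u)
    χ  = (1# - q) * ω (𝐃 ∷ u) - (1# + Ai) * ω u
    core : (1# - q) * (χE + q * A * c * χD) ≈ (1# + q * A) * (1# + c) * χ
    core = lincomb₁ ((1# - q) * (1# - q)) (bulk [] u (s≤s u<N))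
      (lincomb₃ ((1# - q) * q) (- (q + Ai)) ((1# - q) * (1# - q) * c * ω (𝐃 ∷ u) - (1# + c) * (1# - q) * ω u)
        (left (𝐃 ∷ u) (s≤s u<N)) (left u (ℕₚ.m≤n⇒m≤1+n u<N)) AAi
        (solve 10 (λ q c A Ai ωDE ωDD ωED ωD ωE ω →
          (:1 :- q) :* (((:1 :- q) :* ωDE :- (:1 :+ Ai) :* ωE) :+ q :* A :* c :* ((:1 :- q) :* ωDD :- (:1 :+ Ai) :* ωD))
          := (:1 :+ q :* A) :* (:1 :+ c) :* ((:1 :- q) :* ωD :- (:1 :+ Ai) :* ω)
             :+ (:1 :- q) :* (:1 :- q) :* (ωDE :- (q :* ωED :+ (ωD :+ ωE)))
             :+ (:1 :- q) :* q :* ((:1 :- q) :* (ωED :+ A :* c :* ωDD) :- (:1 :+ A) :* (:1 :+ c) :* ωD)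
             :+ (:- (q :+ Ai)) :* ((:1 :- q) :* (ωE :+ A :* c :* ωD) :- (:1 :+ A) :* (:1 :+ c) :* ω)
             :+ ((:1 :- q) :* (:1 :- q) :* c :* ωD :- (:1 :+ c) :* (:1 :- q) :* ω) :* (A :* Ai :- :1))
          refl q c A Ai _ (ω (𝐃 ∷ 𝐃 ∷ u)) (ω (𝐄 ∷ 𝐃 ∷ u)) (ω (𝐃 ∷ u)) (ω (𝐄 ∷ u)) (ω u)))

  -- On the empty word the two boundary relations are linear equations for the values at `𝐃` and
  -- `𝐄`, with determinant `1 - A b c d`. Solving for the value at `𝐃` and subtracting `1 + 1/A`
  -- leaves a numerator that factors.
  next-[] : ∀ {N A Ai ω} → A * Ai ≈ 1# → Right (suc N) ω → Left (suc N) A ω →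
            (1# - A * b * c * d) * next A Ai ω []
              ≈ - Ai * ((y - A * c) * (1# - A * b) * (1# - A * d) * ω [])
  next-[] {N} {A} {Ai} {ω} AAi right left = trans
    (*-congˡ (next-left AAi left [] (s≤s z≤n)))
    (lincomb₃ (y - A * c) (- (y - A * c) * b * d)
      ((y - A * c) * ω [] * (b * c * d - b - d + A * b * d))
      (right [] (s≤s z≤n)) (left [] (s≤s z≤n)) AAi
      (solve 10 (λ q y b c d A Ai ωD ωE ω →
        (:1 :- A :* b :* c :* d) :* ((y :- A :* c) :* ((:1 :- q) :* ωD :- (:1 :+ Ai) :* ω))
        := :- Ai :* ((y :- A :* c) :* (:1 :- A :* b) :* (:1 :- A :* d) :* ω)
           :+ (y :- A :* c) :* ((:1 :- q) :* (ωD :+ b :* d :* ωE) :- (:1 :+ b) :* (:1 :+ d) :* ω)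
           :+ ((:- (y :- A :* c)) :* b :* d) :* ((:1 :- q) :* (ωE :+ A :* c :* ωD) :- (:1 :+ A) :* (:1 :+ c) :* ω)
           :+ ((y :- A :* c) :* ω :* (b :* c :* d :- b :- d :+ A :* b :* d)) :* (A :* Ai :- :1))
        refl q y b c d A Ai (ω (𝐃 ∷ [])) (ω (𝐄 ∷ [])) (ω [])))

  mom : ℕ → Functional → Carrier
  mom zero    ω = ω []
  mom (suc n) ω = y * mom n (λ u → ω (𝐃 ∷ u)) + mom n (λ u → ω (𝐄 ∷ u))

  mom-cong : ∀ n {ω ω′} → (∀ u → length u P.≡ n → ω u ≈ ω′ u) → mom n ω ≈ mom n ω′
  mom-cong zero    p = p [] P.refl
  mom-cong (suc n) p = +-cong (*-congˡ (mom-cong n (λ u l → p (𝐃 ∷ u) (P.cong suc l))))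
                              (mom-cong n (λ u l → p (𝐄 ∷ u) (P.cong suc l)))

  mom-lin : ∀ n s t ω ω′ → mom n (λ u → s * ω u + t * ω′ u) ≈ s * mom n ω + t * mom n ω′
  mom-lin zero    s t ω ω′ = refl
  mom-lin (suc n) s t ω ω′ = trans
    (+-cong (*-congˡ (mom-lin n s t (λ u → ω (𝐃 ∷ u)) (λ u → ω′ (𝐃 ∷ u))))
            (mom-lin n s t (λ u → ω (𝐄 ∷ u)) (λ u → ω′ (𝐄 ∷ u))))
    (solve 7 (λ y s t a b c d → y :* (s :* a :+ t :* b) :+ (s :* c :+ t :* d)
      := s :* (y :* a :+ c) :+ t :* (y :* b :+ d)) refl y s t _ _ _ _)

  -- The definition of `next`, summed over all words of length `n` and solved for the higher moment:
  -- the recurrence on which Newton's expansion runs.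
  mom-next : ∀ n A Ai ω → (1# - q) * mom (suc n) ω ≈ node A Ai * mom n ω + mom n (next A Ai ω)
  mom-next n A Ai ω = sym (trans
    (+-congˡ (trans (mom-cong n (λ u _ → solve 5 (λ k y a b z → k :* (y :* a :+ b) :- z
                       := :1 :* (k :* y :* a :+ k :* b) :+ (:- :1) :* z) refl (1# - q) y _ _ _))
      (trans (mom-lin n 1# (- 1#) _ _)
        (+-cong (*-congˡ (mom-lin n ((1# - q) * y) (1# - q) _ _))
                (*-congˡ (trans (mom-cong n (λ u _ → sym (trans (+-congˡ (zeroˡ _)) (+-identityʳ _))))
                                (mom-lin n (node A Ai) 0# ω ω)))))))
    (solve 6 (λ k y x a b c → x :* a :+ (:1 :* (k :* y :* b :+ k :* c) :+ (:- :1) :* (x :* a :+ con (ℤ.+ 0) :* a))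
       := k :* (y :* b :+ c)) refl _ _ _ _ _ _))

-- Weights of the divided differences

module Newton {ℓc ℓ : Level} (F : CommutativeRing ℓc ℓ) (q : CommutativeRing.Carrier F) where
  open CommutativeRing F hiding (zero)
  open IntegerSolver F
  open Sums F
  open import Relation.Binary.Reasoning.Setoid setoid

  shift₂ : (ℕ → Carrier) → ℕ → Carrier
  shift₂ E m = E (suc (suc m))

  fact : (ℕ → Carrier) → ℕ → Carrier
  fact P n = Prod n (λ i → P (suc i))

  -- mid E j = E j ⋯ E (2j - 1)  and  tail E j l = E (2j + 1) ⋯ E (2j + l).
  mid : (ℕ → Carrier) → ℕ → Carrier
  mid E zero    = 1#
  mid E (suc j) = E (suc j) * mid (shift₂ E) j

  tail : (ℕ → Carrier) → ℕ → ℕ → Carrier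
  tail E zero    l = fact E l
  tail E (suc j) l = tail (shift₂ E) j l

  -- `P` and `E` are arbitrary sequences so that one expression covers both the product of the
  -- factors `p`, `ε A` and the product of their inverses.
  denom : (P E : ℕ → Carrier) → ℕ → ℕ → Carrier
  denom P E j l = fact P j * fact P l * (mid E j * tail E j l)

  tail-suc : ∀ E j l → tail E j (suc l) ≈ tail E j l * E (suc (j ℕ.+ l ℕ.+ j))
  tail-suc E zero    l = trans (Prod-snoc l _) (*-congˡ (reflexive (P.cong E (P.cong suc (P.sym (ℕₚ.+-identityʳ l))))))
  tail-suc E (suc j) l = trans (tail-suc (shift₂ E) j l)
    (*-congˡ (reflexive (P.cong E (P.cong (suc ∘ suc) (P.sym (ℕₚ.+-suc (j ℕ.+ l) j))))))

  denom-suc : ∀ P E j l → denom P E j (suc l) ≈ denom P E j l * (P (suc l) * E (suc (j ℕ.+ l ℕ.+ j)))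
  denom-suc P E j l = trans (*-cong (*-congˡ (Prod-snoc l _)) (*-congˡ (tail-suc E j l)))
    (solve 6 (λ a b p m t e → a :* (b :* p) :* (m :* (t :* e)) := a :* b :* (m :* t) :* (p :* e)) refl _ _ _ _ _ _)

  -- For `E = ε A` the shift by two is `ε (A q²)`: apart from two factors, raising `j` amounts to
  -- replacing `A` by `A q²`. The induction in `coef-sum-zero` rests on this.
  denom-shift : ∀ P E j l → denom P E (suc j) l ≈ denom P (shift₂ E) j l * (P (suc j) * E (suc j))
  denom-shift P E j l = trans (*-congʳ (*-congʳ (Prod-snoc j _)))
    (solve 6 (λ a b p m t e → a :* p :* b :* (e :* m :* t) := a :* b :* (m :* t) :* (p :* e)) refl _ _ _ _ _ _)

  p : ℕ → Carrier
  p m = 1# - q ^ m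

  ε : Carrier → ℕ → Carrier
  ε A m = 1# - A * q ^ m

  -- This is `(-1)^j q^(j(j-1)/2)`.
  sg : ℕ → Carrier
  sg zero    = 1#
  sg (suc j) = - (q ^ j * sg j)

  -- With the inverses of `p` and `ε A` inserted, and up to a factor depending on `k` alone, this is
  -- the divided-difference weight of the node x_j, the product of `1 / (x_j - x_i)` over i ≤ k, i ≠
  -- j.
  coef : (P E : ℕ → Carrier) → ℕ → ℕ → Carrier
  coef P E k j = sg j * denom P E j (k ∸ j)

  module _ (p⁻¹ : ℕ → Carrier) where

    coef-suc : ∀ A (ε⁻¹ : ℕ → Carrier) k j → j ≤ k →
      p (suc k ∸ j) * p⁻¹ (suc k ∸ j) ≈ 1# → ε A (suc k ℕ.+ j) * ε⁻¹ (suc k ℕ.+ j) ≈ 1# →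
      p (suc k ∸ j) * ε A (suc k ℕ.+ j) * coef p⁻¹ ε⁻¹ (suc k) j ≈ coef p⁻¹ ε⁻¹ k j
    -- The two hypotheses are bound only after the match, so that `suc k ∸ j` is replaced by
    -- `suc (k ∸ j)` in their types too.
    coef-suc A ε⁻¹ k j j≤k with suc k ∸ j | ℕₚ.+-∸-assoc 1 j≤k
    ... | ._ | P.refl = λ hp hε → begin
      p s * ε A (suc k ℕ.+ j) * (sg j * denom p⁻¹ ε⁻¹ j s)
        ≈⟨ *-congˡ (*-congˡ (trans (denom-suc p⁻¹ ε⁻¹ j (k ∸ j))
             (*-congˡ (*-congˡ (reflexive (P.cong (λ m → ε⁻¹ (suc (m ℕ.+ j))) (ℕₚ.m+[n∸m]≡n j≤k))))))) ⟩
      p s * ε A (suc k ℕ.+ j) * (sg j * (denom p⁻¹ ε⁻¹ j (k ∸ j) * (p⁻¹ s * ε⁻¹ (suc k ℕ.+ j))))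
        ≈⟨ solve 6 (λ a a′ b b′ s d → a :* b :* (s :* (d :* (a′ :* b′))) := (a :* a′) :* (b :* b′) :* (s :* d))
             refl _ _ _ _ _ _ ⟩
      (p s * p⁻¹ s) * (ε A (suc k ℕ.+ j) * ε⁻¹ (suc k ℕ.+ j)) * (sg j * denom p⁻¹ ε⁻¹ j (k ∸ j))
        ≈⟨ trans (*-congʳ (trans (*-cong hp hε) (*-identityˡ _))) (*-identityˡ _) ⟩
      coef p⁻¹ ε⁻¹ k j ∎
      where s = suc (k ∸ j)

    coef-shift : ∀ A (ε⁻¹ : ℕ → Carrier) k j →
      p (suc j) * p⁻¹ (suc j) ≈ 1# → ε A (suc j) * ε⁻¹ (suc j) ≈ 1# →
      p (suc j) * ε A (suc j) * coef p⁻¹ ε⁻¹ (suc k) (suc j) ≈ - (q ^ j) * coef p⁻¹ (shift₂ ε⁻¹) k j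
    coef-shift A ε⁻¹ k j hp hε = begin
      p s * ε A s * (- (q ^ j * sg j) * denom p⁻¹ ε⁻¹ s (k ∸ j))
        ≈⟨ *-congˡ (*-congˡ (denom-shift p⁻¹ ε⁻¹ j (k ∸ j))) ⟩
      p s * ε A s * (- (q ^ j * sg j) * (denom p⁻¹ (shift₂ ε⁻¹) j (k ∸ j) * (p⁻¹ s * ε⁻¹ s)))
        ≈⟨ solve 7 (λ a a′ b b′ s d r → a :* b :* (:- (r :* s) :* (d :* (a′ :* b′))) := (a :* a′) :* (b :* b′) :* (:- r :* (s :* d)))
             refl _ _ _ _ _ _ _ ⟩
      (p s * p⁻¹ s) * (ε A s * ε⁻¹ s) * (- (q ^ j) * coef p⁻¹ (shift₂ ε⁻¹) k j)
        ≈⟨ trans (*-congʳ (trans (*-cong hp hε) (*-identityˡ _))) (*-identityˡ _) ⟩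
      - (q ^ j) * coef p⁻¹ (shift₂ ε⁻¹) k j ∎
      where s = suc j

    -- For j ≤ K the exponents in `mid` and in `tail` of length `K ∸ j` range over 1, ..., 2K - 1.
    Inverses : ℕ → Carrier → (ℕ → Carrier) → Set ℓ
    Inverses K A ε⁻¹ = ∀ m → suc m < K ℕ.+ K → ε A (suc m) * ε⁻¹ (suc m) ≈ 1#

    -- p_K ε_K = p_{K-j} ε_{K+j} + q^{K-j} p_j ε_j, so the sum for K reduces to the sums for K-1
    -- with parameters A and A q².
    coef-sum-zero : ∀ k A ε⁻¹ → (∀ m → m ≤ k → p (suc m) * p⁻¹ (suc m) ≈ 1#) → Inverses (suc k) A ε⁻¹ →
                    Sum (suc (suc k)) (coef p⁻¹ ε⁻¹ (suc k)) ≈ 0#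
    coef-sum-zero k A ε⁻¹ hp hε = begin
      S
        ≈⟨ sym (*-identityˡ S) ⟩
      1# * S
        ≈⟨ *-congʳ (sym (trans (*-cong (hp k ℕₚ.≤-refl) (hε k (s≤s (ℕₚ.m<m+n k (s≤s z≤n))))) (*-identityˡ _))) ⟩
      (p K * p⁻¹ K) * (ε A K * ε⁻¹ K) * S
        ≈⟨ solve 5 (λ a a′ b b′ s → (a :* a′) :* (b :* b′) :* s := a′ :* b′ :* (a :* b :* s)) refl _ _ _ _ _ ⟩
      p⁻¹ K * ε⁻¹ K * (p K * ε A K * S)
        ≈⟨ *-congˡ (trans reduce (vanishes k hp hε)) ⟩
      p⁻¹ K * ε⁻¹ K * 0#
        ≈⟨ zeroʳ _ ⟩
      0# ∎
      where
      K = suc k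
      S = Sum (suc K) (coef p⁻¹ ε⁻¹ K)
      S₁ = Sum (suc k) (coef p⁻¹ ε⁻¹ k)
      S₂ = Sum (suc k) (coef p⁻¹ (shift₂ ε⁻¹) k)

      split : ∀ j → j ≤ K → p K * ε A K ≈ p (K ∸ j) * ε A (K ℕ.+ j) + q ^ (K ∸ j) * (p j * ε A j)
      split j j≤K = trans (*-cong (+-congˡ (-‿cong qK)) (+-congˡ (-‿cong (*-congˡ qK))))
        (trans (solve 3 (λ A r s → (:1 :- r :* s) :* (:1 :- A :* (r :* s))
            := (:1 :- r) :* (:1 :- A :* (r :* s :* s)) :+ r :* ((:1 :- s) :* (:1 :- A :* s))) refl A (q ^ (K ∸ j)) (q ^ j))
          (+-congʳ (*-congˡ (+-congˡ (-‿cong (*-congˡ (sym (trans (^-+ q K j) (*-congʳ qK)))))))))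
        where
        qK : q ^ K ≈ q ^ (K ∸ j) * q ^ j
        qK = trans (reflexive (P.cong (q ^_) (P.sym (ℕₚ.m∸n+n≡m j≤K)))) (^-+ q (K ∸ j) j)

      reduce : p K * ε A K * S ≈ S₁ + - (q ^ k) * S₂
      reduce = begin
        p K * ε A K * S
          ≈⟨ sym (Sum-*ˡ (suc K) (p K * ε A K) (coef p⁻¹ ε⁻¹ K)) ⟩
        Sum (suc K) (λ j → p K * ε A K * coef p⁻¹ ε⁻¹ K j)
          ≈⟨ Sum-cong (suc K) (λ j j<K → trans (*-congʳ (split j (ℕₚ.≤-pred j<K))) (distribʳ (coef p⁻¹ ε⁻¹ K j) _ _)) ⟩
        Sum (suc K) (λ j → g₁ j + g₂ j)
          ≈⟨ Sum-+ (suc K) g₁ g₂ ⟩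
        Sum (suc K) g₁ + Sum (suc K) g₂
          -- Because `p 0` vanishes, the first part ends at j = k and the second begins at j = 1;
          -- both then have the length of a sum for `k`.
          ≈⟨ +-cong (trans (Sum-snoc K g₁) (trans (+-cong (Sum-cong K first) last₁) (+-identityʳ _)))
                    (trans (+-cong first₂ (trans (Sum-cong K second) (Sum-*ˡ K (- (q ^ k)) (coef p⁻¹ (shift₂ ε⁻¹) k)))) (+-identityˡ _)) ⟩
        S₁ + - (q ^ k) * S₂ ∎
        where
        g₁ g₂ : ℕ → Carrier
        g₁ j = p (K ∸ j) * ε A (K ℕ.+ j) * coef p⁻¹ ε⁻¹ K j
        g₂ j = q ^ (K ∸ j) * (p j * ε A j) * coef p⁻¹ ε⁻¹ K j
        first : ∀ j → j < K → g₁ j ≈ coef p⁻¹ ε⁻¹ k j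
        first j (s≤s j≤k) = coef-suc A ε⁻¹ k j j≤k
          (P.subst (λ m → p m * p⁻¹ m ≈ 1#) (P.sym (ℕₚ.+-∸-assoc 1 j≤k)) (hp (k ∸ j) (ℕₚ.m∸n≤m k j)))
          (hε (k ℕ.+ j) (s≤s (P.subst (suc (k ℕ.+ j) ≤_) (P.sym (ℕₚ.+-suc k k)) (s≤s (ℕₚ.+-monoʳ-≤ k j≤k)))))
        last₁ : g₁ K ≈ 0#
        last₁ = trans (*-congʳ (*-congʳ (trans (reflexive (P.cong p (ℕₚ.n∸n≡0 K))) (-‿inverseʳ 1#))))
                  (trans (*-congʳ (zeroˡ _)) (zeroˡ _))
        first₂ : g₂ 0 ≈ 0#
        first₂ = trans (*-congʳ (trans (*-congˡ (trans (*-congʳ (-‿inverseʳ 1#)) (zeroˡ _))) (zeroʳ _))) (zeroˡ _)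
        second : ∀ j → j < K → g₂ (suc j) ≈ - (q ^ k) * coef p⁻¹ (shift₂ ε⁻¹) k j
        second j (s≤s j≤k) = begin
          q ^ (k ∸ j) * (p (suc j) * ε A (suc j)) * coef p⁻¹ ε⁻¹ K (suc j)
            ≈⟨ *-assoc _ _ _ ⟩
          q ^ (k ∸ j) * (p (suc j) * ε A (suc j) * coef p⁻¹ ε⁻¹ K (suc j))
            ≈⟨ *-congˡ (coef-shift A ε⁻¹ k j (hp j j≤k) (hε j (s≤s (ℕₚ.≤-trans (s≤s j≤k) (ℕₚ.m≤n+m (suc k) k))))) ⟩
          q ^ (k ∸ j) * (- (q ^ j) * coef p⁻¹ (shift₂ ε⁻¹) k j)
            ≈⟨ solve 3 (λ r s c → r :* (:- s :* c) := :- (r :* s) :* c) refl _ _ _ ⟩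
          - (q ^ (k ∸ j) * q ^ j) * coef p⁻¹ (shift₂ ε⁻¹) k j
            ≈⟨ *-congʳ (-‿cong (trans (sym (^-+ q (k ∸ j) j)) (reflexive (P.cong (q ^_) (ℕₚ.m∸n+n≡m j≤k))))) ⟩
          - (q ^ k) * coef p⁻¹ (shift₂ ε⁻¹) k j ∎

      vanishes : ∀ k → (∀ m → m ≤ k → p (suc m) * p⁻¹ (suc m) ≈ 1#) → Inverses (suc k) A ε⁻¹ →
        Sum (suc k) (coef p⁻¹ ε⁻¹ k) + - (q ^ k) * Sum (suc k) (coef p⁻¹ (shift₂ ε⁻¹) k) ≈ 0#
      -- For k = 0 each sum is the same single term, and the two cancel; from k = 1 on they vanish
      -- separately by induction.
      vanishes zero    _  _  = solve 1 (λ x → x :+ (:- :1) :* x := con (ℤ.+ 0)) refl _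
      vanishes (suc k) hp hε = trans
        (+-cong (coef-sum-zero k A ε⁻¹ (λ m m≤k → hp m (ℕₚ.m≤n⇒m≤1+n m≤k))
                   (λ m m<2K → hε m (ℕₚ.≤-trans m<2K (ℕₚ.+-mono-≤ (ℕₚ.n≤1+n (suc k)) (ℕₚ.n≤1+n (suc k))))))
                (*-congˡ (coef-sum-zero k (A * (q * q)) (shift₂ ε⁻¹) (λ m m≤k → hp m (ℕₚ.m≤n⇒m≤1+n m≤k))
                   (λ m m<2K → trans (*-congʳ (+-congˡ (-‿cong (solve 3 (λ A q r → A :* (q :* q) :* r := A :* (q :* (q :* r))) refl A q _))))
                      (hε (suc (suc m)) (P.subst (suc (suc (suc m)) <_) (P.cong suc (P.cong suc (P.sym (ℕₚ.+-suc k (suc k))))) (s≤s (s≤s m<2K))))))))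
        (trans (+-identityˡ _) (zeroʳ _))

-- Newton interpolation at the nodes x_k

module _ {ℓc ℓ : Level} (F : CommutativeRing ℓc ℓ)
  (q q⁻¹ a a⁻¹ y y⁻¹ : CommutativeRing.Carrier F) (p⁻¹ ε⁻¹ : ℕ → CommutativeRing.Carrier F) where
  open CommutativeRing F hiding (zero)
  open IntegerSolver F
  open LinComb F
  open Sums F
  open Newton F q

  module Interpolation
    (qq⁻¹ : q * q⁻¹ ≈ 1#) (aa⁻¹ : a * a⁻¹ ≈ 1#) (yy⁻¹ : y * y⁻¹ ≈ 1#)
    (N : ℕ) (hp : ∀ m → m < N → p (suc m) * p⁻¹ (suc m) ≈ 1#)
    (hε : Inverses p⁻¹ N (a * a * y⁻¹) ε⁻¹) where
    open import Relation.Binary.Reasoning.Setoid setoid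

    A : Carrier
    A = a * a * y⁻¹

    x κ : ℕ → Carrier
    x j = 1# + y + q ^ j * a + y * (q⁻¹ ^ j * a⁻¹)
    κ k = - (y * a⁻¹ * q⁻¹ ^ k)

    u : ℕ → ℕ → Carrier
    u = coef p⁻¹ ε⁻¹

    -- `T m k` is the divided difference of the m-th power at x_0, ..., x_k, multiplied by κ_0 ⋯
    -- κ_{k-1}. The factor `q ^ k`, which is the one in the outer sum of the statement, absorbs the
    -- `q⁻¹` of `coef-step`.
    S T : ℕ → ℕ → Carrier
    S m k = Sum (suc k) (λ j → u k j * x j ^ m)
    T m k = q ^ k * S m k

    -- The function z + y/z takes equal values at z and y/z, so its difference at a q^j and a q^k
    -- splits into two factors, one in q^(k-j) and one in q^(k+j); `κ k` is the monomial left over.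
    x-diff : ∀ j k → j ≤ k → x j - x k ≈ - (y * a⁻¹ * q⁻¹ ^ k) * (p (k ∸ j) * ε A (k ℕ.+ j))
    x-diff j k j≤k = begin
      x j - x k
        ≈⟨ +-congˡ (-‿cong (+-cong (+-congˡ (*-congʳ (pow q))) (*-congˡ (*-congʳ (pow q⁻¹))))) ⟩
      x j - (1# + y + (r * s) * a + y * ((r′ * s′) * a⁻¹))
        ≈⟨ lincomb₂ (- (y * a⁻¹ * s′)) (- ((1# - r) * s * a)) r-inv product
           (solve 8 (λ y y′ a a′ r r′ s s′ →
             (:1 :+ y :+ s :* a :+ y :* (s′ :* a′)) :- (:1 :+ y :+ (r :* s) :* a :+ y :* ((r′ :* s′) :* a′))
             := (:- (y :* a′ :* (r′ :* s′))) :* ((:1 :- r) :* (:1 :- a :* a :* y′ :* (r :* s :* s)))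
                :+ (:- (y :* a′ :* s′)) :* (r :* r′ :- :1)
                :+ (:- ((:1 :- r) :* s :* a)) :* ((y :* y′) :* (a :* a′) :* ((r :* r′) :* (s :* s′)) :- :1))
             refl y y⁻¹ a a⁻¹ r r′ s s′) ⟩
      - (y * a⁻¹ * (r′ * s′)) * ((1# - r) * (1# - A * (r * s * s)))
        ≈⟨ *-cong (-‿cong (*-congˡ (pow q⁻¹)))
             (*-congˡ (+-congˡ (-‿cong (*-congˡ (trans (^-+ q k j) (*-congʳ (pow q))))))) ⟨
      - (y * a⁻¹ * q⁻¹ ^ k) * (p (k ∸ j) * ε A (k ℕ.+ j)) ∎
      where
      r = q ^ (k ∸ j)
      s = q ^ j
      r′ = q⁻¹ ^ (k ∸ j)
      s′ = q⁻¹ ^ j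
      r-inv : r * r′ ≈ 1#
      r-inv = ^-inverse (k ∸ j) qq⁻¹
      s-inv : s * s′ ≈ 1#
      s-inv = ^-inverse j qq⁻¹
      product : (y * y⁻¹) * (a * a⁻¹) * ((r * r′) * (s * s′)) ≈ 1#
      product = trans (*-cong (trans (*-cong yy⁻¹ aa⁻¹) (*-identityˡ _)) (trans (*-cong r-inv s-inv) (*-identityˡ _)))
                      (*-identityˡ _)
      pow : ∀ z → z ^ k ≈ z ^ (k ∸ j) * z ^ j
      pow z = trans (reflexive (P.cong (z ^_) (P.sym (ℕₚ.m∸n+n≡m j≤k)))) (^-+ z (k ∸ j) j)

    coef-step : ∀ j k → j ≤ k → k < N → (x j - x (suc k)) * u (suc k) j ≈ q⁻¹ * κ k * u k j
    coef-step j k j≤k k<N = begin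
      (x j - x (suc k)) * u (suc k) j
        ≈⟨ *-congʳ (x-diff j (suc k) (ℕₚ.m≤n⇒m≤1+n j≤k)) ⟩
      - (y * a⁻¹ * (q⁻¹ * q⁻¹ ^ k)) * (p (suc k ∸ j) * ε A (suc k ℕ.+ j)) * u (suc k) j
        ≈⟨ *-assoc _ _ _ ⟩
      - (y * a⁻¹ * (q⁻¹ * q⁻¹ ^ k)) * (p (suc k ∸ j) * ε A (suc k ℕ.+ j) * u (suc k) j)
        ≈⟨ *-cong (solve 4 (λ y a q z → :- (y :* a :* (q :* z)) := q :* (:- (y :* a :* z))) refl y a⁻¹ q⁻¹ _)
             (coef-suc p⁻¹ A ε⁻¹ k j j≤k
               (P.subst (λ m → p m * p⁻¹ m ≈ 1#) (P.sym (ℕₚ.+-∸-assoc 1 j≤k)) (hp (k ∸ j) (ℕₚ.≤-trans (s≤s (ℕₚ.m∸n≤m k j)) k<N)))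
               (hε (k ℕ.+ j) (ℕₚ.≤-trans (P.subst (suc (suc (k ℕ.+ j)) ≤_) (P.cong suc (P.sym (ℕₚ.+-suc k k)))
                 (s≤s (s≤s (ℕₚ.+-monoʳ-≤ k j≤k)))) (ℕₚ.+-mono-≤ k<N k<N)))) ⟩
      q⁻¹ * κ k * u k j ∎

    S-suc : ∀ m k → k < N → S (suc m) (suc k) ≈ x (suc k) * S m (suc k) + q⁻¹ * κ k * S m k
    S-suc m k k<N = begin
      S (suc m) (suc k)
        ≈⟨ Sum-cong (suc (suc k)) (λ j _ → solve 4 (λ u x y z → u :* (x :* z) := y :* (u :* z) :+ :1 :* ((x :- y) :* u :* z))
             refl (u (suc k) j) (x j) (x (suc k)) (x j ^ m)) ⟩
      Sum (suc (suc k)) (λ j → x (suc k) * (u (suc k) j * x j ^ m) + 1# * g j)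
        ≈⟨ Sum-lin (suc (suc k)) (x (suc k)) 1# (λ j → u (suc k) j * x j ^ m) g ⟩
      x (suc k) * S m (suc k) + 1# * Sum (suc (suc k)) g
        ≈⟨ +-congˡ (trans (*-identityˡ _) (trans (Sum-snoc (suc k) g) (trans (+-congˡ last-zero) (+-identityʳ _)))) ⟩
      x (suc k) * S m (suc k) + Sum (suc k) g
        ≈⟨ +-congˡ (trans (Sum-cong (suc k) (λ j j<k → trans (*-congʳ (coef-step j k (ℕₚ.≤-pred j<k) k<N)) (*-assoc _ _ (x j ^ m))))
                          (Sum-*ˡ (suc k) (q⁻¹ * κ k) (λ j → u k j * x j ^ m))) ⟩
      x (suc k) * S m (suc k) + q⁻¹ * κ k * S m k ∎
      where
      g : ℕ → Carrier
      g j = (x j - x (suc k)) * u (suc k) j * x j ^ m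
      last-zero : g (suc k) ≈ 0#
      last-zero = trans (*-congʳ (trans (*-congʳ (-‿inverseʳ _)) (zeroˡ _))) (zeroˡ _)

    -- The Leibniz rule for the divided difference of a product with the identity function.
    T-suc : ∀ m k → k < N → T (suc m) (suc k) ≈ x (suc k) * T m (suc k) + κ k * T m k
    T-suc m k k<N = lincomb₂ (q * q ^ k) (q ^ k * κ k * S m k) (S-suc m k k<N) qq⁻¹
      (solve 8 (λ q q′ r x κ S₁ S₂ S₃ →
        q :* r :* S₁ := x :* (q :* r :* S₂) :+ κ :* (r :* S₃)
          :+ q :* r :* (S₁ :- (x :* S₂ :+ q′ :* κ :* S₃)) :+ r :* κ :* S₃ :* (q :* q′ :- :1))
        refl q q⁻¹ (q ^ k) (x (suc k)) (κ k) _ _ _)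

    T-zero : ∀ m → T (suc m) 0 ≈ x 0 * T m 0
    T-zero m = solve 3 (λ u x z → :1 :* (u :* (x :* z) :+ con (ℤ.+ 0)) := x :* (:1 :* (u :* z :+ con (ℤ.+ 0)))) refl (u 0 0) (x 0) _

    -- Divided differences at k + 1 nodes annihilate powers below k. The recursion reduces this to
    -- the power 0, where it is `coef-sum-zero`.
    T-triangular : ∀ m k → m < k → k ≤ N → T m k ≈ 0#
    T-triangular zero (suc k) _ k<N = trans (*-congˡ (trans
      (Sum-cong (suc (suc k)) {g = coef p⁻¹ ε⁻¹ (suc k)} (λ j _ → *-identityʳ _))
      (coef-sum-zero p⁻¹ k A ε⁻¹ (λ m m≤k → hp m (ℕₚ.≤-trans (s≤s m≤k) k<N))
        (λ m lt → hε m (ℕₚ.≤-trans lt (ℕₚ.+-mono-≤ k<N k<N)))))) (zeroʳ _)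
    T-triangular (suc m) (suc k) (s≤s m<k) k<N = trans (T-suc m k k<N)
      (trans (+-cong (trans (*-congˡ (T-triangular m (suc k) (ℕₚ.m≤n⇒m≤1+n m<k) k<N)) (zeroʳ _))
                     (trans (*-congˡ (T-triangular m k m<k (ℕₚ.<⇒≤ k<N))) (zeroʳ _)))
             (+-identityˡ _))

    -- Each step of the induction trades one unit of `r` for one of `m`. The recursion of `M` in `k`
    -- and that of `T` are transposes of each other, so the passage is a summation by parts.
    newton : ∀ (M : ℕ → ℕ → Carrier) → (∀ k r → M k (suc r) ≈ x k * M k r + κ k * M (suc k) r) →
             ∀ m → m ≤ N → ∀ r → M 0 (m ℕ.+ r) ≈ Sum (suc m) (λ k → T m k * M k r)
    newton M rec zero m≤N r = solve 1 (λ z → z := :1 :* (:1 :* (:1 :* :1 :* (:1 :* :1)) :* :1 :+ con (ℤ.+ 0)) :* z :+ con (ℤ.+ 0)) refl (M 0 r)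
    newton M rec (suc m) m<N r = begin
      M 0 (suc m ℕ.+ r)
        ≡⟨ P.cong (M 0) (P.sym (ℕₚ.+-suc m r)) ⟩
      M 0 (m ℕ.+ suc r)
        ≈⟨ newton M rec m (ℕₚ.<⇒≤ m<N) (suc r) ⟩
      Sum (suc m) (λ k → T m k * M k (suc r))
        ≈⟨ Sum-cong (suc m) (λ k _ → trans (*-congˡ (rec k r))
             (solve 5 (λ t x a κ b → t :* (x :* a :+ κ :* b) := x :* t :* a :+ κ :* t :* b) refl (T m k) _ _ _ _)) ⟩
      Sum (suc m) (λ k → g k + h k)
        ≈⟨ Sum-+ (suc m) g h ⟩
      Sum (suc m) g + Sum (suc m) h
        -- By triangularity the term `g (suc m)` is zero; adding it makes `g (suc k)` available next
        -- to every `h k`, ready for `T-suc`.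
        ≈⟨ +-congʳ (trans (sym (+-identityʳ _)) (trans (+-congˡ (sym g-last)) (sym (Sum-snoc (suc m) g)))) ⟩
      (g 0 + Sum (suc m) (g ∘ suc)) + Sum (suc m) h
        ≈⟨ trans (+-assoc _ _ _) (+-congˡ (sym (Sum-+ (suc m) (g ∘ suc) h))) ⟩
      g 0 + Sum (suc m) (λ k → g (suc k) + h k)
        ≈⟨ +-cong (*-congʳ (sym (T-zero m)))
             (Sum-cong (suc m) (λ k k≤m → trans (sym (distribʳ (M (suc k) r) _ _))
               (*-congʳ (sym (T-suc m k (ℕₚ.≤-trans k≤m m<N)))))) ⟩
      Sum (suc (suc m)) (λ k → T (suc m) k * M k r) ∎
      where
      g h : ℕ → Carrier
      g k = x k * T m k * M k r
      h k = κ k * T m k * M (suc k) r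
      g-last : g (suc m) ≈ 0#
      g-last = trans (*-congʳ (trans (*-congˡ (T-triangular m (suc m) ℕₚ.≤-refl m<N)) (zeroʳ _))) (zeroˡ _)

-- Staircase tableaux built column by column

module Tableaux where
  open P using (_≡_; refl; sym; trans; cong; cong₂; subst; module ≡-Reasoning)

  infixr 5 _⇒_
  _⇒_ : Bool → Bool → Bool
  b ⇒ b′ = if b then b′ else true

  every : ℕ → (ℕ → Bool) → Bool
  every zero    p = true
  every (suc n) p = p 0 ∧ every n (p ∘ suc)

  every-cong : ∀ n {p p′} → (∀ i → i < n → p i ≡ p′ i) → every n p ≡ every n p′
  every-cong zero    h = refl
  every-cong (suc n) h = cong₂ _∧_ (h 0 (s≤s z≤n)) (every-cong n (λ i i<n → h (suc i) (s≤s i<n)))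

  ∧-interchange : ∀ a b c d → (a ∧ b) ∧ (c ∧ d) ≡ (a ∧ c) ∧ (b ∧ d)
  ∧-interchange true  true  c d = refl
  ∧-interchange true  false c d = sym (𝔹.∧-zeroʳ c)
  ∧-interchange false b     c d = refl

  every-∧ : ∀ n p p′ → every n (λ i → p i ∧ p′ i) ≡ every n p ∧ every n p′
  every-∧ zero    p p′ = refl
  every-∧ (suc n) p p′ = trans (cong (_ ∧_) (every-∧ n (p ∘ suc) (p′ ∘ suc))) (∧-interchange (p 0) (p′ 0) _ _)

  every-snoc : ∀ n p → every (suc n) p ≡ every n p ∧ p n
  every-snoc zero    p = 𝔹.∧-identityʳ (p 0)
  every-snoc (suc n) p = trans (cong (p 0 ∧_) (every-snoc n (p ∘ suc))) (sym (𝔹.∧-assoc (p 0) _ _))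

  ∧-true : ∀ {a b} → a ∧ b ≡ true → a ≡ true × b ≡ true
  ∧-true {true} {true} _ = refl , refl

  every-true : ∀ n p → every n p ≡ true → ∀ i → i < n → p i ≡ true
  every-true (suc n) p h zero    _         = proj₁ (∧-true h)
  every-true (suc n) p h (suc i) (s≤s i<n) = every-true n (p ∘ suc) (proj₂ (∧-true h)) i i<n

  allB-applyUpTo : ∀ {A : Set} (p : A → Bool) f n → allB p (applyUpTo f n) ≡ every n (p ∘ f)
  allB-applyUpTo p f zero    = refl
  allB-applyUpTo p f (suc n) = cong (p (f 0) ∧_) (allB-applyUpTo p (f ∘ suc) n)

  allB-++ : ∀ {A : Set} (p : A → Bool) xs ys → allB p (xs ++ ys) ≡ allB p xs ∧ allB p ys
  allB-++ p []       ys = refl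
  allB-++ p (x ∷ xs) ys = trans (cong (p x ∧_) (allB-++ p xs ys)) (sym (𝔹.∧-assoc (p x) _ _))

  allB-boxes : ∀ p n → allB p (boxes n) ≡ every n (λ r → every (n ∸ r) (λ c → p (r , c)))
  allB-boxes p n = go id n
    where
    row : ℕ → List (ℕ × ℕ)
    row r = map (r ,_) (upTo (n ∸ r))
    go : ∀ f m → allB p (concatMap row (applyUpTo f m)) ≡ every m (λ i → every (n ∸ f i) (λ c → p (f i , c)))
    go f zero    = refl
    go f (suc m) = trans (allB-++ p (row (f 0)) _) (cong₂ _∧_
      (trans (cong (allB p) (Listₚ.map-applyUpTo id (f 0 ,_) (n ∸ f 0))) (allB-applyUpTo p (f 0 ,_) (n ∸ f 0)))
      (go (f ∘ suc) m))

  data Shape : ℕ → Filling → Set where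
    []  : Shape 0 []
    _∷_ : ∀ {n L T} → length L ≡ suc n → Shape n T → Shape (suc n) (L ∷ T)

  Shape-length : ∀ {n T} → Shape n T → length T ≡ n
  Shape-length []      = refl
  Shape-length (_ ∷ s) = cong suc (Shape-length s)

  rowOf-length : ∀ {n T} → Shape n T → ∀ r → length (rowOf T r) ≡ n ∸ r
  rowOf-length []      r       = sym (ℕₚ.0∸n≡0 r)
  rowOf-length (l ∷ s) zero    = l
  rowOf-length (l ∷ s) (suc r) = rowOf-length s r

  -- glue col T adds the leftmost column col to T; this lengthens the diagonal by one box.
  glue : List Label → Filling → Filling
  glue []       T       = []
  glue (x ∷ xs) []      = (x ∷ []) ∷ glue xs []
  glue (x ∷ xs) (L ∷ T) = (x ∷ L) ∷ glue xs T

  get-glue-zero : ∀ col T r → get (glue col T) r 0 ≡ nth col r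
  get-glue-zero []       T       r       = refl
  get-glue-zero (x ∷ xs) []      zero    = refl
  get-glue-zero (x ∷ xs) []      (suc r) = get-glue-zero xs [] r
  get-glue-zero (x ∷ xs) (L ∷ T) zero    = refl
  get-glue-zero (x ∷ xs) (L ∷ T) (suc r) = get-glue-zero xs T r

  get-glue-suc : ∀ col T → length T ≤ length col → ∀ r c → get (glue col T) r (suc c) ≡ get T r c
  get-glue-suc []       []      _         r       c = refl
  get-glue-suc (x ∷ xs) []      _         zero    c = refl
  get-glue-suc (x ∷ xs) []      _         (suc r) c = get-glue-suc xs [] z≤n r c
  get-glue-suc (x ∷ xs) (L ∷ T) _         zero    c = refl
  get-glue-suc (x ∷ xs) (L ∷ T) (s≤s len) (suc r) c = get-glue-suc xs T len r c

  anyB : (Label → Bool) → List Label → Bool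
  anyB P []       = false
  anyB P (x ∷ xs) = P x ∨ anyB P xs

  ∨-⇒ : ∀ a b c → (a ∨ b) ⇒ c ≡ (a ⇒ c) ∧ (b ⇒ c)
  ∨-⇒ true  true  true  = refl
  ∨-⇒ true  true  false = refl
  ∨-⇒ true  false true  = refl
  ∨-⇒ true  false false = refl
  ∨-⇒ false b     c     = refl

  every-⇒ : ∀ P xs b {m} → length xs ≡ m → every m (λ i → P (nth xs i) ⇒ b) ≡ (anyB P xs ⇒ b)
  every-⇒ P []       b refl = refl
  every-⇒ P (x ∷ xs) b refl = trans (cong ((P x ⇒ b) ∧_) (every-⇒ P xs b refl)) (sym (∨-⇒ (P x) _ b))

  ⇒-∧ : ∀ a b c → (a ⇒ (b ∧ c)) ≡ (a ⇒ b) ∧ (a ⇒ c)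
  ⇒-∧ true  b c = refl
  ⇒-∧ false b c = refl

  clear : List Label → ℕ → Bool
  clear xs m = every m (λ i → isEmp (nth xs i))

  -- What the enlarged filling must satisfy beyond `T`. A β or δ in the new column contributes
  -- nothing, as no box lies to its left.
  columnOK : ℕ → List Label → Filling → Bool
  columnOK n col T = every (suc n) λ r →
    ((r ≡ᵇ n) ⇒ not (isEmp (nth col r))) ∧ (isAG (nth col r) ⇒ clear col r)
    ∧ every (n ∸ r) (λ c → isBD (get T r c) ⇒ isEmp (nth col r))

  module _ {n T} (col : List Label) (shape : Shape n T) (len : length col ≡ suc n) where
    private
      T⁺ : Filling
      T⁺ = glue col T

      get-suc : ∀ r c → get T⁺ r (suc c) ≡ get T r c
      get-suc = get-glue-suc col T
        (ℕₚ.≤-trans (ℕₚ.≤-reflexive (Shape-length shape)) (ℕₚ.≤-trans (ℕₚ.n≤1+n n) (ℕₚ.≤-reflexive (sym len))))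

      get-zero : ∀ r → get T⁺ r 0 ≡ nth col r
      get-zero = get-glue-zero col T

    boxOK-suc : ∀ r c → boxOK (suc n) T⁺ (r , suc c) ≡ boxOK n T (r , c) ∧ (isBD (get T r c) ⇒ isEmp (nth col r))
    boxOK-suc r c
      rewrite get-suc r c | ℕₚ.+-suc r c | allB-applyUpTo (λ c′ → isEmp (get T⁺ r c′)) suc c | get-zero r
            | allB-applyUpTo (λ c′ → isEmp (get T r c′)) id c
            | allB-applyUpTo (λ r′ → isEmp (get T⁺ r′ (suc c))) id r
            | allB-applyUpTo (λ r′ → isEmp (get T r′ c)) id r
            | every-cong c (λ c′ _ → cong isEmp (get-suc r c′))
            | every-cong r (λ r′ _ → cong isEmp (get-suc r′ c))
      = shuffle (isBD (get T r c)) (if suc (r ℕ.+ c) ≡ᵇ n then not (isEmp (get T r c)) else true) _ _ _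
      where
      shuffle : ∀ b d e f g → d ∧ (b ⇒ (e ∧ f)) ∧ g ≡ (d ∧ (b ⇒ f) ∧ g) ∧ (b ⇒ e)
      shuffle false d e f g = sym (𝔹.∧-identityʳ _)
      shuffle true  d e f g = begin
        d ∧ (e ∧ f) ∧ g    ≡⟨ cong (d ∧_) (trans (𝔹.∧-assoc e f g) (𝔹.∧-comm e (f ∧ g))) ⟩
        d ∧ (f ∧ g) ∧ e    ≡⟨ 𝔹.∧-assoc d (f ∧ g) e ⟨
        (d ∧ f ∧ g) ∧ e    ∎
        where open ≡-Reasoning

    boxOK-zero : ∀ r → boxOK (suc n) T⁺ (r , 0) ≡
      ((r ≡ᵇ n) ⇒ not (isEmp (nth col r))) ∧ (isAG (nth col r) ⇒ clear col r)
    boxOK-zero r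
      rewrite get-zero r | ℕₚ.+-identityʳ r | allB-applyUpTo (λ r′ → isEmp (get T⁺ r′ 0)) id r
            | every-cong r (λ r′ _ → cong isEmp (get-zero r′)) | 𝔹.if-eta (isBD (nth col r)) {true}
      = refl

    isStaircase-glue : isStaircase (suc n) T⁺ ≡ isStaircase n T ∧ columnOK n col T
    isStaircase-glue = begin
      isStaircase (suc n) T⁺
        ≡⟨ allB-boxes _ (suc n) ⟩
      every (suc n) (λ r → every (suc n ∸ r) (λ c → boxOK (suc n) T⁺ (r , c)))
        ≡⟨ every-cong (suc n) (λ r r<n → row r (ℕₚ.≤-pred r<n)) ⟩
      every (suc n) (λ r → every (n ∸ r) (λ c → boxOK n T (r , c)) ∧ K r)
        ≡⟨ every-∧ (suc n) row₀ K ⟩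
      every (suc n) (λ r → every (n ∸ r) (λ c → boxOK n T (r , c))) ∧ every (suc n) K
        -- The bottom row of the enlarged shape consists of the new diagonal box only, so its part
        -- in `T` is an empty condition.
        ≡⟨ cong (_∧ every (suc n) K) (trans (every-snoc n row₀)
             (trans (cong (λ m → every n row₀ ∧ every m (λ c → boxOK n T (n , c))) (ℕₚ.n∸n≡0 n)) (𝔹.∧-identityʳ _))) ⟩
      every n (λ r → every (n ∸ r) (λ c → boxOK n T (r , c))) ∧ every (suc n) K
        ≡⟨ cong (_∧ every (suc n) K) (sym (allB-boxes _ n)) ⟩
      isStaircase n T ∧ columnOK n col T ∎
      where
      open ≡-Reasoning
      row₀ : ℕ → Bool
      row₀ r = every (n ∸ r) (λ c → boxOK n T (r , c))
      B : ℕ → Bool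
      B r = every (n ∸ r) (λ c → isBD (get T r c) ⇒ isEmp (nth col r))
      K : ℕ → Bool
      K r = ((r ≡ᵇ n) ⇒ not (isEmp (nth col r))) ∧ (isAG (nth col r) ⇒ clear col r) ∧ B r
      row : ∀ r → r ≤ n → every (suc n ∸ r) (λ c → boxOK (suc n) T⁺ (r , c))
                          ≡ every (n ∸ r) (λ c → boxOK n T (r , c)) ∧ K r
      row r r≤n rewrite ℕₚ.+-∸-assoc 1 r≤n = begin
        boxOK (suc n) T⁺ (r , 0) ∧ every (n ∸ r) (λ c → boxOK (suc n) T⁺ (r , suc c))
          ≡⟨ cong₂ _∧_ (boxOK-zero r) (trans (every-cong (n ∸ r) (λ c _ → boxOK-suc r c)) (every-∧ (n ∸ r) (λ c → boxOK n T (r , c)) _)) ⟩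
        (d ∧ e) ∧ (f ∧ B r)
          ≡⟨ trans (cong ((d ∧ e) ∧_) (𝔹.∧-comm f (B r))) (trans (sym (𝔹.∧-assoc (d ∧ e) (B r) f)) (𝔹.∧-comm _ f)) ⟩
        f ∧ ((d ∧ e) ∧ B r)
          ≡⟨ cong (f ∧_) (𝔹.∧-assoc d e (B r)) ⟩
        f ∧ K r ∎
        where
        d = (r ≡ᵇ n) ⇒ not (isEmp (nth col r))
        e = isAG (nth col r) ⇒ clear col r
        f = every (n ∸ r) (λ c → boxOK n T (r , c))

  -- A β or δ in the top row demands that the top box be empty, and so does each α or γ further
  -- down; the disjunction collects all these demands.
  columnOK-∷ : ∀ {n L T} x xs → length L ≡ suc n → length xs ≡ suc n →
    columnOK (suc n) (x ∷ xs) (L ∷ T) ≡ ((anyB isBD L ∨ anyB isAG xs) ⇒ isEmp x) ∧ columnOK n xs T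
  columnOK-∷ {n} {L} {T} x xs lenL lenxs = begin
    ((isAG x ⇒ true) ∧ every (suc n) (λ c → isBD (nth L c) ⇒ isEmp x)) ∧ every (suc n) K′
      ≡⟨ cong₂ _∧_ (cong₂ _∧_ (𝔹.if-eta (isAG x)) (every-⇒ isBD L (isEmp x) lenL))
           (trans (every-cong (suc n) (λ r _ → split r)) (every-∧ (suc n) (λ r → isAG (nth xs r) ⇒ isEmp x) K)) ⟩
    (anyB isBD L ⇒ isEmp x) ∧ (every (suc n) (λ r → isAG (nth xs r) ⇒ isEmp x) ∧ columnOK n xs T)
      ≡⟨ cong (λ b → (anyB isBD L ⇒ isEmp x) ∧ (b ∧ columnOK n xs T)) (every-⇒ isAG xs (isEmp x) lenxs) ⟩
    (anyB isBD L ⇒ isEmp x) ∧ ((anyB isAG xs ⇒ isEmp x) ∧ columnOK n xs T)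
      ≡⟨ trans (sym (𝔹.∧-assoc (anyB isBD L ⇒ isEmp x) _ _)) (cong (_∧ columnOK n xs T) (sym (∨-⇒ (anyB isBD L) _ _))) ⟩
    ((anyB isBD L ∨ anyB isAG xs) ⇒ isEmp x) ∧ columnOK n xs T ∎
    where
    open ≡-Reasoning
    K′ : ℕ → Bool
    K′ r = ((r ≡ᵇ n) ⇒ not (isEmp (nth xs r))) ∧ (isAG (nth xs r) ⇒ (isEmp x ∧ clear xs r))
           ∧ every (n ∸ r) (λ c → isBD (get T r c) ⇒ isEmp (nth xs r))
    K : ℕ → Bool
    K r = ((r ≡ᵇ n) ⇒ not (isEmp (nth xs r))) ∧ (isAG (nth xs r) ⇒ clear xs r)
          ∧ every (n ∸ r) (λ c → isBD (get T r c) ⇒ isEmp (nth xs r))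
    split : ∀ r → K′ r ≡ (isAG (nth xs r) ⇒ isEmp x) ∧ K r
    split r = trans (cong (λ b → d ∧ b ∧ B) (⇒-∧ (isAG (nth xs r)) _ _))
      (trans (cong (d ∧_) (𝔹.∧-assoc a _ B)) (trans (sym (𝔹.∧-assoc d a _))
        (trans (cong (_∧ _) (𝔹.∧-comm d a)) (𝔹.∧-assoc a d _))))
      where
      a = isAG (nth xs r) ⇒ isEmp x
      d = (r ≡ᵇ n) ⇒ not (isEmp (nth xs r))
      B = every (n ∸ r) (λ c → isBD (get T r c) ⇒ isEmp (nth xs r))

  types : Filling → List Label
  types = map firstLabeled

  -- Validity seen through the leftmost labels of the rows and the topmost label of the column below
  -- a box. This suffices because in a valid filling a β or δ can only be the leftmost label of its
  -- row, and an α or γ only the topmost label of its column.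
  columnOKᵗ : List Label → List Label → Bool
  columnOKᵗ []       ρs       = true
  columnOKᵗ (x ∷ xs) []       = not (isEmp x)
  columnOKᵗ (x ∷ xs) (ρ ∷ ρs) = ((isBD ρ ∨ isAG (firstLabeled xs)) ⇒ isEmp x) ∧ columnOKᵗ xs ρs

  RowOK : List Label → Set
  RowOK L = anyB isBD L ≡ isBD (firstLabeled L) × isEmp (firstLabeled L) ≡ false

  ⇒-false : ∀ b → (b ⇒ false) ≡ true → b ≡ false
  ⇒-false false _ = refl

  ∨-conseq : ∀ a b → (a ∨ b) ⇒ false ≡ true → b ≡ false
  ∨-conseq false false _ = refl

  -- The common core for rows, where `P` selects β and δ, and columns, where it selects α and γ: a
  -- labelled box excludes `P` from all boxes after it, so the first label decides whether `P`
  -- occurs.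
  anyB-firstLabeled : ∀ {P} → P emp ≡ false → ∀ x xs → (isEmp x ≡ false → anyB P xs ≡ false) →
    anyB P xs ≡ P (firstLabeled xs) → anyB P (x ∷ xs) ≡ P (firstLabeled (x ∷ xs))
  anyB-firstLabeled P-emp emp xs h ih rewrite P-emp = ih
  anyB-firstLabeled {P} P-emp lα xs h ih rewrite h refl = 𝔹.∨-identityʳ _
  anyB-firstLabeled {P} P-emp lβ xs h ih rewrite h refl = 𝔹.∨-identityʳ _
  anyB-firstLabeled {P} P-emp lγ xs h ih rewrite h refl = 𝔹.∨-identityʳ _
  anyB-firstLabeled {P} P-emp lδ xs h ih rewrite h refl = 𝔹.∨-identityʳ _

  columnOK-anyAG : ∀ {n T} → Shape n T → ∀ col → length col ≡ suc n → columnOK n col T ≡ true →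
                   anyB isAG col ≡ isAG (firstLabeled col)
  columnOK-anyAG []      (x ∷ []) _   _  = anyB-firstLabeled {isAG} refl x [] (λ _ → refl) refl
  columnOK-anyAG (_∷_ {L = L} {T = T} l s) (x ∷ xs) len ok with ∧-true (trans (sym (columnOK-∷ {L = L} {T = T} x xs l (ℕₚ.suc-injective len))) ok)
  ... | h , ok′ = anyB-firstLabeled {isAG} refl x xs
    (λ x≢emp → ∨-conseq (anyB isBD L) (anyB isAG xs) (subst (λ b → ((anyB isBD L ∨ anyB isAG xs) ⇒ b) ≡ true) x≢emp h))
    (columnOK-anyAG s xs (ℕₚ.suc-injective len) ok′)

  columnOK-types : ∀ {n T} → Shape n T → All RowOK T → ∀ col → length col ≡ suc n →
                   columnOK n col T ≡ columnOKᵗ col (types T)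
  columnOK-types [] [] (x ∷ []) _ =
    trans (𝔹.∧-identityʳ _) (trans (cong (not (isEmp x) ∧_) (trans (𝔹.∧-identityʳ _) (𝔹.if-eta (isAG x)))) (𝔹.∧-identityʳ _))
  columnOK-types {n = suc n} {T = L ∷ T} (l ∷ s) ((bd , _) ∷ rows) (x ∷ xs) len
    with columnOK n xs T in eq | columnOK-types s rows xs (ℕₚ.suc-injective len)
       | columnOK-∷ {L = L} {T = T} x xs l (ℕₚ.suc-injective len)
  -- The topmost label is known to reveal every α and γ only when the lower part of the column is
  -- valid; otherwise both sides are false.
  ... | false | ih | step = trans step (trans (𝔹.∧-zeroʳ _)
          (trans (sym (𝔹.∧-zeroʳ ((isBD (firstLabeled L) ∨ isAG (firstLabeled xs)) ⇒ isEmp x))) (cong (_ ∧_) ih)))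
  ... | true  | ih | step = trans step (cong₂ (λ b b′ → (b ⇒ isEmp x) ∧ b′)
          (cong₂ _∨_ bd (columnOK-anyAG s xs (ℕₚ.suc-injective len) eq)) ih)

  row-anyBD : ∀ L → (∀ c → c < length L → (isBD (nth L c) ⇒ clear L c) ≡ true) →
              anyB isBD L ≡ isBD (firstLabeled L)
  row-anyBD []      h = refl
  row-anyBD (x ∷ L) h = anyB-firstLabeled {isBD} refl x L nonempty (row-anyBD L tail)
    where
    parts : ∀ c → c < length L → (isBD (nth L c) ⇒ isEmp x) ≡ true × (isBD (nth L c) ⇒ clear L c) ≡ true
    parts c c< = ∧-true (trans (sym (⇒-∧ (isBD (nth L c)) _ _)) (h (suc c) (s≤s c<)))
    tail : ∀ c → c < length L → (isBD (nth L c) ⇒ clear L c) ≡ true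
    tail c c< = proj₂ (parts c c<)
    every-all : ∀ n p → (∀ i → i < n → p i ≡ true) → every n p ≡ true
    every-all zero    p h = refl
    every-all (suc n) p h rewrite h 0 (s≤s z≤n) = every-all n (p ∘ suc) (λ i i<n → h (suc i) (s≤s i<n))
    nonempty : isEmp x ≡ false → anyB isBD L ≡ false
    nonempty x≢emp = ⇒-false (anyB isBD L) (subst (λ b → (anyB isBD L ⇒ b) ≡ true) x≢emp
      (trans (sym (every-⇒ isBD L (isEmp x) refl)) (every-all (length L) _ (λ c c< → proj₁ (parts c c<)))))

  firstLabeled-nonempty : ∀ L c → isEmp (nth L c) ≡ false → isEmp (firstLabeled L) ≡ false
  firstLabeled-nonempty (emp ∷ L) (suc c) h = firstLabeled-nonempty L c h
  firstLabeled-nonempty (lα ∷ L)  c       h = refl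
  firstLabeled-nonempty (lβ ∷ L)  c       h = refl
  firstLabeled-nonempty (lγ ∷ L)  c       h = refl
  firstLabeled-nonempty (lδ ∷ L)  c       h = refl

  staircase-rowOK : ∀ {n T} → Shape n T → isStaircase n T ≡ true → ∀ r → r < n → RowOK (rowOf T r)
  staircase-rowOK {n} {T} s ok r r<n = row-anyBD (rowOf T r) left , firstLabeled-nonempty (rowOf T r) c₀ diagonal
    where
    box : ∀ c → c < n ∸ r → boxOK n T (r , c) ≡ true
    box = every-true (n ∸ r) _ (every-true n _ (trans (sym (allB-boxes (boxOK n T) n)) ok) r r<n)
    left : ∀ c → c < length (rowOf T r) → (isBD (get T r c) ⇒ clear (rowOf T r) c) ≡ true
    left c c< = trans (cong (isBD (get T r c) ⇒_) (sym (allB-applyUpTo (λ c′ → isEmp (get T r c′)) id c)))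
      (proj₁ (∧-true (proj₂ (∧-true {if suc (r ℕ.+ c) ≡ᵇ n then not (isEmp (get T r c)) else true}
        (box c (subst (c <_) (rowOf-length s r) c<))))))
    c₀ = n ∸ suc r
    on-diagonal : (suc (r ℕ.+ c₀) ≡ᵇ n) ≡ true
    on-diagonal rewrite ℕₚ.m+[n∸m]≡n r<n = ≡ᵇ-refl n
      where
      ≡ᵇ-refl : ∀ n → (n ≡ᵇ n) ≡ true
      ≡ᵇ-refl zero    = refl
      ≡ᵇ-refl (suc n) = ≡ᵇ-refl n
    diagonal : isEmp (get T r c₀) ≡ false
    diagonal = not-true (subst (λ b → (b ⇒ not (isEmp (get T r c₀))) ≡ true) on-diagonal
      (proj₁ (∧-true (box c₀ (ℕₚ.∸-monoʳ-< (ℕₚ.n<1+n r) r<n)))))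
      where
      not-true : ∀ {b} → not b ≡ true → b ≡ false
      not-true {false} _ = refl

  staircase-rowsOK : ∀ {n T} → Shape n T → isStaircase n T ≡ true → All RowOK T
  staircase-rowsOK {n} {T} s ok = rows T (λ r r< → staircase-rowOK s ok r (subst (r <_) (Shape-length s) r<))
    where
    rows : ∀ T → (∀ r → r < length T → RowOK (rowOf T r)) → All RowOK T
    rows []      h = []
    rows (L ∷ T) h = h 0 (s≤s z≤n) ∷ rows T (λ r r< → h (suc r) (s≤s r<))

  newTypes : List Label → List Label → List Label
  newTypes []       ρs       = []
  newTypes (x ∷ xs) []       = x ∷ newTypes xs []
  newTypes (x ∷ xs) (ρ ∷ ρs) = firstLabeled (x ∷ ρ ∷ []) ∷ newTypes xs ρs

  firstLabeled-∷ : ∀ x L → firstLabeled (x ∷ L) ≡ firstLabeled (x ∷ firstLabeled L ∷ [])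
  firstLabeled-∷ emp []      = refl
  firstLabeled-∷ emp (emp ∷ L) = firstLabeled-∷ emp L
  firstLabeled-∷ emp (lα ∷ L) = refl
  firstLabeled-∷ emp (lβ ∷ L) = refl
  firstLabeled-∷ emp (lγ ∷ L) = refl
  firstLabeled-∷ emp (lδ ∷ L) = refl
  firstLabeled-∷ lα  L       = refl
  firstLabeled-∷ lβ  L       = refl
  firstLabeled-∷ lγ  L       = refl
  firstLabeled-∷ lδ  L       = refl

  types-glue : ∀ col T → types (glue col T) ≡ newTypes col (types T)
  types-glue []       T       = refl
  types-glue (x ∷ xs) []      = cong₂ _∷_ (single x) (types-glue xs [])
    where
    single : ∀ x → firstLabeled (x ∷ []) ≡ x
    single emp = refl
    single lα = refl
    single lβ = refl
    single lγ = refl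
    single lδ = refl
  types-glue (x ∷ xs) (L ∷ T) = cong₂ _∷_ (firstLabeled-∷ x L) (types-glue xs T)

  applyUpTo-nth : ∀ L {m} → length L ≡ m → applyUpTo (nth L) m ≡ L
  applyUpTo-nth []      refl = refl
  applyUpTo-nth (x ∷ L) refl = cong (x ∷_) (applyUpTo-nth L refl)

  nth-drop : ∀ xs r i → nth xs (r ℕ.+ i) ≡ nth (drop r xs) i
  nth-drop xs       zero    i = refl
  nth-drop []       (suc r) i = refl
  nth-drop (x ∷ xs) (suc r) i = nth-drop xs r i

  module _ {n T} (col : List Label) (shape : Shape n T) (len : length col ≡ suc n) where
    private
      T⁺ : Filling
      T⁺ = glue col T

    get-suc : ∀ r c → get T⁺ r (suc c) ≡ get T r c
    get-suc = get-glue-suc col T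
        (ℕₚ.≤-trans (ℕₚ.≤-reflexive (Shape-length shape)) (ℕₚ.≤-trans (ℕₚ.n≤1+n n) (ℕₚ.≤-reflexive (sym len))))

    rightOf-suc : ∀ r c → rightOf (suc n) T⁺ r (suc c) ≡ rightOf n T r c
    rightOf-suc r c = cong firstLabeled (begin
      map (λ i → get T⁺ r (suc (suc c) ℕ.+ i)) (upTo (suc n ∸ r ∸ suc (suc c)))
        ≡⟨ Listₚ.map-cong (λ i → get-suc r (suc c ℕ.+ i)) _ ⟩
      map (λ i → get T r (suc c ℕ.+ i)) (upTo (suc n ∸ r ∸ suc (suc c)))
        ≡⟨ cong (λ m → map (λ i → get T r (suc c ℕ.+ i)) (upTo m)) (begin
             suc n ∸ r ∸ suc (suc c)     ≡⟨ ℕₚ.∸-+-assoc (suc n) r _ ⟩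
             suc n ∸ (r ℕ.+ suc (suc c)) ≡⟨ cong (suc n ∸_) (ℕₚ.+-suc r (suc c)) ⟩
             n ∸ (r ℕ.+ suc c)           ≡⟨ ℕₚ.∸-+-assoc n r (suc c) ⟨
             n ∸ r ∸ suc c               ∎) ⟩
      map (λ i → get T r (suc c ℕ.+ i)) (upTo (n ∸ r ∸ suc c)) ∎)
      where open ≡-Reasoning

    belowOf-suc : ∀ r c → belowOf (suc n) T⁺ r (suc c) ≡ belowOf n T r c
    belowOf-suc r c = cong firstLabeled (Listₚ.map-cong (λ i → get-suc (suc r ℕ.+ i) c) (upTo (n ∸ c ∸ suc r)))

    rightOf-zero : ∀ r → rightOf (suc n) T⁺ r 0 ≡ firstLabeled (rowOf T r)
    rightOf-zero r = cong firstLabeled (begin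
      map (λ i → get T⁺ r (suc i)) (upTo (suc n ∸ r ∸ 1))
        ≡⟨ Listₚ.map-cong (λ i → get-suc r i) _ ⟩
      map (nth (rowOf T r)) (upTo (suc n ∸ r ∸ 1))
        ≡⟨ cong (λ m → map (nth (rowOf T r)) (upTo m)) (trans (ℕₚ.∸-+-assoc (suc n) r 1) (cong (suc n ∸_) (ℕₚ.+-comm r 1))) ⟩
      map (nth (rowOf T r)) (upTo (n ∸ r))
        ≡⟨ trans (Listₚ.map-applyUpTo id (nth (rowOf T r)) (n ∸ r)) (applyUpTo-nth _ (rowOf-length shape r)) ⟩
      rowOf T r ∎)
      where open ≡-Reasoning

    belowOf-zero : ∀ r → belowOf (suc n) T⁺ r 0 ≡ firstLabeled (drop (suc r) col)
    belowOf-zero r = cong firstLabeled (begin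
      map (λ i → get T⁺ (suc r ℕ.+ i) 0) (upTo (n ∸ r))
        ≡⟨ Listₚ.map-cong (λ i → trans (get-glue-zero col T (suc r ℕ.+ i)) (nth-drop col (suc r) i)) _ ⟩
      map (nth (drop (suc r) col)) (upTo (n ∸ r))
        ≡⟨ trans (Listₚ.map-applyUpTo id (nth (drop (suc r) col)) (n ∸ r))
             (applyUpTo-nth _ (trans (Listₚ.length-drop (suc r) col) (cong (_∸ suc r) len))) ⟩
      drop (suc r) col ∎)
      where open ≡-Reasoning

-- Sums over tableaux and the operator y D + E

module TableauSums {ℓc ℓ : Level} (F : CommutativeRing ℓc ℓ)
                (α β γ δ q y : CommutativeRing.Carrier F) where
  open CommutativeRing F hiding (zero)
  open Tableaux
  open P using (_≡_)
  open IntegerSolver F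
  open Sums F
  open Transfer F α β γ δ q
  open import Relation.Binary.Reasoning.Setoid setoid

  sumLabels : (Label → Carrier) → Carrier
  sumLabels h = sumR F (map h labels)

  sumLists : ℕ → (List Label → Carrier) → Carrier
  sumLists zero    g = g []
  sumLists (suc m) g = sumLabels (λ l → sumLists m (λ L → g (l ∷ L)))

  sumFillings : ℕ → (Filling → Carrier) → Carrier
  sumFillings zero    g = g []
  sumFillings (suc n) g = sumLists (suc n) (λ L → sumFillings n (λ T → g (L ∷ T)))

  sumLabels-cong : ∀ {g h} → (∀ l → g l ≈ h l) → sumLabels g ≈ sumLabels h
  sumLabels-cong e = +-cong (e emp) (+-cong (e lα) (+-cong (e lβ) (+-cong (e lγ) (+-cong (e lδ) refl))))

  sumLists-cong : ∀ m {g h} → (∀ L → length L ≡ m → g L ≈ h L) → sumLists m g ≈ sumLists m h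
  sumLists-cong zero    e = e [] P.refl
  sumLists-cong (suc m) e = sumLabels-cong (λ l → sumLists-cong m (λ L len → e (l ∷ L) (P.cong suc len)))

  sumFillings-cong : ∀ n {g h} → (∀ T → Shape n T → g T ≈ h T) → sumFillings n g ≈ sumFillings n h
  sumFillings-cong zero    e = e [] []
  sumFillings-cong (suc n) e =
    sumLists-cong (suc n) (λ L len → sumFillings-cong n (λ T s → e (L ∷ T) (len ∷ s)))

  Additive : ∀ {A : Set} → ((A → Carrier) → Carrier) → Set _
  Additive {A} Σ = ∀ s t (g h : A → Carrier) → Σ (λ x → s * g x + t * h x) ≈ s * Σ g + t * Σ h

  sumLabels-lin : Additive sumLabels
  sumLabels-lin s t g h = solve 12 (λ s t a b c d e a′ b′ c′ d′ e′ →
    (s :* a :+ t :* a′) :+ ((s :* b :+ t :* b′) :+ ((s :* c :+ t :* c′) :+ ((s :* d :+ t :* d′) :+ ((s :* e :+ t :* e′) :+ con (ℤ.+ 0)))))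
    := s :* (a :+ (b :+ (c :+ (d :+ (e :+ con (ℤ.+ 0)))))) :+ t :* (a′ :+ (b′ :+ (c′ :+ (d′ :+ (e′ :+ con (ℤ.+ 0)))))))
    refl s t (g emp) (g lα) (g lβ) (g lγ) (g lδ) (h emp) (h lα) (h lβ) (h lγ) (h lδ)

  sumLists-lin : ∀ m → Additive (sumLists m)
  sumLists-lin zero    s t g h = refl
  sumLists-lin (suc m) s t g h = trans (sumLabels-cong (λ l → sumLists-lin m s t (g ∘ (l ∷_)) (h ∘ (l ∷_))))
    (sumLabels-lin s t (λ l → sumLists m (g ∘ (l ∷_))) (λ l → sumLists m (h ∘ (l ∷_))))

  sumFillings-lin : ∀ n → Additive (sumFillings n)
  sumFillings-lin zero    s t g h = refl
  sumFillings-lin (suc n) s t g h = trans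
    (sumLists-cong (suc n) (λ L _ → sumFillings-lin n s t (g ∘ (L ∷_)) (h ∘ (L ∷_))))
    (sumLists-lin (suc n) s t (λ L → sumFillings n (g ∘ (L ∷_))) (λ L → sumFillings n (h ∘ (L ∷_))))

  Cong : ∀ {A : Set} → ((A → Carrier) → Carrier) → Set _
  Cong {A} Σ = ∀ {g h : A → Carrier} → (∀ x → g x ≈ h x) → Σ g ≈ Σ h

  *ˡ-out : ∀ {A : Set} {Σ : (A → Carrier) → Carrier} → Cong Σ → Additive Σ → ∀ s g → Σ (λ x → s * g x) ≈ s * Σ g
  *ˡ-out cg ad s g = trans (cg (λ _ → sym (trans (+-congˡ (zeroˡ _)) (+-identityʳ _))))
    (trans (ad s 0# g g) (trans (+-congˡ (zeroˡ _)) (+-identityʳ _)))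

  sumLabels-swap : ∀ {A : Set} {Σ : (A → Carrier) → Carrier} → Cong Σ → Additive Σ →
    ∀ (h : Label → A → Carrier) → Σ (λ x → sumLabels (λ l → h l x)) ≈ sumLabels (λ l → Σ (h l))
  sumLabels-swap {Σ = Σ} cg ad h =
    step (h emp) (step (h lα) (step (h lβ) (step (h lγ) (step (h lδ) base))))
    where
    step : ∀ g {k K} → Σ k ≈ K → Σ (λ x → g x + k x) ≈ Σ g + K
    step g {k} e = trans (cg (λ _ → sym (+-cong (*-identityˡ _) (*-identityˡ _))))
      (trans (ad 1# 1# g k) (+-cong (*-identityˡ _) (trans (*-identityˡ _) e)))
    base : Σ (λ _ → 0#) ≈ 0#
    base = trans (cg (λ _ → sym (zeroˡ 0#))) (trans (*ˡ-out cg ad 0# (λ _ → 0#)) (zeroˡ _))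

  sumLists-cong′ : ∀ m → Cong (sumLists m)
  sumLists-cong′ m e = sumLists-cong m (λ L _ → e L)

  sumFillings-cong′ : ∀ n → Cong (sumFillings n)
  sumFillings-cong′ n e = sumFillings-cong n (λ T _ → e T)

  -- An exchange of summations: the first entry `x` of the top row is moved inward past the rest `L`
  -- of that row and past the smaller filling `T`, to join the entries `xs` that the induction
  -- hypothesis has already collected in a column.
  sumFillings-glue : ∀ n g → sumFillings (suc n) g ≈ sumFillings n (λ T → sumLists (suc n) (λ col → g (glue col T)))
  sumFillings-glue zero    g = refl
  sumFillings-glue (suc n) g = begin
    sumLabels (λ x → sumLists (suc n) (λ L → sumFillings (suc n) (λ T → g ((x ∷ L) ∷ T))))
      ≈⟨ sumLabels-cong (λ x → sumLists-cong′ (suc n) (λ L → sumFillings-glue n (λ T → g ((x ∷ L) ∷ T)))) ⟩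
    sumLabels (λ x → sumLists (suc n) (λ L → sumFillings n (λ T → sumLists (suc n) (λ xs → g ((x ∷ L) ∷ glue xs T)))))
      ≈⟨ sumLabels-swap (sumLists-cong′ (suc n)) (sumLists-lin (suc n))
           (λ x L → sumFillings n (λ T → sumLists (suc n) (λ xs → g ((x ∷ L) ∷ glue xs T)))) ⟨
    sumLists (suc n) (λ L → sumLabels (λ x → sumFillings n (λ T → sumLists (suc n) (λ xs → g ((x ∷ L) ∷ glue xs T)))))
      ≈⟨ sumLists-cong′ (suc n) (λ L → sym (sumLabels-swap (sumFillings-cong′ n) (sumFillings-lin n)
           (λ x T → sumLists (suc n) (λ xs → g ((x ∷ L) ∷ glue xs T))))) ⟩
    sumLists (suc n) (λ L → sumFillings n (λ T → sumLabels (λ x → sumLists (suc n) (λ xs → g ((x ∷ L) ∷ glue xs T))))) ∎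

  sumR-++ : ∀ xs ys → sumR F (xs ++ ys) ≈ sumR F xs + sumR F ys
  sumR-++ []       ys = sym (+-identityˡ _)
  sumR-++ (x ∷ xs) ys = trans (+-congˡ (sumR-++ xs ys)) (sym (+-assoc _ _ _))

  prodR-++ : ∀ xs ys → prodR F (xs ++ ys) ≈ prodR F xs * prodR F ys
  prodR-++ []       ys = sym (*-identityˡ _)
  prodR-++ (x ∷ xs) ys = trans (*-congˡ (prodR-++ xs ys)) (sym (*-assoc _ _ _))

  sumR-concatMap : ∀ {A B C : Set} (g : C → Carrier) (k : A → B → C) (ys : List B) xs →
    sumR F (map g (concatMap (λ x → map (k x) ys) xs)) ≈ sumR F (map (λ x → sumR F (map (g ∘ k x) ys)) xs)
  sumR-concatMap g k ys []       = refl
  sumR-concatMap g k ys (x ∷ xs) = begin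
    sumR F (map g (map (k x) ys ++ concatMap (λ x → map (k x) ys) xs))
      ≡⟨ P.cong (sumR F) (Listₚ.map-++ g (map (k x) ys) _) ⟩
    sumR F (map g (map (k x) ys) ++ map g (concatMap (λ x → map (k x) ys) xs))
      ≈⟨ sumR-++ (map g (map (k x) ys)) _ ⟩
    sumR F (map g (map (k x) ys)) + sumR F (map g (concatMap (λ x → map (k x) ys) xs))
      ≈⟨ +-cong (reflexive (P.cong (sumR F) (P.sym (Listₚ.map-∘ ys)))) (sumR-concatMap g k ys xs) ⟩
    sumR F (map (g ∘ k x) ys) + sumR F (map (λ x → sumR F (map (g ∘ k x) ys)) xs) ∎

  sumR-allRows : ∀ m g → sumR F (map g (allRows m)) ≈ sumLists m g
  sumR-allRows zero    g = +-identityʳ _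
  sumR-allRows (suc m) g = trans (sumR-concatMap g _∷_ (allRows m) labels)
    (sumLabels-cong (λ l → sumR-allRows m (g ∘ (l ∷_))))

  sumR-cong : ∀ {A : Set} {g h : A → Carrier} xs → (∀ x → g x ≈ h x) → sumR F (map g xs) ≈ sumR F (map h xs)
  sumR-cong []       e = refl
  sumR-cong (x ∷ xs) e = +-cong (e x) (sumR-cong xs e)

  sumR-fillings : ∀ n g → sumR F (map g (allFillings n)) ≈ sumFillings n g
  sumR-fillings zero    g = +-identityʳ _
  sumR-fillings (suc n) g = begin
    sumR F (map g (fillingsWith (suc n ∷ map (suc n ∸_) (applyUpTo suc n))))
      ≡⟨ P.cong (λ ms → sumR F (map g (fillingsWith (suc n ∷ ms))))
           (P.trans (Listₚ.map-applyUpTo suc (suc n ∸_) n) (P.sym (Listₚ.map-applyUpTo id (n ∸_) n))) ⟩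
    sumR F (map g (concatMap (λ row → map (row ∷_) (allFillings n)) (allRows (suc n))))
      ≈⟨ sumR-concatMap g _∷_ (allFillings n) (allRows (suc n)) ⟩
    sumR F (map (λ L → sumR F (map (g ∘ (L ∷_)) (allFillings n))) (allRows (suc n)))
      ≈⟨ sumR-cong (allRows (suc n)) (λ L → sumR-fillings n (g ∘ (L ∷_))) ⟩
    sumR F (map (λ L → sumFillings n (g ∘ (L ∷_))) (allRows (suc n)))
      ≈⟨ sumR-allRows (suc n) _ ⟩
    sumFillings (suc n) g ∎

  ind : Bool → Carrier
  ind b = if b then 1# else 0#

  ind-∧ : ∀ a b → ind (a ∧ b) ≈ ind a * ind b
  ind-∧ true  b = sym (*-identityˡ _)
  ind-∧ false b = sym (zeroˡ _)

  sumR-filterᵇ : ∀ {A : Set} (g : A → Carrier) p xs →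
                 sumR F (map g (filterᵇ p xs)) ≈ sumR F (map (λ x → ind (p x) * g x) xs)
  sumR-filterᵇ g p []       = refl
  sumR-filterᵇ g p (x ∷ xs) with p x
  ... | true  = +-cong (sym (*-identityˡ _)) (sumR-filterᵇ g p xs)
  ... | false = trans (sumR-filterᵇ g p xs) (sym (trans (+-congʳ (zeroˡ _)) (+-identityˡ _)))

  -- An indicator replaces the filter, so sums run over all fillings of the shape and can be
  -- regrouped freely.
  weight : ℕ → Filling → Carrier
  weight n T = ind (isStaircase n T) * (wt F α β γ δ q n T * y ^ bullets n T)

  Z-weight : ∀ n → Z F α β γ δ q n y ≈ sumFillings n (weight n)
  Z-weight n = trans (sumR-filterᵇ _ (isStaircase n) (allFillings n)) (sumR-fillings n (weight n))

  prodR-boxes : ∀ n (h : ℕ × ℕ → Carrier) → prodR F (map h (boxes n)) ≈ Prod n (λ r → Prod (n ∸ r) (λ c → h (r , c)))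
  prodR-boxes n h = go id n
    where
    row : ℕ → List (ℕ × ℕ)
    row r = map (r ,_) (upTo (n ∸ r))
    go : ∀ f m → prodR F (map h (concatMap row (applyUpTo f m))) ≈ Prod m (λ i → Prod (n ∸ f i) (λ c → h (f i , c)))
    go f zero    = refl
    go f (suc m) = trans (reflexive (P.cong (prodR F) (Listₚ.map-++ h (row (f 0)) _)))
      (trans (prodR-++ (map h (row (f 0))) _) (*-cong
        (reflexive (P.trans (P.cong (prodR F) (P.sym (Listₚ.map-∘ (upTo (n ∸ f 0))))) (prodR-map-applyUpTo _ id (n ∸ f 0))))
        (go (f ∘ suc) m)))

  bulletWt : Label → Carrier
  bulletWt l = if isBullet l then y else 1#

  y^bullets : ∀ n T → y ^ bullets n T ≈ Prod n (λ r → bulletWt (get T r (n ∸ suc r)))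
  y^bullets n T = go id n
    where
    go : ∀ f m → y ^ length (filterᵇ (λ r → isBullet (get T r (n ∸ suc r))) (applyUpTo f m))
                 ≈ Prod m (λ i → bulletWt (get T (f i) (n ∸ suc (f i))))
    go f zero    = refl
    go f (suc m) with isBullet (get T (f 0) (n ∸ suc (f 0)))
    ... | true  = *-congˡ (go (f ∘ suc) m)
    ... | false = trans (go (f ∘ suc) m) (sym (*-identityˡ _))

  cellWt : Label → Label → Label → Carrier
  cellWt emp ρ s = emptyWt F α β γ δ q ρ s
  cellWt l   ρ s = labelWt F α β γ δ q l

  boxWt-cellWt : ∀ n T r c → boxWt F α β γ δ q n T (r , c) ≡ cellWt (get T r c) (rightOf n T r c) (belowOf n T r c)
  boxWt-cellWt n T r c with get T r c
  ... | emp = P.refl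
  ... | lα  = P.refl
  ... | lβ  = P.refl
  ... | lγ  = P.refl
  ... | lδ  = P.refl

  columnWt : List Label → List Label → Carrier
  columnWt []       ρs       = 1#
  columnWt (x ∷ xs) []       = cellWt x emp emp * bulletWt x
  columnWt (x ∷ xs) (ρ ∷ ρs) = cellWt x ρ (firstLabeled xs) * columnWt xs ρs

  columnWt-Prod : ∀ {n T} → Shape n T → ∀ col → length col ≡ suc n →
    Prod (suc n) (λ r → cellWt (nth col r) (firstLabeled (rowOf T r)) (firstLabeled (drop (suc r) col)))
      * bulletWt (nth col n) ≈ columnWt col (types T)
  columnWt-Prod []      (x ∷ []) _   = *-congʳ (*-identityʳ _)
  columnWt-Prod (_ ∷ s) (x ∷ xs) len = trans (*-assoc _ _ _) (*-congˡ (columnWt-Prod s xs (ℕₚ.suc-injective len)))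

  wt-glue : ∀ {n T} col → Shape n T → length col ≡ suc n →
    wt F α β γ δ q (suc n) (glue col T) * y ^ bullets (suc n) (glue col T)
      ≈ wt F α β γ δ q n T * y ^ bullets n T * columnWt col (types T)
  wt-glue {n} {T} col s len = begin
    wt F α β γ δ q (suc n) T⁺ * y ^ bullets (suc n) T⁺
      ≈⟨ *-cong wts bul ⟩
    (C * wt F α β γ δ q n T) * (y ^ bullets n T * bulletWt (nth col n))
      ≈⟨ solve 4 (λ a b c d → (a :* b) :* (c :* d) := b :* c :* (a :* d)) refl _ _ _ _ ⟩
    wt F α β γ δ q n T * y ^ bullets n T * (C * bulletWt (nth col n))
      ≈⟨ *-congˡ (columnWt-Prod s col len) ⟩
    wt F α β γ δ q n T * y ^ bullets n T * columnWt col (types T) ∎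
    where
    T⁺ = glue col T
    bw : ℕ → ℕ → Carrier
    bw r c = boxWt F α β γ δ q n T (r , c)
    cw : ℕ → Carrier
    cw r = cellWt (nth col r) (firstLabeled (rowOf T r)) (firstLabeled (drop (suc r) col))
    C = Prod (suc n) cw
    box-suc : ∀ r c → boxWt F α β γ δ q (suc n) T⁺ (r , suc c) ≈ bw r c
    box-suc r c = reflexive (P.trans (boxWt-cellWt (suc n) T⁺ r (suc c)) (P.trans
      (P.cong₂ (λ l (ρs : Label × Label) → cellWt l (proj₁ ρs) (proj₂ ρs)) (get-suc col s len r c)
        (P.cong₂ _,_ (rightOf-suc col s len r c) (belowOf-suc col s len r c)))
      (P.sym (boxWt-cellWt n T r c))))
    box-zero : ∀ r → boxWt F α β γ δ q (suc n) T⁺ (r , 0) ≈ cw r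
    box-zero r = reflexive (P.trans (boxWt-cellWt (suc n) T⁺ r 0)
      (P.cong₂ (λ l (ρs : Label × Label) → cellWt l (proj₁ ρs) (proj₂ ρs)) (get-glue-zero col T r)
        (P.cong₂ _,_ (rightOf-zero col s len r) (belowOf-zero col s len r))))
    row : ∀ r → r ≤ n → Prod (suc n ∸ r) (λ c → boxWt F α β γ δ q (suc n) T⁺ (r , c)) ≈ cw r * Prod (n ∸ r) (bw r)
    row r r≤n rewrite ℕₚ.+-∸-assoc 1 r≤n = *-cong (box-zero r) (Prod-cong (n ∸ r) (λ c _ → box-suc r c))
    wts : wt F α β γ δ q (suc n) T⁺ ≈ C * wt F α β γ δ q n T
    wts = begin
      wt F α β γ δ q (suc n) T⁺
        ≈⟨ prodR-boxes (suc n) _ ⟩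
      Prod (suc n) (λ r → Prod (suc n ∸ r) (λ c → boxWt F α β γ δ q (suc n) T⁺ (r , c)))
        ≈⟨ Prod-cong (suc n) (λ r r<n → row r (ℕₚ.≤-pred r<n)) ⟩
      Prod (suc n) (λ r → cw r * Prod (n ∸ r) (bw r))
        ≈⟨ Prod-* (suc n) cw (λ r → Prod (n ∸ r) (bw r)) ⟩
      C * Prod (suc n) (λ r → Prod (n ∸ r) (bw r))
        ≈⟨ *-congˡ (trans (Prod-snoc n (λ r → Prod (n ∸ r) (bw r)))
             (trans (*-congˡ (reflexive (P.cong (λ m → Prod m (bw n)) (ℕₚ.n∸n≡0 n)))) (*-identityʳ _))) ⟩
      C * Prod n (λ r → Prod (n ∸ r) (bw r))
        ≈⟨ *-congˡ (sym (prodR-boxes n _)) ⟩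
      C * wt F α β γ δ q n T ∎
    bul : y ^ bullets (suc n) T⁺ ≈ y ^ bullets n T * bulletWt (nth col n)
    bul = begin
      y ^ bullets (suc n) T⁺
        ≈⟨ y^bullets (suc n) T⁺ ⟩
      Prod (suc n) (λ r → bulletWt (get T⁺ r (n ∸ r)))
        ≈⟨ Prod-snoc n _ ⟩
      Prod n (λ r → bulletWt (get T⁺ r (n ∸ r))) * bulletWt (get T⁺ n (n ∸ n))
        ≈⟨ *-cong (Prod-cong n (λ r r<n → reflexive (P.cong bulletWt
               (P.trans (P.cong (get T⁺ r) (ℕₚ.+-∸-assoc 1 r<n)) (get-suc col s len r (n ∸ suc r))))))
             (reflexive (P.cong bulletWt (P.trans (P.cong (get T⁺ n) (ℕₚ.n∸n≡0 n)) (get-glue-zero col T n)))) ⟩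
      Prod n (λ r → bulletWt (get T r (n ∸ suc r))) * bulletWt (nth col n)
        ≈⟨ *-congʳ (y^bullets n T) ⟨
      y ^ bullets n T * bulletWt (nth col n) ∎

  columnFactor : List Label → List Label → Carrier
  columnFactor col ρs = ind (columnOKᵗ col ρs) * columnWt col ρs

  weight-glue : ∀ {n T} col → Shape n T → length col ≡ suc n →
                weight (suc n) (glue col T) ≈ weight n T * columnFactor col (types T)
  weight-glue {n} {T} col s len = trans (*-cong
      (trans (reflexive (P.cong ind (isStaircase-glue col s len))) (ind-∧ (isStaircase n T) _)) (wt-glue col s len))
    (cases (isStaircase n T) P.refl)
    where
    cases : ∀ b → isStaircase n T ≡ b →
      ind (isStaircase n T) * ind (columnOK n col T) * (wt F α β γ δ q n T * y ^ bullets n T * columnWt col (types T))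
        ≈ weight n T * columnFactor col (types T)
    cases true eq = trans (*-congʳ (*-congˡ (reflexive (P.cong ind (columnOK-types s (staircase-rowsOK s eq) col len)))))
      (solve 4 (λ a b c d → a :* b :* (c :* d) := a :* c :* (b :* d)) refl _ _ _ _)
    -- `columnOK` and `columnOKᵗ` are compared only over a valid `T`; for any other `T` both sides
    -- carry the factor 0.
    cases false eq = trans (*-congʳ (*-congʳ (reflexive (P.cong ind eq))))
      (trans (solve 4 (λ b c d e → con (ℤ.+ 0) :* b :* c := con (ℤ.+ 0) :* d :* e) refl _ _ _ _)
        (*-congʳ (*-congʳ (reflexive (P.cong ind (P.sym eq))))))

  countAG countδ : Label → ℕ → ℕ
  countAG lα i = suc i
  countAG lγ i = suc i
  countAG _  i = i
  countδ lδ j = suc j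
  countδ _  j = j

  #AG #δ : List Label → ℕ
  #AG []       = 0
  #AG (ρ ∷ ρs) = countAG ρ (#AG ρs)
  #δ []       = 0
  #δ (ρ ∷ ρs) = countδ ρ (#δ ρs)

  -- The value at `emp` is dropped: the bottom box of a valid new column is labelled, so a topmost
  -- label exists.
  byLabel : (Label → G) → H
  byLabel ψ = ⟨ ψ lα , ψ lβ , ψ lγ , ψ lδ ⟩

  newLabel : H → G
  newLabel ψ i j = α * atα ψ (suc i) j + (β * atβ ψ i j + (γ * atγ ψ (suc i) j + δ * atδ ψ i (suc j)))

  -- The effect of an extra row with leftmost label α or γ: its new box is empty, or it receives
  -- a label, which is possible only if the nearest label below is β or δ.
  topRow : H → H
  topRow ψ = ⟨ X (atα ψ) , (λ i j → q * X (atβ ψ) i j + newLabel ψ i j)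
             , (λ i j → q * X (atγ ψ) i j) , (λ i j → X (atδ ψ) i j + newLabel ψ i j) ⟩

  -- The clauses for `suc i` insert a row at the bottom, `topRow` inserts it at the top. The two
  -- insertions concern opposite ends of the column and commute, so only a column with a single box
  -- has to be computed.
  d̂-topRow : ∀ ψ i j → d̂ (topRow ψ) i j ≈ d̂ ψ (suc i) j
  ê-topRow : ∀ ψ i j → ê (topRow ψ) i j ≈ ê ψ (suc i) j
  d̂-topRow ψ zero zero =
    solve 10 (λ α β γ δ a b u v w z → α :* a :+ δ :* (b :+ (α :* u :+ (β :* v :+ (γ :* w :+ δ :* z))))
      := (α :* a :+ δ :* b) :+ δ :* ((α :* u :+ δ :* z) :+ (β :* v :+ γ :* w))) refl α β γ δ _ _ _ _ _ _
  d̂-topRow ψ zero (suc j) = trans (*-congˡ (d̂-topRow (mapH Y ψ) zero j)) (sym (d̂-Y ψ 1 j))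
  d̂-topRow ψ (suc i) j = +-cong (d̂-topRow (mapH X ψ) i j)
    (*-congˡ (+-cong (d̂-topRow (mapH Y ψ) i j) (ê-topRow (mapH Y ψ) i j)))
  ê-topRow ψ zero zero =
    solve 11 (λ α β γ δ q a b u v w z → β :* (q :* a :+ (α :* u :+ (β :* v :+ (γ :* w :+ δ :* z)))) :+ γ :* (q :* b)
      := q :* (β :* a :+ γ :* b) :+ β :* ((α :* u :+ δ :* z) :+ (β :* v :+ γ :* w))) refl α β γ δ q _ _ _ _ _ _
  ê-topRow ψ zero (suc j) = trans (*-congˡ (ê-topRow (mapH Y ψ) zero j)) (sym (ê-Y ψ 1 j))
  ê-topRow ψ (suc i) j = +-cong (*-congˡ (ê-topRow (mapH X ψ) i j))
    (*-congˡ (+-cong (d̂-topRow ψ i j) (ê-topRow ψ i j)))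

  t̂ : H → G
  t̂ ψ i j = y * d̂ ψ i j + ê ψ i j

  t̂-cong : ∀ {ψ χ} → ψ ≐ᴴ χ → t̂ ψ ≐ t̂ χ
  t̂-cong e i j = +-cong (*-congˡ (d̂-cong e i j)) (ê-cong e i j)

  t̂-scale : ∀ s ψ i j → t̂ (mapH (scale s) ψ) i j ≈ s * t̂ ψ i j
  t̂-scale s ψ i j = trans (t̂-cong ≐⟨ pad , pad , pad , pad ⟩ i j)
    (trans (+-cong (*-congˡ (d̂-lin s 0# ψ ψ i j)) (ê-lin s 0# ψ ψ i j))
      (solve 4 (λ y s a b → let z = con (ℤ.+ 0) in y :* (s :* a :+ z :* a) :+ (s :* b :+ z :* b) := s :* (y :* a :+ b))
        refl y s _ _))
    where
    pad : ∀ {φ} → scale s φ ≐ lin s 0# φ φ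
    pad i j = sym (trans (+-congˡ (zeroˡ _)) (+-identityʳ _))

  columnTerm : (Label → G) → List Label → List Label → Carrier
  columnTerm ψ ρs col = columnFactor col ρs * ψ (firstLabeled col) (#AG (newTypes col ρs)) (#δ (newTypes col ρs))

  step : Label → (Label → G) → Label → Label → G
  step ρ ψ s x i j =
    ind ((isBD ρ ∨ isAG s) ⇒ isEmp x) * cellWt x ρ s
      * ψ (firstLabeled (x ∷ s ∷ [])) (countAG (firstLabeled (x ∷ ρ ∷ [])) i) (countδ (firstLabeled (x ∷ ρ ∷ [])) j)

  columnTerm-∷ : ∀ ψ ρ ρs x xs → columnTerm ψ (ρ ∷ ρs) (x ∷ xs) ≈
    columnFactor xs ρs * step ρ ψ (firstLabeled xs) x (#AG (newTypes xs ρs)) (#δ (newTypes xs ρs))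
  columnTerm-∷ ψ ρ ρs x xs = trans
    (*-cong (*-congʳ (ind-∧ ((isBD ρ ∨ isAG (firstLabeled xs)) ⇒ isEmp x) (columnOKᵗ xs ρs)))
            (reflexive (P.cong (λ s → ψ s (#AG (newTypes (x ∷ xs) (ρ ∷ ρs))) (#δ (newTypes (x ∷ xs) (ρ ∷ ρs)))) (firstLabeled-∷ x xs))))
    (solve 5 (λ a b c d e → (a :* b) :* (c :* d) :* e := (b :* d) :* (a :* c :* e)) refl _ _ _ _ _)

  empty-only : ∀ x a b c d a′ b′ c′ d′ →
    x + (0# * a * a′ + (0# * b * b′ + (0# * c * c′ + (0# * d * d′ + 0#)))) ≈ x
  empty-only = solve 9 (λ x a b c d a′ b′ c′ d′ → let o = con (ℤ.+ 0) in
    x :+ (o :* a :* a′ :+ (o :* b :* b′ :+ (o :* c :* c′ :+ (o :* d :* d′ :+ o)))) := x) refl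

  1*1* : ∀ x → 1# * 1# * x ≈ x
  1*1* x = trans (*-congʳ (*-identityˡ _)) (*-identityˡ _)

  one-of-each : ∀ k e a b c d a′ b′ c′ d′ →
    1# * k * e + (1# * a * a′ + (1# * b * b′ + (1# * c * c′ + (1# * d * d′ + 0#))))
      ≈ k * e + (a * a′ + (b * b′ + (c * c′ + d * d′)))
  one-of-each = solve 10 (λ k e a b c d a′ b′ c′ d′ →
    :1 :* k :* e :+ (:1 :* a :* a′ :+ (:1 :* b :* b′ :+ (:1 :* c :* c′ :+ (:1 :* d :* d′ :+ con (ℤ.+ 0)))))
      := k :* e :+ (a :* a′ :+ (b :* b′ :+ (c :* c′ :+ d :* d′)))) refl

  newBox : Label → (Label → G) → Label → G
  newBox ρ ψ s i j = sumLabels (λ x → step ρ ψ s x i j)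

  newBox-β : ∀ ψ → byLabel (newBox lβ ψ) ≐ᴴ byLabel ψ
  newBox-β ψ = ≐⟨ (λ i j → trans (empty-only _ _ _ _ _ _ _ _ _) (1*1* _))
                , (λ i j → trans (empty-only _ _ _ _ _ _ _ _ _) (1*1* _))
                , (λ i j → trans (empty-only _ _ _ _ _ _ _ _ _) (1*1* _))
                , (λ i j → trans (empty-only _ _ _ _ _ _ _ _ _) (1*1* _)) ⟩

  newBox-δ : ∀ ψ → byLabel (newBox lδ ψ) ≐ᴴ mapH (scale q) (mapH Y (byLabel ψ))
  newBox-δ ψ = ≐⟨ (λ i j → trans (empty-only _ _ _ _ _ _ _ _ _) (*-congʳ (*-identityˡ _)))
                , (λ i j → trans (empty-only _ _ _ _ _ _ _ _ _) (*-congʳ (*-identityˡ _)))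
                , (λ i j → trans (empty-only _ _ _ _ _ _ _ _ _) (*-congʳ (*-identityˡ _)))
                , (λ i j → trans (empty-only _ _ _ _ _ _ _ _ _) (*-congʳ (*-identityˡ _))) ⟩

  newBox-α : ∀ ψ → byLabel (newBox lα ψ) ≐ᴴ topRow (byLabel ψ)
  newBox-α ψ = ≐⟨ (λ i j → trans (empty-only _ _ _ _ _ _ _ _ _) (1*1* _))
                , (λ i j → one-of-each _ _ _ _ _ _ _ _ _ _)
                , (λ i j → trans (empty-only _ _ _ _ _ _ _ _ _) (*-congʳ (*-identityˡ _)))
                , (λ i j → trans (one-of-each _ _ _ _ _ _ _ _ _ _) (+-congʳ (*-identityˡ _))) ⟩

  newBox-γ : ∀ ψ → byLabel (newBox lγ ψ) ≐ᴴ topRow (byLabel ψ)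
  newBox-γ ψ = ≐⟨ (λ i j → trans (empty-only _ _ _ _ _ _ _ _ _) (1*1* _))
                , (λ i j → one-of-each _ _ _ _ _ _ _ _ _ _)
                , (λ i j → trans (empty-only _ _ _ _ _ _ _ _ _) (*-congʳ (*-identityˡ _)))
                , (λ i j → trans (one-of-each _ _ _ _ _ _ _ _ _ _) (+-congʳ (*-identityˡ _))) ⟩

  t̂-topRow : ∀ ψ i j → t̂ (topRow ψ) i j ≈ t̂ ψ (suc i) j
  t̂-topRow ψ i j = +-cong (*-congˡ (d̂-topRow ψ i j)) (ê-topRow ψ i j)

  t̂-newBox : ∀ ρ → isEmp ρ ≡ false → ∀ ψ i j → t̂ (byLabel (newBox ρ ψ)) i j ≈ t̂ (byLabel ψ) (countAG ρ i) (countδ ρ j)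
  t̂-newBox lα _ ψ i j = trans (t̂-cong (newBox-α ψ) i j) (t̂-topRow (byLabel ψ) i j)
  t̂-newBox lγ _ ψ i j = trans (t̂-cong (newBox-γ ψ) i j) (t̂-topRow (byLabel ψ) i j)
  t̂-newBox lβ _ ψ i j = t̂-cong (newBox-β ψ) i j
  t̂-newBox lδ _ ψ i j = trans (t̂-cong (newBox-δ ψ) i j) (trans (t̂-scale q (mapH Y (byLabel ψ)) i j)
    (trans (solve 4 (λ q y a b → q :* (y :* a :+ b) := y :* (q :* a) :+ q :* b) refl q y _ _)
      (sym (+-cong (*-congˡ (d̂-Y (byLabel ψ) i j)) (ê-Y (byLabel ψ) i j)))))

  -- Summing out the top box turns `ψ` into `newBox ρ ψ` on the remaining column. The weight and the
  -- admissibility of that box depend on the topmost label below it, hence the induction needs an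
  -- arbitrary `ψ` that sees this label.
  column-sum : ∀ ρs → All (λ ρ → isEmp ρ ≡ false) ρs → ∀ ψ →
    sumLists (suc (length ρs)) (columnTerm ψ ρs) ≈ t̂ (byLabel ψ) (#AG ρs) (#δ ρs)
  column-sum [] [] ψ =
    solve 10 (λ α β γ δ y e₀ a b c d → let o = con (ℤ.+ 0) in
      o :* (:1 :* :1) :* e₀ :+ (:1 :* (α :* y) :* a :+ (:1 :* (β :* :1) :* b :+ (:1 :* (γ :* :1) :* c :+ (:1 :* (δ :* y) :* d :+ o))))
      := y :* (α :* a :+ δ :* d) :+ (β :* b :+ γ :* c))
      refl α β γ δ y (ψ emp 0 0) (ψ lα 1 0) (ψ lβ 0 0) (ψ lγ 1 0) (ψ lδ 0 1)
  column-sum (ρ ∷ ρs) (ρ≢emp ∷ all) ψ = begin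
    sumLabels (λ x → sumLists (suc (length ρs)) (λ xs → columnTerm ψ (ρ ∷ ρs) (x ∷ xs)))
      ≈⟨ sumLabels-swap (sumLists-cong′ (suc (length ρs))) (sumLists-lin (suc (length ρs)))
           (λ x xs → columnTerm ψ (ρ ∷ ρs) (x ∷ xs)) ⟨
    sumLists (suc (length ρs)) (λ xs → sumLabels (λ x → columnTerm ψ (ρ ∷ ρs) (x ∷ xs)))
      ≈⟨ sumLists-cong′ (suc (length ρs)) (λ xs → trans (sumLabels-cong (λ x → columnTerm-∷ ψ ρ ρs x xs))
           (*ˡ-out sumLabels-cong sumLabels-lin (columnFactor xs ρs)
             (λ x → step ρ ψ (firstLabeled xs) x (#AG (newTypes xs ρs)) (#δ (newTypes xs ρs))))) ⟩
    sumLists (suc (length ρs)) (columnTerm (newBox ρ ψ) ρs)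
      ≈⟨ column-sum ρs all (newBox ρ ψ) ⟩
    t̂ (byLabel (newBox ρ ψ)) (#AG ρs) (#δ ρs)
      ≈⟨ t̂-newBox ρ ρ≢emp ψ (#AG ρs) (#δ ρs) ⟩
    t̂ (byLabel ψ) (countAG ρ (#AG ρs)) (countδ ρ (#δ ρs)) ∎

  types-nonempty : ∀ {T} → All RowOK T → All (λ ρ → isEmp ρ ≡ false) (types T)
  types-nonempty []             = []
  types-nonempty ((_ , h) ∷ hs) = h ∷ types-nonempty hs

  t : G → G
  t φ = t̂ (const φ)

  iterate-t : ℕ → G → G
  iterate-t zero    φ = φ
  iterate-t (suc n) φ = iterate-t n (t φ)

  -- Summing out the leftmost column replaces `φ` by `t φ`, so `φ` has to be general although only
  -- the constant 1 is wanted in the end.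
  tableau-sum : ∀ n φ → sumFillings n (λ T → weight n T * φ (#AG (types T)) (#δ (types T))) ≈ iterate-t n φ 0 0
  tableau-sum zero    φ = solve 1 (λ x → :1 :* (:1 :* :1) :* x := x) refl _
  tableau-sum (suc n) φ = begin
    sumFillings (suc n) (λ T → weight (suc n) T * φ (#AG (types T)) (#δ (types T)))
      ≈⟨ sumFillings-glue n (λ T → weight (suc n) T * φ (#AG (types T)) (#δ (types T))) ⟩
    sumFillings n (λ T → sumLists (suc n) (λ col → weight (suc n) (glue col T)
      * φ (#AG (types (glue col T))) (#δ (types (glue col T)))))
      ≈⟨ sumFillings-cong n (λ T s → trans
           (sumLists-cong (suc n) (λ col len → trans
             (*-cong (weight-glue col s len) (reflexive (P.cong (λ ρs → φ (#AG ρs) (#δ ρs)) (types-glue col T))))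
             (*-assoc (weight n T) _ _)))
           (trans (*ˡ-out (sumLists-cong′ (suc n)) (sumLists-lin (suc n)) (weight n T) (columnTerm (λ _ → φ) (types T)))
             (collapse T s (isStaircase n T) P.refl))) ⟩
    sumFillings n (λ T → weight n T * t φ (#AG (types T)) (#δ (types T)))
      ≈⟨ tableau-sum n (t φ) ⟩
    iterate-t n (t φ) 0 0 ∎
    where
    collapse : ∀ T → Shape n T → ∀ b → isStaircase n T ≡ b →
      weight n T * sumLists (suc n) (columnTerm (λ _ → φ) (types T)) ≈ weight n T * t φ (#AG (types T)) (#δ (types T))
    collapse T s true eq = *-congˡ (trans
      (reflexive (P.cong (λ m → sumLists (suc m) (columnTerm (λ _ → φ) (types T)))
        (P.trans (P.sym (Shape-length s)) (P.sym (Listₚ.length-map firstLabeled T)))))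
      (column-sum (types T) (types-nonempty (staircase-rowsOK s eq)) (λ _ → φ)))
    collapse T s false eq = trans (*-congʳ w≈0) (trans (zeroˡ _) (sym (trans (*-congʳ w≈0) (zeroˡ _))))
      where
      w≈0 : weight n T ≈ 0#
      w≈0 = trans (*-congʳ (reflexive (P.cong ind eq))) (zeroˡ _)

  Z-iterate : ∀ n → Z F α β γ δ q n y ≈ iterate-t n (λ _ _ → 1#) 0 0
  Z-iterate n = trans (Z-weight n) (trans (sumFillings-cong′ n (λ T → sym (*-identityʳ _))) (tableau-sum n (λ _ _ → 1#)))

-- The q-Pochhammer denominators of the inner sums

module Denominators {ℓc ℓ : Level} (F : CommutativeRing ℓc ℓ) (q : CommutativeRing.Carrier F) where
  open CommutativeRing F hiding (zero)
  open IntegerSolver F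
  open LinComb F
  open Sums F
  open Newton F q
  open import Relation.Binary.Reasoning.Setoid setoid

  tail-Prod : ∀ E j l → tail E j l ≈ Prod l (λ i → E (suc (j ℕ.+ j ℕ.+ i)))
  tail-Prod E zero    l = refl
  tail-Prod E (suc j) l = trans (tail-Prod (shift₂ E) j l)
    (Prod-cong l (λ i _ → reflexive (P.cong (λ m → E (suc (suc m ℕ.+ i))) (P.sym (ℕₚ.+-suc j j)))))

  Prod-inverse : ∀ n {f g : ℕ → Carrier} → (∀ i → i < n → f i * g i ≈ 1#) → Prod n f * Prod n g ≈ 1#
  Prod-inverse n {f} {g} h = trans (sym (Prod-* n f g)) (Prod-1 n h)

  mid-inverse : ∀ j {E E⁻¹ : ℕ → Carrier} → (∀ m → suc m < j ℕ.+ j → E (suc m) * E⁻¹ (suc m) ≈ 1#) →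
                mid E j * mid E⁻¹ j ≈ 1#
  mid-inverse zero    h = *-identityˡ _
  mid-inverse (suc j) h = trans
    (solve 4 (λ a b c d → (a :* b) :* (c :* d) := (a :* c) :* (b :* d)) refl _ _ _ _)
    (trans (*-cong (h j (s≤s (ℕₚ.m≤n+m (suc j) j)))
      (mid-inverse j (λ m lt → h (suc (suc m)) (P.subst (suc (suc (suc m)) <_) (P.cong suc (P.sym (ℕₚ.+-suc j j))) (s≤s (s≤s lt))))))
      (*-identityˡ _))

  -- (q^{1-2j}/A ; q)_j = ∏_{m=j}^{2j-1} (-q^{-m}/A) (1 - A q^m), and the signs and powers of q
  -- collect to those of sg.
  mid-reverse : ∀ {q⁻¹} → q * q⁻¹ ≈ 1# → ∀ j A A⁻¹ → A * A⁻¹ ≈ 1# → ∀ E → (∀ m → E m ≈ ε A m) →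
    sg j * Prod j (λ i → 1# - q⁻¹ ^ (2 ℕ.* j) * q * A⁻¹ * q ^ i) ≈ q⁻¹ ^ (j ℕ.* j) * A⁻¹ ^ j * mid E j
  mid-reverse {q⁻¹} qq⁻¹ zero A A⁻¹ AA⁻¹ E E≈ = sym (*-identityʳ _)
  mid-reverse {q⁻¹} qq⁻¹ (suc j) A A⁻¹ AA⁻¹ E E≈ = begin
    - (R * sg j) * Prod (suc j) (λ i → 1# - q⁻¹ ^ (2 ℕ.* suc j) * q * A⁻¹ * q ^ i)
      ≈⟨ *-congˡ (Prod-snoc j _) ⟩
    - (R * sg j) * (Prod j (λ i → 1# - q⁻¹ ^ (2 ℕ.* suc j) * q * A⁻¹ * q ^ i) * (1# - q⁻¹ ^ (2 ℕ.* suc j) * q * A⁻¹ * R))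
      -- Since q^(-2(j+1)) / A = q^(-2j) / (A q²), the first j factors are those of the induction
      -- hypothesis at A q²; the factor with i = j yields `E (suc j)`.
      ≈⟨ *-congˡ (*-cong (Prod-cong j (λ i _ → +-congˡ (-‿cong (*-congʳ (trans (*-congʳ (*-congʳ pow))
           (solve 4 (λ p s q a → p :* (p :* s) :* q :* a := s :* q :* (a :* p :* p)) refl q⁻¹ (q⁻¹ ^ (2 ℕ.* j)) q A⁻¹))))))
           last) ⟩
    - (R * sg j) * (Pr * - (A⁻¹ * (q⁻¹ * r) * (1# - A * (q * R))))
      ≈⟨ solve 6 (λ R s p a e z → :- (R :* s) :* (p :* :- (a :* z :* e)) := (s :* p) :* (R :* a :* z :* e)) refl _ _ _ _ _ _ ⟩
    (sg j * Pr) * (R * A⁻¹ * (q⁻¹ * r) * (1# - A * (q * R)))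
      ≈⟨ *-cong (mid-reverse qq⁻¹ j (A * q * q) (A⁻¹ * q⁻¹ * q⁻¹) AA′ (shift₂ E)
           (λ m → trans (E≈ (suc (suc m))) (+-congˡ (-‿cong
              (solve 3 (λ A q z → A :* (q :* (q :* z)) := A :* q :* q :* z) refl A q _))))) (*-congˡ (sym (E≈ (suc j)))) ⟩
    (q⁻¹ ^ (j ℕ.* j) * (A⁻¹ * q⁻¹ * q⁻¹) ^ j * mid (shift₂ E) j) * (R * A⁻¹ * (q⁻¹ * r) * E (suc j))
      ≈⟨ *-congʳ (*-congʳ (*-congˡ (trans (^-* (A⁻¹ * q⁻¹) q⁻¹ j) (*-congʳ (^-* A⁻¹ q⁻¹ j))))) ⟩
    (q⁻¹ ^ (j ℕ.* j) * (A⁻¹ ^ j * r * r) * mid (shift₂ E) j) * (R * A⁻¹ * (q⁻¹ * r) * E (suc j))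
      ≈⟨ lincomb₁ (q⁻¹ ^ (j ℕ.* j) * (A⁻¹ ^ j * r * r) * mid (shift₂ E) j * A⁻¹ * q⁻¹ * E (suc j)) Rr
           (solve 8 (λ w z r m R a q e → (w :* (z :* r :* r) :* m) :* (R :* a :* (q :* r) :* e)
              := (q :* (r :* (r :* w))) :* (a :* z) :* (e :* m) :+ w :* (z :* r :* r) :* m :* a :* q :* e :* (R :* r :- :1))
            refl _ _ _ _ _ _ _ _) ⟩
    (q⁻¹ * (r * (r * q⁻¹ ^ (j ℕ.* j)))) * (A⁻¹ * A⁻¹ ^ j) * (E (suc j) * mid (shift₂ E) j)
      ≈⟨ *-congʳ (*-congʳ (sym square)) ⟩
    q⁻¹ ^ (suc j ℕ.* suc j) * A⁻¹ ^ suc j * mid E (suc j) ∎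
    where
    R = q ^ j
    r = q⁻¹ ^ j
    Pr = Prod j (λ i → 1# - q⁻¹ ^ (2 ℕ.* j) * q * (A⁻¹ * q⁻¹ * q⁻¹) * q ^ i)
    Rr : R * r ≈ 1#
    Rr = ^-inverse j qq⁻¹
    AA′ : A * q * q * (A⁻¹ * q⁻¹ * q⁻¹) ≈ 1#
    AA′ = trans (solve 4 (λ A q a p → A :* q :* q :* (a :* p :* p) := (A :* a) :* ((q :* p) :* (q :* p))) refl A q A⁻¹ q⁻¹)
            (trans (*-cong AA⁻¹ (trans (*-cong qq⁻¹ qq⁻¹) (*-identityˡ _))) (*-identityˡ _))
    pow : q⁻¹ ^ (2 ℕ.* suc j) ≈ q⁻¹ * (q⁻¹ * q⁻¹ ^ (2 ℕ.* j))
    pow = reflexive (P.cong (λ m → q⁻¹ * q⁻¹ ^ m) (ℕₚ.+-suc j (j ℕ.+ 0)))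
    square : q⁻¹ ^ (suc j ℕ.* suc j) ≈ q⁻¹ * (r * (r * q⁻¹ ^ (j ℕ.* j)))
    square = *-congˡ (trans (reflexive (P.cong (λ m → q⁻¹ ^ (j ℕ.+ m)) (ℕₚ.*-suc j j)))
      (trans (^-+ q⁻¹ j _) (*-congˡ (^-+ q⁻¹ j _))))
    pow₂ : q⁻¹ ^ (2 ℕ.* j) ≈ r * r
    pow₂ = trans (^-+ q⁻¹ j _) (*-congˡ (reflexive (P.cong (q⁻¹ ^_) (ℕₚ.+-identityʳ j))))
    last : 1# - q⁻¹ ^ (2 ℕ.* suc j) * q * A⁻¹ * R ≈ - (A⁻¹ * (q⁻¹ * r) * (1# - A * (q * R)))
    last = trans (+-congˡ (-‿cong (*-congʳ (*-congʳ (*-congʳ (trans pow (*-congˡ (*-congˡ pow₂))))))))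
      (lincomb₂ (- (q⁻¹ * r * A⁻¹)) (- 1#) hyp₁ hyp₂
        (solve 6 (λ q p r R A a →
          :1 :- p :* (p :* (r :* r)) :* q :* a :* R
          := :- (a :* (p :* r) :* (:1 :- A :* (q :* R)))
             :+ (:- (p :* r :* a)) :* ((q :* p) :* (R :* r) :- :1)
             :+ (:- :1) :* ((A :* a) :* ((q :* p) :* (R :* r)) :- :1)) refl q q⁻¹ r R A A⁻¹))
      where
      hyp₁ : (q * q⁻¹) * (R * r) ≈ 1#
      hyp₁ = trans (*-cong qq⁻¹ Rr) (*-identityˡ _)
      hyp₂ : (A * A⁻¹) * ((q * q⁻¹) * (R * r)) ≈ 1#
      hyp₂ = trans (*-cong AA⁻¹ hyp₁) (*-identityˡ _)

-- The formula, with all inverses given as data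

module _ {ℓc ℓ : Level} (F : CommutativeRing ℓc ℓ)
  (α β γ δ q y a b c d α⁻¹ β⁻¹ q⁻¹ y⁻¹ a⁻¹ r : CommutativeRing.Carrier F)
  (p⁻¹ ε⁻¹ ℓ⁻¹ Q⁻¹ : ℕ → CommutativeRing.Carrier F) where
  open CommutativeRing F hiding (zero)
  open Sums F
  open Newton F q

  module Core
    (αα⁻¹ : α * α⁻¹ ≈ 1#) (ββ⁻¹ : β * β⁻¹ ≈ 1#) (qq⁻¹ : q * q⁻¹ ≈ 1#) (yy⁻¹ : y * y⁻¹ ≈ 1#)
    (aa⁻¹ : a * a⁻¹ ≈ 1#) (rr⁻¹ : (1# - q) * r ≈ 1#)
    (a+c : α * (a + c) ≈ 1# - q - α + γ) (ac : α * (a * c) ≈ - γ)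
    (b+d : β * (b + d) ≈ 1# - q - β + δ) (bd : β * (b * d) ≈ - δ)
    (n : ℕ)
    (hp : ∀ m → m < n → p (suc m) * p⁻¹ (suc m) ≈ 1#)
    (hε : Inverses p⁻¹ n (a * a * y⁻¹) ε⁻¹)
    (hℓ : ∀ m → m < n → (1# - a * b * c * d * q ^ m) * ℓ⁻¹ m ≈ 1#)
    (hQ : ∀ k → k ≤ n → Prod k (λ m → 1# - a * b * c * d * q ^ m) * Q⁻¹ k ≈ 1#) where
    open IntegerSolver F
    open LinComb F
    open Words F α β γ δ q using (act; act-++; act-cong; act-lin; op; one; f; L; f-bulk; f-right; f-left)
    open Moments F q y b c d
    open Interpolation F q q⁻¹ a a⁻¹ y y⁻¹ p⁻¹ ε⁻¹ qq⁻¹ aa⁻¹ yy⁻¹ n hp hε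
    open TableauSums F α β γ δ q y using (t; iterate-t; Z-iterate)
    open import Relation.Binary.Reasoning.Setoid setoid

    -- `mom` unfolds words at the front, whereas `iterate-t` applies `t` to the functional first,
    -- which attaches the new letter at the end.
    mom-snoc : ∀ m ω → mom (suc m) ω ≈ mom m (λ u → y * ω (u ++ 𝐃 ∷ []) + 1# * ω (u ++ 𝐄 ∷ []))
    mom-snoc zero    ω = +-congˡ (sym (*-identityˡ _))
    mom-snoc (suc m) ω = +-cong (*-congˡ (mom-snoc m (λ u → ω (𝐃 ∷ u)))) (mom-snoc m (λ u → ω (𝐄 ∷ u)))

    iterate-mom : ∀ m φ → iterate-t m φ 0 0 ≈ mom m (λ u → act u φ 0 0)
    iterate-mom zero    φ = refl
    iterate-mom (suc m) φ = trans (iterate-mom m (t φ)) (trans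
      (mom-cong m (λ u _ → trans (act-cong u (λ i j → +-congˡ (sym (*-identityˡ _))) 0 0)
        (trans (act-lin u y 1# (op 𝐃 φ) (op 𝐄 φ) 0 0)
          (sym (+-cong (*-congˡ (reflexive (P.cong (λ χ → χ 0 0) (act-++ u (𝐃 ∷ []) φ))))
                       (*-congˡ (reflexive (P.cong (λ χ → χ 0 0) (act-++ u (𝐄 ∷ []) φ)))))))))
      (sym (mom-snoc m (λ u → act u φ 0 0))))

    Z-mom : Z F α β γ δ q n y ≈ mom n f
    Z-mom = trans (Z-iterate n) (iterate-mom n one)

    αβ⁻¹ : (α * β) * (α⁻¹ * β⁻¹) ≈ 1#
    αβ⁻¹ = trans (solve 4 (λ a b c d → (a :* b) :* (c :* d) := (a :* c) :* (b :* d)) refl _ _ _ _)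
             (trans (*-cong αα⁻¹ ββ⁻¹) (*-identityˡ _))

    -- By the products of the roots, `a c = - γ / α` and `b d = - δ / β`, so `γ δ = α β a b c d`.
    L-factor : ∀ m → L m ≈ α * β * (1# - a * b * c * d * q ^ m)
    L-factor m = lincomb₂ (q ^ m * (β * (b * d))) (- (γ * q ^ m)) ac bd
      (solve 9 (λ α β γ δ a b c d r →
        α :* β :- γ :* δ :* r := α :* β :* (:1 :- a :* b :* c :* d :* r)
          :+ r :* (β :* (b :* d)) :* (α :* (a :* c) :- :- γ)
          :+ (:- (γ :* r)) :* (β :* (b :* d) :- :- δ)) refl α β γ δ a b c d (q ^ m))

    L⁻¹ : ℕ → Carrier
    L⁻¹ m = α⁻¹ * β⁻¹ * ℓ⁻¹ m

    LL⁻¹ : ∀ m → m < n → L m * L⁻¹ m ≈ 1#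
    LL⁻¹ m m<n = trans (*-congʳ (L-factor m))
      (trans (solve 4 (λ a b c d → (a :* b) :* (c :* d) := (a :* c) :* (b :* d)) refl _ _ _ _)
        (trans (*-cong αβ⁻¹ (hℓ m m<n)) (*-identityˡ _)))

    Λ : ℕ → Carrier
    Λ zero    = 1#
    Λ (suc m) = Λ m * L⁻¹ m

    Λ-suc : ∀ m → m < n → L m * Λ (suc m) ≈ Λ m
    Λ-suc m m<n = trans (solve 3 (λ l Λ l′ → l :* (Λ :* l′) := Λ :* (l :* l′)) refl _ _ _)
      (trans (*-congˡ (LL⁻¹ m m<n)) (*-identityʳ _))

    -- Dividing by the product of the factors L turns f into a functional of the matrix ansatz proper.
    ω₀ : Functional
    ω₀ u = Λ (length u) * f u

    ω₀-length : ∀ u {m} → length u P.≡ m → ω₀ u ≈ Λ m * f u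
    ω₀-length u P.refl = refl

    length-++₁ : ∀ (u v : Word) l → length (u ++ l ∷ v) P.≡ suc (length u ℕ.+ length v)
    length-++₁ u v l = P.trans (Listₚ.length-++ u) (ℕₚ.+-suc (length u) (length v))

    length-++₂ : ∀ (u v : Word) l l′ → length (u ++ l ∷ l′ ∷ v) P.≡ suc (suc (length u ℕ.+ length v))
    length-++₂ u v l l′ = P.trans (length-++₁ u (l′ ∷ v) l) (P.cong suc (ℕₚ.+-suc (length u) (length v)))

    length-snoc : ∀ (u : Word) l → length (u ++ l ∷ []) P.≡ suc (length u)
    length-snoc u l = P.trans (length-++₁ u [] l) (P.cong suc (ℕₚ.+-identityʳ (length u)))

    Bulk-ω₀ : Bulk n ω₀
    Bulk-ω₀ u v le = begin
      ω₀ (u ++ 𝐃 ∷ 𝐄 ∷ v)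
        ≈⟨ ω₀-length (u ++ 𝐃 ∷ 𝐄 ∷ v) (length-++₂ u v 𝐃 𝐄) ⟩
      Λ (suc (suc m)) * f (u ++ 𝐃 ∷ 𝐄 ∷ v)
        ≈⟨ *-congˡ (trans (f-bulk u v) (+-congˡ (*-congʳ (reflexive (P.cong L (ℕₚ.+-suc (length u) (length v))))))) ⟩
      Λ (suc (suc m)) * (q * f (u ++ 𝐄 ∷ 𝐃 ∷ v) + L (suc m) * (f (u ++ 𝐃 ∷ v) + f (u ++ 𝐄 ∷ v)))
        ≈⟨ lincomb₁ (f (u ++ 𝐃 ∷ v) + f (u ++ 𝐄 ∷ v)) (Λ-suc (suc m) m<n)
             (solve 7 (λ Λ₂ q x l y z Λ₁ → Λ₂ :* (q :* x :+ l :* (y :+ z))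
               := q :* (Λ₂ :* x) :+ (Λ₁ :* y :+ Λ₁ :* z) :+ (y :+ z) :* (l :* Λ₂ :- Λ₁)) refl _ _ _ _ _ _ _) ⟩
      q * (Λ (suc (suc m)) * f (u ++ 𝐄 ∷ 𝐃 ∷ v)) + (Λ (suc m) * f (u ++ 𝐃 ∷ v) + Λ (suc m) * f (u ++ 𝐄 ∷ v))
        ≈⟨ +-cong (*-congˡ (ω₀-length (u ++ 𝐄 ∷ 𝐃 ∷ v) (length-++₂ u v 𝐄 𝐃)))
             (+-cong (ω₀-length (u ++ 𝐃 ∷ v) (length-++₁ u v 𝐃)) (ω₀-length (u ++ 𝐄 ∷ v) (length-++₁ u v 𝐄))) ⟨
      q * ω₀ (u ++ 𝐄 ∷ 𝐃 ∷ v) + (ω₀ (u ++ 𝐃 ∷ v) + ω₀ (u ++ 𝐄 ∷ v)) ∎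
      where
      m = length u ℕ.+ length v
      m<n : suc m < n
      m<n = P.subst (_≤ n) (P.trans (ℕₚ.+-suc (length u) (suc (length v))) (P.cong suc (ℕₚ.+-suc (length u) (length v)))) le

    -- The sum and the product of the roots give `α (1 + a) (1 + c) = 1 - q` and `a c = - γ / α`.
    -- With `β`, `δ`, `b`, `d` in place of `α`, `γ`, `a`, `c` the same lemma serves the right
    -- boundary.
    boundary : ∀ {α α⁻¹ γ a c x z w} → α * α⁻¹ ≈ 1# → α * (a + c) ≈ 1# - q - α + γ → α * (a * c) ≈ - γ →
               α * x - γ * z ≈ w → (1# - q) * (x + a * c * z) ≈ (1# + a) * (1# + c) * w
    boundary {α} {α⁻¹} {γ} {a} {c} {x} {z} {w} h₀ h₁ h₂ h₃ =
      lincomb₁ ((1# + a) * (1# + c) * w - (1# - q) * (x + a * c * z)) h₀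
        (lincomb₃ (- (α⁻¹ * w)) ((1# - q) * α⁻¹ * z - α⁻¹ * w) (α⁻¹ * (1# - q)) h₁ h₂ h₃
          (solve 9 (λ α α′ γ a c x z w q →
            (:1 :- q) :* (x :+ a :* c :* z)
            := (:1 :+ a) :* (:1 :+ c) :* w
               :+ ((:1 :+ a) :* (:1 :+ c) :* w :- (:1 :- q) :* (x :+ a :* c :* z)) :* (α :* α′ :- :1)
               :+ (:- (α′ :* w)) :* (α :* (a :+ c) :- (:1 :- q :- α :+ γ))
               :+ ((:1 :- q) :* α′ :* z :- α′ :* w) :* (α :* (a :* c) :- :- γ)
               :+ α′ :* (:1 :- q) :* (α :* x :- γ :* z :- w)) refl α α⁻¹ γ a c x z w q))

    normalise : ∀ {α γ x z} m {w} → m < n → α * x - γ * z ≈ L m * w →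
                α * (Λ (suc m) * x) - γ * (Λ (suc m) * z) ≈ Λ m * w
    normalise {α} {γ} {x} {z} m {w} m<n h = lincomb₂ (Λ (suc m)) w h (Λ-suc m m<n)
      (solve 8 (λ α γ x z w l Λ₁ Λ₀ → α :* (Λ₁ :* x) :- γ :* (Λ₁ :* z)
        := Λ₀ :* w :+ Λ₁ :* (α :* x :- γ :* z :- l :* w) :+ w :* (l :* Λ₁ :- Λ₀)) refl α γ x z w (L m) (Λ (suc m)) (Λ m))

    Left-ω₀ : Left n a ω₀
    Left-ω₀ u u<n = boundary αα⁻¹ a+c ac (normalise (length u) u<n (f-left u))

    Right-ω₀ : Right n ω₀
    Right-ω₀ u u<n = boundary ββ⁻¹ b+d bd
      (trans (+-cong (*-congˡ (ω₀-length (u ++ 𝐃 ∷ []) (length-snoc u 𝐃)))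
                     (-‿cong (*-congˡ (ω₀-length (u ++ 𝐄 ∷ []) (length-snoc u 𝐄)))))
        (normalise (length u) u<n (f-right u)))

    aₖ aₖ⁻¹ : ℕ → Carrier
    aₖ k = q ^ k * a
    aₖ⁻¹ k = q⁻¹ ^ k * a⁻¹

    aₖaₖ⁻¹ : ∀ k → aₖ k * aₖ⁻¹ k ≈ 1#
    aₖaₖ⁻¹ k = trans (solve 4 (λ a b c d → (a :* b) :* (c :* d) := (a :* c) :* (b :* d)) refl _ _ _ _)
      (trans (*-cong (^-inverse k qq⁻¹) aa⁻¹) (*-identityˡ _))

    ω : ℕ → Functional
    ω zero    = ω₀
    ω (suc k) = next (aₖ k) (aₖ⁻¹ k) (ω k)

    -- After `k` steps the relations survive up to length n - k. `M-base` applies `next-[]` at k <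
    -- n, where one letter is still available.
    ω-properties : ∀ k m → k ℕ.+ m P.≡ n → Bulk m (ω k) × Right m (ω k) × Left m (aₖ k) (ω k)
    ω-properties zero    m P.refl = Bulk-ω₀ , Right-ω₀ , Left-cong {n} {ω = ω₀} (sym (*-identityˡ a)) Left-ω₀
    ω-properties (suc k) m eq with ω-properties k (suc m) (P.trans (ℕₚ.+-suc k m) eq)
    ... | bulk , right , left =
      Bulk-next (aₖ k) (aₖ⁻¹ k) {ω = ω k} bulk , Right-next (aₖ k) (aₖ⁻¹ k) {ω = ω k} right ,
      Left-cong {m} {ω = ω (suc k)} (sym (*-assoc _ _ _)) (Left-next {ω = ω k} (aₖaₖ⁻¹ k) bulk left)

    -- The inverse of κ_0 ⋯ κ_{k-1}; it compensates the normalisation of `T`.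
    ρ⁻¹ : ℕ → Carrier
    ρ⁻¹ zero    = 1#
    ρ⁻¹ (suc k) = ρ⁻¹ k * - (y⁻¹ * aₖ k)

    M : ℕ → ℕ → Carrier
    M k r = ρ⁻¹ k * ((1# - q) ^ r * mom r (ω k))

    M-suc : ∀ k r → M k (suc r) ≈ x k * M k r + κ k * M (suc k) r
    M-suc k r = lincomb₂ (ρ⁻¹ k * (1# - q) ^ r) (- (ρ⁻¹ k * ((1# - q) ^ r * mom r (ω (suc k)))))
      (mom-next r (aₖ k) (aₖ⁻¹ k) (ω k)) κ-inverse
      (solve 12 (λ ρ p z m₁ x m m′ y y′ a a′ q → let κ = :- (y :* a′ :* q) in
        ρ :* (p :* z :* m₁) := x :* (ρ :* (z :* m)) :+ κ :* ((ρ :* a) :* (z :* m′))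
          :+ ρ :* z :* (p :* m₁ :- (x :* m :+ m′))
          :+ (:- (ρ :* (z :* m′))) :* (κ :* a :- :1))
        refl (ρ⁻¹ k) (1# - q) ((1# - q) ^ r) (mom (suc r) (ω k)) (x k) (mom r (ω k)) (mom r (ω (suc k)))
        y y⁻¹ (- (y⁻¹ * aₖ k)) a⁻¹ (q⁻¹ ^ k))
      where
      κ-inverse : κ k * - (y⁻¹ * aₖ k) ≈ 1#
      κ-inverse = trans (solve 6 (λ y a′ q′ y′ q a → :- (y :* a′ :* q′) :* :- (y′ :* (q :* a)) := (y :* y′) :* ((q :* a) :* (q′ :* a′))) refl _ _ _ _ _ _)
        (trans (*-cong yy⁻¹ (aₖaₖ⁻¹ k)) (*-identityˡ _))

    -- This is `next-[]` at A = a q^k. The new normalising factor `- A / y` turns `- (y - A c) / A`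
    -- into `1 - A c / y`, which gives the symbol in `a c / y`.
    M-base : ∀ k → k < n → (1# - a * b * c * d * q ^ k) * M (suc k) 0
      ≈ (1# - a * b * q ^ k) * (1# - a * c * y⁻¹ * q ^ k) * (1# - a * d * q ^ k) * M k 0
    M-base k k<n with ω-properties k (suc (n ∸ suc k)) (P.trans (ℕₚ.+-suc k _) (ℕₚ.m+[n∸m]≡n k<n))
    ... | _ , right , left = lincomb₃ (ρ⁻¹ k * - (y⁻¹ * aₖ k))
      (ρ⁻¹ k * (y⁻¹ * (y - aₖ k * c) * (1# - aₖ k * b) * (1# - aₖ k * d) * ω k []))
      (ρ⁻¹ k * (1# - aₖ k * b) * (1# - aₖ k * d) * ω k [])
      (next-[] {ω = ω k} (aₖaₖ⁻¹ k) right left) (aₖaₖ⁻¹ k) yy⁻¹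
      (solve 12 (λ a b c d y y′ r ρ w′ w a′ r′ → let A = r :* a ; A′ = r′ :* a′ in
        (:1 :- a :* b :* c :* d :* r) :* ((ρ :* (:- (y′ :* A))) :* (:1 :* w′))
        := (:1 :- a :* b :* r) :* (:1 :- a :* c :* y′ :* r) :* (:1 :- a :* d :* r) :* (ρ :* (:1 :* w))
           :+ (ρ :* (:- (y′ :* A))) :* ((:1 :- A :* b :* c :* d) :* w′ :- (:- A′) :* ((y :- A :* c) :* (:1 :- A :* b) :* (:1 :- A :* d) :* w))
           :+ (ρ :* (y′ :* (y :- A :* c) :* (:1 :- A :* b) :* (:1 :- A :* d) :* w)) :* (A :* A′ :- :1)
           :+ (ρ :* (:1 :- A :* b) :* (:1 :- A :* d) :* w) :* (y :* y′ :- :1))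
        refl a b c d y y⁻¹ (q ^ k) (ρ⁻¹ k) (ω (suc k) []) (ω k []) a⁻¹ (q⁻¹ ^ k))

    qP : Carrier → ℕ → Carrier
    qP z k = Prod k (λ m → 1# - z * q ^ m)

    M-product : ∀ k → k ≤ n → qP (a * b * c * d) k * M k 0 ≈ qP (a * b) k * qP (a * c * y⁻¹) k * qP (a * d) k
    M-product zero    _   = solve 0 (:1 :* (:1 :* (:1 :* (:1 :* :1))) := :1 :* :1 :* :1) refl
    M-product (suc k) k<n = begin
      qP (a * b * c * d) (suc k) * M (suc k) 0
        ≈⟨ *-congʳ (Prod-snoc k _) ⟩
      qP (a * b * c * d) k * (1# - a * b * c * d * q ^ k) * M (suc k) 0
        ≈⟨ trans (*-assoc _ _ _) (*-congˡ (M-base k k<n)) ⟩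
      qP (a * b * c * d) k * (e₁ * e₂ * e₃ * M k 0)
        ≈⟨ solve 5 (λ p x y z m → p :* (x :* y :* z :* m) := x :* y :* z :* (p :* m)) refl _ _ _ _ _ ⟩
      e₁ * e₂ * e₃ * (qP (a * b * c * d) k * M k 0)
        ≈⟨ *-congˡ (M-product k (ℕₚ.<⇒≤ k<n)) ⟩
      e₁ * e₂ * e₃ * (qP (a * b) k * qP (a * c * y⁻¹) k * qP (a * d) k)
        ≈⟨ solve 6 (λ x y z p r s → x :* y :* z :* (p :* r :* s) := (p :* x) :* (r :* y) :* (s :* z)) refl _ _ _ _ _ _ ⟩
      (qP (a * b) k * e₁) * (qP (a * c * y⁻¹) k * e₂) * (qP (a * d) k * e₃)
        ≈⟨ *-cong (*-cong (Prod-snoc k _) (Prod-snoc k _)) (Prod-snoc k _) ⟨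
      qP (a * b) (suc k) * qP (a * c * y⁻¹) (suc k) * qP (a * d) (suc k) ∎
      where
      e₁ = 1# - a * b * q ^ k
      e₂ = 1# - a * c * y⁻¹ * q ^ k
      e₃ = 1# - a * d * q ^ k

    M-value : ∀ k → k ≤ n → M k 0 ≈ qP (a * b) k * qP (a * c * y⁻¹) k * qP (a * d) k * Q⁻¹ k
    M-value k k≤n = lincomb₂ (- M k 0) (Q⁻¹ k) (hQ k k≤n) (M-product k k≤n)
      (solve 4 (λ m p p′ r → m := r :* p′ :+ (:- m) :* (p :* p′ :- :1) :+ p′ :* (p :* m :- r))
        refl (M k 0) (qP (a * b * c * d) k) (Q⁻¹ k) _)

    Λ-inverse : ∀ m → m ≤ n → qP (a * b * c * d) m * (α * β) ^ m * Λ m ≈ 1#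
    Λ-inverse zero    _   = solve 0 (:1 :* :1 :* :1 := :1) refl
    Λ-inverse (suc m) m<n = begin
      qP (a * b * c * d) (suc m) * (α * β) ^ suc m * Λ (suc m)
        ≈⟨ *-congʳ (*-congʳ (Prod-snoc m _)) ⟩
      (qP (a * b * c * d) m * e) * (α * β * (α * β) ^ m) * Λ (suc m)
        ≈⟨ solve 5 (λ p e k z l → (p :* e) :* (k :* z) :* l := p :* z :* ((k :* e) :* l)) refl _ e (α * β) _ _ ⟩
      qP (a * b * c * d) m * (α * β) ^ m * (α * β * e * Λ (suc m))
        ≈⟨ *-congˡ (trans (*-congʳ (sym (L-factor m))) (Λ-suc m m<n)) ⟩
      qP (a * b * c * d) m * (α * β) ^ m * Λ m
        ≈⟨ Λ-inverse m (ℕₚ.<⇒≤ m<n) ⟩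
      1# ∎
      where e = 1# - a * b * c * d * q ^ m

    Z-formula : Z F α β γ δ q n y ≈ qP (a * b * c * d) n * (α * β * r) ^ n *
      Sum (suc n) (λ k → T n k * (qP (a * b) k * qP (a * c * y⁻¹) k * qP (a * d) k * Q⁻¹ k))
    Z-formula = begin
      Z F α β γ δ q n y
        ≈⟨ Z-mom ⟩
      mom n f
        -- A factor 1 is inserted in split form: `Λ n` normalises `f` to `ω₀`, the power of `1 - q`
        -- enters `M 0 n`, and the rest is the prefactor of the statement.
        ≈⟨ trans (sym (*-identityˡ _)) (*-congʳ (sym (trans (*-cong (Λ-inverse n ℕₚ.≤-refl) (^-inverse n rr⁻¹)) (*-identityˡ _)))) ⟩
      (qP (a * b * c * d) n * (α * β) ^ n * Λ n) * ((1# - q) ^ n * r ^ n) * mom n f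
        ≈⟨ solve 6 (λ p z l s t m → (p :* z :* l) :* (s :* t) :* m := p :* (z :* t) :* (:1 :* (s :* (l :* m)))) refl _ _ _ _ _ _ ⟩
      qP (a * b * c * d) n * ((α * β) ^ n * r ^ n) * (1# * ((1# - q) ^ n * (Λ n * mom n f)))
        ≈⟨ *-cong (*-congˡ (sym (^-* (α * β) r n))) (*-congˡ (*-congˡ (sym mom-ω₀))) ⟩
      qP (a * b * c * d) n * (α * β * r) ^ n * M 0 n
        ≈⟨ *-congˡ (trans (reflexive (P.cong (M 0) (P.sym (ℕₚ.+-identityʳ n)))) (newton M M-suc n ℕₚ.≤-refl 0)) ⟩
      qP (a * b * c * d) n * (α * β * r) ^ n * Sum (suc n) (λ k → T n k * M k 0)
        ≈⟨ *-congˡ (Sum-cong (suc n) (λ k k≤n → *-congˡ {T n k} (M-value k (ℕₚ.≤-pred k≤n)))) ⟩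
      qP (a * b * c * d) n * (α * β * r) ^ n *
        Sum (suc n) (λ k → T n k * (qP (a * b) k * qP (a * c * y⁻¹) k * qP (a * d) k * Q⁻¹ k)) ∎
      where
      mom-ω₀ : mom n ω₀ ≈ Λ n * mom n f
      mom-ω₀ = trans (mom-cong n (λ u len → trans (ω₀-length u len) (sym (trans (+-congˡ (zeroˡ _)) (+-identityʳ _)))))
        (trans (mom-lin n (Λ n) 0# f f) (trans (+-congˡ (zeroˡ _)) (+-identityʳ _)))

-- From nonvanishing denominators to the stated formula

-- Each exponent from 1 to 2n - 1 occurs in the last q-Pochhammer symbol of a denominator with k =
-- n: those up to n with j = 0, and n + 1 + e with j = e + 1. Hence the hypotheses at k = n alone
-- make every `ε` that is needed invertible.
exponent-split : ∀ m n → suc m < n ℕ.+ n → ∃[ j ] ∃[ i ] (j ≤ n × i < n ∸ j × suc (j ℕ.+ j ℕ.+ i) P.≡ suc m)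
exponent-split m n lt with m ℕ.<? n
... | yes m<n = 0 , m , z≤n , m<n , P.refl
... | no  m≮n with ℕₚ.m≤n⇒∃[o]m+o≡n (ℕₚ.≮⇒≥ m≮n)
... | e , P.refl with ℕₚ.m≤n⇒∃[o]m+o≡n (ℕₚ.+-cancelˡ-≤ n (suc (suc e)) n
        (P.subst (_≤ n ℕ.+ n) (P.sym (P.trans (ℕₚ.+-suc n (suc e)) (P.cong suc (ℕₚ.+-suc n e)))) lt))
... | f , P.refl = suc e , f , s≤s (ℕₚ.≤-trans (ℕₚ.m≤m+n e f) (ℕₚ.n≤1+n _))
  , P.subst (f <_) (P.sym (P.trans (P.cong (_∸ e) (P.sym (ℕₚ.+-suc e f))) (ℕₚ.m+n∸m≡n e (suc f)))) ℕₚ.≤-refl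
  , P.cong suc (solve 2 (λ e f → (con 1 :+ e) :+ (con 1 :+ e) :+ f := con 2 :+ e :+ f :+ e) P.refl e f)
  where open +-*-Solver

exponent-bound : ∀ {i j k n} → j ≤ k → k ≤ n → i < k ∸ j → suc (j ℕ.+ j ℕ.+ i) < n ℕ.+ n
exponent-bound {i} {j} {k} {n} j≤k k≤n i< = begin-strict
  suc (j ℕ.+ j ℕ.+ i)     ≡⟨ P.cong suc (ℕₚ.+-assoc j j i) ⟩
  suc (j ℕ.+ (j ℕ.+ i))   ≡⟨ ℕₚ.+-suc j (j ℕ.+ i) ⟨
  j ℕ.+ suc (j ℕ.+ i)     ≤⟨ ℕₚ.+-monoʳ-≤ j j+i<k ⟩
  j ℕ.+ k                 <⟨ ℕₚ.+-monoˡ-< k (ℕₚ.≤-trans (s≤s (ℕₚ.m≤m+n j i)) j+i<k) ⟩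
  k ℕ.+ k                 ≤⟨ ℕₚ.+-mono-≤ k≤n k≤n ⟩
  n ℕ.+ n                 ∎
  where
  open ℕₚ.≤-Reasoning
  j+i<k : suc (j ℕ.+ i) ≤ k
  j+i<k = P.subst (_≤ k) (ℕₚ.+-suc j i) (P.subst (j ℕ.+ suc i ≤_) (ℕₚ.m+[n∸m]≡n j≤k) (ℕₚ.+-monoʳ-≤ j i<))

module _ {ℓc ℓ : Level} (F : CommutativeRing ℓc ℓ) where
  open CommutativeRing F hiding (zero)
  open Sums F
  open IntegerSolver F
  open LinComb F

  module Field (inv : Carrier → Carrier) (inverse : ∀ x → ¬ (x ≈ 0#) → x * inv x ≈ 1#) where
    open import Relation.Binary.Reasoning.Setoid setoid

    nonzeroˡ : ∀ {x y} → ¬ (x * y ≈ 0#) → ¬ (x ≈ 0#)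
    nonzeroˡ xy≉0 x≈0 = xy≉0 (trans (*-congʳ x≈0) (zeroˡ _))

    nonzeroʳ : ∀ {x y} → ¬ (x * y ≈ 0#) → ¬ (y ≈ 0#)
    nonzeroʳ xy≉0 y≈0 = xy≉0 (trans (*-congˡ y≈0) (zeroʳ _))

    *-nonzero : ∀ {x y} → ¬ (x ≈ 0#) → ¬ (y ≈ 0#) → ¬ (x * y ≈ 0#)
    *-nonzero {x} {y} x≉0 y≉0 xy≈0 = y≉0 (lincomb₂ (inv x) (- y) xy≈0 (inverse x x≉0)
      (solve 3 (λ x y i → y := con (ℤ.+ 0) :+ i :* (x :* y :- con (ℤ.+ 0)) :+ (:- y) :* (x :* i :- :1)) refl x y (inv x)))

    -- The ring axioms allow the trivial ring; the nonzero `z` excludes it, since `x ≈ 0` would give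
    -- `z = x y z = 0`.
    invertible-nonzero : ∀ {x y z} → ¬ (z ≈ 0#) → x * y ≈ 1# → ¬ (x ≈ 0#)
    invertible-nonzero {x} {y} {z} z≉0 xy≈1 x≈0 = z≉0 (lincomb₂ (y * z) (- z) x≈0 xy≈1
      (solve 3 (λ x y z → z := con (ℤ.+ 0) :+ (y :* z) :* (x :- con (ℤ.+ 0)) :+ (:- z) :* (x :* y :- :1)) refl x y z))

    inv-unique : ∀ {x z} → ¬ (x ≈ 0#) → x * z ≈ 1# → inv x ≈ z
    inv-unique {x} {z} x≉0 xz≈1 = lincomb₂ z (- inv x) (inverse x x≉0) xz≈1
      (solve 3 (λ x z i → i := z :+ z :* (x :* i :- :1) :+ (:- i) :* (x :* z :- :1)) refl x z (inv x))

    Prod-nonzero : ∀ n {f} → ¬ (Prod n f ≈ 0#) → ∀ i → i < n → ¬ (f i ≈ 0#)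
    Prod-nonzero (suc n) h zero    _         = nonzeroˡ h
    Prod-nonzero (suc n) h (suc i) (s≤s i<n) = Prod-nonzero n (nonzeroʳ h) i i<n

    qPoch-Prod : ∀ z q m → qPoch F z q m P.≡ Prod m (λ i → 1# - z * q ^ i)
    qPoch-Prod z q m = prodR-map-applyUpTo (λ i → 1# - z * q ^ i) id m

    module Roots {α γ q s} (2≉0 : ¬ (1# + 1# ≈ 0#)) (α≉0 : ¬ (α ≈ 0#))
      (s² : s * s ≈ (1# - q - α + γ) * (1# - q - α + γ) + (1# + 1# + 1# + 1#) * α * γ) where

      private
        h : Carrier
        h = inv ((1# + 1#) * α)
        hyp : (1# + 1#) * α * h ≈ 1#
        hyp = inverse _ (*-nonzero 2≉0 α≉0)

      -- Vieta's relations for `α z² - (1 - q - α + γ) z - γ`, freed of division. The chosen square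
      -- root `s` enters the later argument only through them.
      roots-sum : α * (((1# - q - α + γ) + s) * h + ((1# - q - α + γ) - s) * h) ≈ 1# - q - α + γ
      roots-sum = lincomb₁ (1# - q - α + γ) hyp
        (solve 4 (λ α p s h → α :* ((p :+ s) :* h :+ (p :- s) :* h) := p :+ p :* ((:1 :+ :1) :* α :* h :- :1))
          refl α (1# - q - α + γ) s h)

      roots-product : α * ((((1# - q - α + γ) + s) * h) * (((1# - q - α + γ) - s) * h)) ≈ - γ
      roots-product = lincomb₂ (- (α * h * h)) (- (γ * ((1# + 1#) * α * h + 1#))) s² hyp
        (solve 5 (λ α γ p s h → α :* (((p :+ s) :* h) :* ((p :- s) :* h))
          := :- γ :+ (:- (α :* h :* h)) :* (s :* s :- (p :* p :+ (:1 :+ :1 :+ :1 :+ :1) :* α :* γ))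
             :+ (:- (γ :* ((:1 :+ :1) :* α :* h :+ :1))) :* ((:1 :+ :1) :* α :* h :- :1))
          refl α γ (1# - q - α + γ) s h)

    module Formula (α β γ δ q y a b c d : Carrier)
      (α≉0 : ¬ (α ≈ 0#)) (β≉0 : ¬ (β ≈ 0#)) (q≉0 : ¬ (q ≈ 0#)) (1-q≉0 : ¬ (1# - q ≈ 0#))
      (y≉0 : ¬ (y ≈ 0#)) (a≉0 : ¬ (a ≈ 0#))
      (a+c : α * (a + c) ≈ 1# - q - α + γ) (ac : α * (a * c) ≈ - γ)
      (b+d : β * (b + d) ≈ 1# - q - β + δ) (bd : β * (b * d) ≈ - δ)
      (n : ℕ)
      (nonzero : ∀ k → k ≤ n → ¬ (qPoch F (a * b * c * d) q k ≈ 0#) ×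
         (∀ j → j ≤ k → ¬ (denomKJ F inv q y α β a b c d k j ≈ 0#))) where
      open Newton F q
      open Denominators F q

      A A⁻¹ : Carrier
      A = a * a * inv y
      A⁻¹ = inv A

      inv-y≉0 : ¬ (inv y ≈ 0#)
      inv-y≉0 = invertible-nonzero y≉0 (trans (*-comm _ _) (inverse y y≉0))

      AA⁻¹ : A * A⁻¹ ≈ 1#
      AA⁻¹ = inverse A (*-nonzero (*-nonzero a≉0 a≉0) inv-y≉0)

      -- The statement writes the reciprocal of a²/y in two ways: as one inverse in the inner terms,
      -- as `y` times the inverse of `a * a` in the denominators.
      A⁻¹-alt : y * inv (a * a) ≈ A⁻¹
      A⁻¹-alt = sym (inv-unique (*-nonzero (*-nonzero a≉0 a≉0) inv-y≉0)
        (trans (solve 4 (λ s y′ y s′ → s :* y′ :* (y :* s′) := (y :* y′) :* (s :* s′)) refl (a * a) (inv y) y (inv (a * a)))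
          (trans (*-cong (inverse y y≉0) (inverse _ (*-nonzero a≉0 a≉0))) (*-identityˡ _))))

      den : ℕ → ℕ → Carrier
      den = denomKJ F inv q y α β a b c d

      tail-qPoch : ∀ j l → qPoch F (a * a * q ^ (1 ℕ.+ 2 ℕ.* j) * inv y) q l ≈ tail (ε A) j l
      tail-qPoch j l = trans (reflexive (qPoch-Prod _ q l)) (trans
        (Prod-cong l (λ i _ → +-congˡ (-‿cong (trans
          (solve 4 (λ s r y z → s :* r :* y :* z := s :* y :* (r :* z)) refl (a * a) _ (inv y) _)
          (*-congˡ (trans (sym (^-+ q (1 ℕ.+ 2 ℕ.* j) i))
            (reflexive (P.cong (λ m → q ^ (suc (j ℕ.+ m ℕ.+ i))) (ℕₚ.+-identityʳ j)))))))))
        (sym (tail-Prod (ε A) j l)))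

      fact-qPoch : ∀ j → qPoch F q q j ≈ fact p j
      fact-qPoch j = reflexive (qPoch-Prod q q j)

      ε⁻¹ p⁻¹ : ℕ → Carrier
      ε⁻¹ m = inv (ε A m)
      p⁻¹ m = inv (p m)

      hp : ∀ m → m < n → p (suc m) * p⁻¹ (suc m) ≈ 1#
      hp m m<n = inverse _ (Prod-nonzero n
        -- The denominator with k = n and j = 0 contains (q;q)_n and with it all factors `p 1`, ...,
        -- `p n`.
        (λ e → nonzeroˡ (nonzeroʳ (proj₂ (nonzero n ℕₚ.≤-refl) 0 z≤n)) (trans (fact-qPoch n) e)) m m<n)

      hε : Inverses p⁻¹ n A ε⁻¹
      hε m lt with exponent-split m n lt
      ... | j , i , j≤n , i< , eq = inverse _ (λ e → Prod-nonzero (n ∸ j)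
        (λ z → nonzeroʳ (nonzeroʳ (proj₂ (nonzero n ℕₚ.≤-refl) j j≤n)) (trans (tail-qPoch j (n ∸ j)) (trans (tail-Prod (ε A) j (n ∸ j)) z)))
        i i< (trans (reflexive (P.cong (ε A) eq)) e))

      denom-inverse : ∀ j k → j ≤ k → k ≤ n → denom p (ε A) j (k ∸ j) * denom p⁻¹ ε⁻¹ j (k ∸ j) ≈ 1#
      denom-inverse j k j≤k k≤n = trans
        (solve 8 (λ a b c d a′ b′ c′ d′ → a :* b :* (c :* d) :* (a′ :* b′ :* (c′ :* d′)) := (a :* a′) :* (b :* b′) :* ((c :* c′) :* (d :* d′)))
          refl _ _ _ _ _ _ _ _)
        (trans (*-cong
          (trans (*-cong (Prod-inverse j (λ i i<j → hp i (ℕₚ.≤-trans i<j (ℕₚ.≤-trans j≤k k≤n))))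
                         (Prod-inverse (k ∸ j) (λ i i< → hp i (ℕₚ.≤-trans i< (ℕₚ.≤-trans (ℕₚ.m∸n≤m k j) k≤n)))))
                 (*-identityˡ _))
          (trans (*-cong (mid-inverse j (λ m lt → hε m (ℕₚ.≤-trans lt (ℕₚ.+-mono-≤ (ℕₚ.≤-trans j≤k k≤n) (ℕₚ.≤-trans j≤k k≤n)))))
                         (trans (*-cong (tail-Prod (ε A) j (k ∸ j)) (tail-Prod ε⁻¹ j (k ∸ j)))
                            (Prod-inverse (k ∸ j) tail-inverse)))
                 (*-identityˡ _))) (*-identityˡ _))
        where
        tail-inverse : ∀ i → i < k ∸ j → ε A (suc (j ℕ.+ j ℕ.+ i)) * ε⁻¹ (suc (j ℕ.+ j ℕ.+ i)) ≈ 1#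
        tail-inverse i i< = hε (j ℕ.+ j ℕ.+ i) (exponent-bound j≤k k≤n i<)

      den-denom : ∀ j k → sg j * den k j ≈ inv q ^ (j ℕ.* j) * A⁻¹ ^ j * denom p (ε A) j (k ∸ j)
      den-denom j k = begin
        sg j * den k j
          ≈⟨ *-congˡ (*-cong (*-cong (fact-qPoch j) reversed) (*-cong (fact-qPoch (k ∸ j)) (tail-qPoch j (k ∸ j)))) ⟩
        sg j * (fact p j * Pr * (fact p (k ∸ j) * tail (ε A) j (k ∸ j)))
          ≈⟨ solve 5 (λ s a w b t → s :* (a :* w :* (b :* t)) := (s :* w) :* (a :* b :* t)) refl _ _ _ _ _ ⟩
        (sg j * Pr) * (fact p j * fact p (k ∸ j) * tail (ε A) j (k ∸ j))
          ≈⟨ *-congʳ (mid-reverse (inverse q q≉0) j A A⁻¹ AA⁻¹ (ε A) (λ _ → refl)) ⟩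
        (inv q ^ (j ℕ.* j) * A⁻¹ ^ j * mid (ε A) j) * (fact p j * fact p (k ∸ j) * tail (ε A) j (k ∸ j))
          ≈⟨ solve 5 (λ w m a b t → (w :* m) :* (a :* b :* t) := w :* (a :* b :* (m :* t))) refl _ _ _ _ _ ⟩
        inv q ^ (j ℕ.* j) * A⁻¹ ^ j * denom p (ε A) j (k ∸ j) ∎
        where
        Pr : Carrier
        Pr = Prod j (λ i → 1# - inv q ^ (2 ℕ.* j) * q * A⁻¹ * q ^ i)
        reversed : qPoch F (inv q ^ (2 ℕ.* j) * q * y * inv (a * a)) q j ≈ Pr
        reversed = trans (reflexive (qPoch-Prod _ q j)) (Prod-cong j (λ i _ → +-congˡ (-‿cong (*-congʳ
          (trans (*-assoc _ _ _) (*-congˡ A⁻¹-alt))))))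

      -- This is `den-denom` turned upside down: with both denominators invertible, the sign `sg j`
      -- passes to the numerator, and the powers of q and A in the inner term are absorbed.
      innerTerm-coef : ∀ k j → j ≤ k → k ≤ n →
        inv q ^ (j ℕ.* j) * A⁻¹ ^ j * inv (den k j) ≈ coef p⁻¹ ε⁻¹ k j
      innerTerm-coef k j j≤k k≤n = lincomb₃ (- (W * inv (den k j))) (sg j * D′) (- (inv (den k j) * D′))
        (denom-inverse j k j≤k k≤n) (inverse _ (proj₂ (nonzero k k≤n) j j≤k)) (den-denom j k)
        (solve 6 (λ W di D D′ s den → W :* di := s :* D′ :+ (:- (W :* di)) :* (D :* D′ :- :1)
           :+ s :* D′ :* (den :* di :- :1) :+ (:- (di :* D′)) :* (s :* den :- W :* D))
         refl W (inv (den k j)) (denom p (ε A) j (k ∸ j)) D′ (sg j) (den k j))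
        where
        W = inv q ^ (j ℕ.* j) * A⁻¹ ^ j
        D′ = denom p⁻¹ ε⁻¹ j (k ∸ j)

      hℓ : ∀ m → m < n → (1# - a * b * c * d * q ^ m) * inv (1# - a * b * c * d * q ^ m) ≈ 1#
      hℓ m m<n = inverse _ (Prod-nonzero (suc m) {λ m → 1# - a * b * c * d * q ^ m}
        (λ e → proj₁ (nonzero (suc m) m<n) (trans (reflexive (qPoch-Prod (a * b * c * d) q (suc m))) e)) m ℕₚ.≤-refl)

      open Core F α β γ δ q y a b c d (inv α) (inv β) (inv q) (inv y) (inv a) (inv (1# - q)) p⁻¹ ε⁻¹
        (λ m → inv (1# - a * b * c * d * q ^ m)) (λ k → inv (qPoch F (a * b * c * d) q k))
        (inverse α α≉0) (inverse β β≉0) (inverse q q≉0) (inverse y y≉0) (inverse a a≉0) (inverse _ 1-q≉0)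
        a+c ac b+d bd n hp hε
        hℓ
        (λ k k≤n → trans (*-congʳ (reflexive (P.sym (qPoch-Prod (a * b * c * d) q k)))) (inverse _ (proj₁ (nonzero k k≤n))))
        using (qP; Z-formula)
      open Interpolation F q (inv q) a (inv a) y (inv y) p⁻¹ ε⁻¹
        (inverse q q≉0) (inverse a a≉0) (inverse y y≉0) n hp hε using (S; T)

      inner-sum : ∀ k → k ≤ n → sumR F (map (innerTerm F inv q y α β a b c d n k) (upTo (suc k))) ≈ S n k
      inner-sum k k≤n = trans (reflexive (sumR-map-applyUpTo (innerTerm F inv q y α β a b c d n k) id (suc k)))
        (Sum-cong (suc k) (λ j j≤k → trans
          (solve 4 (λ v w z d → v :* w :* z :* d := (v :* w :* d) :* z) refl _ _ _ _)
          (*-cong (innerTerm-coef k j (ℕₚ.≤-pred j≤k) k≤n)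
            (^-cong n (+-congˡ {1# + y + q ^ j * a}
              (solve 3 (λ s y a⁻¹ → s :* y :* a⁻¹ := y :* (s :* a⁻¹)) refl (inv q ^ j) y (inv a)))))))

      outer-term : ∀ k → k ≤ n → T n k * (qP (a * b) k * qP (a * c * inv y) k * qP (a * d) k * inv (qPoch F (a * b * c * d) q k))
                                 ≈ outerTerm F inv q y α β a b c d n k
      outer-term k k≤n = trans
        (solve 3 (λ r s w → r :* s :* w := w :* r :* s) refl (q ^ k) (S n k) _)
        (*-cong (*-congʳ (*-congʳ (*-cong (*-cong (poch (a * b)) (poch (a * c * inv y))) (poch (a * d))))) (sym (inner-sum k k≤n)))
        where
        poch : ∀ z → qP z k ≈ qPoch F z q k
        poch z = reflexive (P.sym (qPoch-Prod z q k))

      Z-RHS : Z F α β γ δ q n y ≈ RHS F inv q y α β a b c d n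
      Z-RHS = trans Z-formula (*-cong
        (*-congʳ (reflexive (P.sym (qPoch-Prod (a * b * c * d) q n))))
        (trans (Sum-cong (suc n) (λ k k≤n → outer-term k (ℕₚ.≤-pred k≤n)))
          (reflexive (P.sym (sumR-map-applyUpTo (outerTerm F inv q y α β a b c d n) id (suc n))))))

theorem1p13 : {ℓc ℓ : Level} (F : CommutativeRing ℓc ℓ) →
    let open CommutativeRing F in
    (inv : Carrier → Carrier) →
    (∀ x → ¬ (x ≈ 0#) → x * inv x ≈ 1#) →
    (α β γ δ q y sα sβ : Carrier) →
    ¬ ((1# + 1#) ≈ 0#) → ¬ (α ≈ 0#) → ¬ (β ≈ 0#) → ¬ (q ≈ 0#) →
    ¬ ((1# - q) ≈ 0#) → ¬ (y ≈ 0#) →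
    sα * sα ≈ (1# - q - α + γ) * (1# - q - α + γ) + (1# + 1# + 1# + 1#) * α * γ →
    sβ * sβ ≈ (1# - q - β + δ) * (1# - q - β + δ) + (1# + 1# + 1# + 1#) * β * δ →
    let a = ((1# - q - α + γ) + sα) * inv ((1# + 1#) * α)
        b = ((1# - q - β + δ) + sβ) * inv ((1# + 1#) * β)
        c = ((1# - q - α + γ) - sα) * inv ((1# + 1#) * α)
        d = ((1# - q - β + δ) - sβ) * inv ((1# + 1#) * β)
    in ¬ (a ≈ 0#) →
    (n : ℕ) →
    (∀ k → k ≤ n →
      ¬ (qPoch F (a * b * c * d) q k ≈ 0#) ×
      (∀ j → j ≤ k → ¬ (denomKJ F inv q y α β a b c d k j ≈ 0#))) →
    Z F α β γ δ q n y ≈ RHS F inv q y α β a b c d n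
theorem1p13 F inv inverse α β γ δ q y sα sβ 2≉0 α≉0 β≉0 q≉0 1-q≉0 y≉0 sα² sβ² a≉0 n nonzero =
  Formula.Z-RHS α β γ δ q y _ _ _ _ α≉0 β≉0 q≉0 1-q≉0 y≉0 a≉0
    A.roots-sum A.roots-product B.roots-sum B.roots-product n nonzero
  where
  open Field F inv inverse
  module A = Roots 2≉0 α≉0 sα²
  module B = Roots 2≉0 β≉0 sβ²
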